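{- Let $$C=1+\sqrt{2}\sum_{k=1}^{\infty}\frac{(-1)^{k+1}}{(2k-1)8^k}\binom{2k}{k}\,\zeta\!\left(k-\tfrac{1}{2}\right).$$ Then, as $n\to\infty$ through the odd positive integers, $$\sum_{j=1}^n(-1)^{j+1}\sqrt{jn}=\frac{n}{2}+C\sqrt{n}+\frac{1}{8}+O\left(\frac{1}{n}\right).$$ That is, there is an absolute constant $K>0$ such that for every odd integer $n\geq 1$, $$\left|\sum_{j=1}^n(-1)^{j+1}\sqrt{jn}-\frac{n}{2}-C\sqrt{n}-\frac{1}{8}\right|\leq\frac{K}{n}.$$
   Context: $\zeta(s)$ denotes the Riemann zeta function; for $k=1$ the value $\zeta(1/2)$ is that of its analytic continuation. Numerically, $C\simeq 0.3801$. -}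

module Defs where

open import Data.Nat as ℕ using (ℕ; zero; suc; NonZero; z≤n; s≤s)
import Data.Nat.Properties as ℕP
open import Data.Nat.Combinatorics using (_C_)
import Data.Integer as ℤ
open import Data.Integer using (ℤ; +_; -1ℤ)
import Data.Integer.Properties as ℤP
open import Data.Rational as ℚ using (ℚ; 0ℚ; 1ℚ; ½; _/_; toℚᵘ)
import Data.Rational.Properties as ℚP
import Data.Rational.Unnormalised as ℚᵘ
import Data.Rational.Unnormalised.Properties as ℚᵘP
open import Data.Rational.Solver using (module +-*-Solver)
import Data.Integer.Solver as ℤS
open import Data.Empty using (⊥-elim)
open import Data.Product using (_×_; _,_; ∃-syntax; Σ-syntax)
open import Data.Sum using (inj₁; inj₂)
open import Relation.Nullary using (yes; no)
open import Relation.Binary.PropositionalEquality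

------------------------------------------------------------------------
-- Real numbers: Cauchy sequences of rationals, with the equivalence _≈_

Cauchy : (ℕ → ℚ) → Set
Cauchy x = ∀ ε → 0ℚ ℚ.< ε →
  ∃[ N ] (∀ m n → N ℕ.≤ m → N ℕ.≤ n → ℚ.∣ x m ℚ.- x n ∣ ℚ.< ε)

record ℝ : Set where
  constructor mkℝ
  field
    seq    : ℕ → ℚ
    cauchy : Cauchy seq

open ℝ public

infix  4 _≈_ _≤_ _<_
infixl 6 _+_ _-_
infixl 7 _*_
infix  8 -_

_≈_ : ℝ → ℝ → Set
x ≈ y = ∀ ε → 0ℚ ℚ.< ε →
  ∃[ N ] (∀ n → N ℕ.≤ n → ℚ.∣ seq x n ℚ.- seq y n ∣ ℚ.< ε)

_≤_ : ℝ → ℝ → Set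
x ≤ y = ∀ ε → 0ℚ ℚ.< ε →
  ∃[ N ] (∀ n → N ℕ.≤ n → seq x n ℚ.< seq y n ℚ.+ ε)

_<_ : ℝ → ℝ → Set
x < y = ∃[ ε ] (0ℚ ℚ.< ε ×
  ∃[ N ] (∀ n → N ℕ.≤ n → seq x n ℚ.+ ε ℚ.< seq y n))

private
  half-pos : ∀ {ε} → 0ℚ ℚ.< ε → 0ℚ ℚ.< ½ ℚ.* ε
  half-pos 0<ε = ℚP.*-monoʳ-<-pos ½ 0<ε

  halves : ∀ ε → ½ ℚ.* ε ℚ.+ ½ ℚ.* ε ≡ ε
  halves ε = trans (sym (ℚP.*-distribʳ-+ ε ½ ½)) (ℚP.*-identityˡ ε)

  const-cauchy : ∀ q → Cauchy (λ _ → q)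
  const-cauchy q ε 0<ε = 0 , λ _ _ _ _ →
    subst (λ d → ℚ.∣ d ∣ ℚ.< ε) (sym (ℚP.+-inverseʳ q)) 0<ε

  +-cauchy : ∀ {x y} → Cauchy x → Cauchy y → Cauchy (λ n → x n ℚ.+ y n)
  +-cauchy {x} {y} cx cy ε 0<ε
    with cx (½ ℚ.* ε) (half-pos 0<ε) | cy (½ ℚ.* ε) (half-pos 0<ε)
  ... | M , hM | N , hN = M ℕ.⊔ N , λ m n m≥ n≥ → begin-strict
      ℚ.∣ (x m ℚ.+ y m) ℚ.- (x n ℚ.+ y n) ∣        ≡⟨ cong ℚ.∣_∣ (rearrange (x m) (y m) (x n) (y n)) ⟩
      ℚ.∣ (x m ℚ.- x n) ℚ.+ (y m ℚ.- y n) ∣        ≤⟨ ℚP.∣p+q∣≤∣p∣+∣q∣ (x m ℚ.- x n) (y m ℚ.- y n) ⟩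
      ℚ.∣ x m ℚ.- x n ∣ ℚ.+ ℚ.∣ y m ℚ.- y n ∣      <⟨ ℚP.+-mono-<
        (hM m n (ℕP.≤-trans (ℕP.m≤m⊔n M N) m≥) (ℕP.≤-trans (ℕP.m≤m⊔n M N) n≥))
        (hN m n (ℕP.≤-trans (ℕP.m≤n⊔m M N) m≥) (ℕP.≤-trans (ℕP.m≤n⊔m M N) n≥)) ⟩
      ½ ℚ.* ε ℚ.+ ½ ℚ.* ε                          ≡⟨ halves ε ⟩
      ε                                            ∎
    where
    open ℚP.≤-Reasoning
    rearrange : ∀ a b c d → (a ℚ.+ b) ℚ.- (c ℚ.+ d) ≡ (a ℚ.- c) ℚ.+ (b ℚ.- d)
    rearrange = solve 4 (λ a b c d → (a :+ b) :- (c :+ d) := (a :- c) :+ (b :- d)) refl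
      where open +-*-Solver

  neg-cauchy : ∀ {x} → Cauchy x → Cauchy (λ n → ℚ.- x n)
  neg-cauchy {x} cx ε 0<ε with cx ε 0<ε
  ... | N , h = N , λ m n m≥ n≥ → subst (ℚ._< ε)
      (trans (sym (ℚP.∣-p∣≡∣p∣ (x m ℚ.- x n)))
             (cong ℚ.∣_∣ (ℚP.neg-distrib-+ (x m) (ℚ.- x n))))
      (h m n m≥ n≥)

  ∣p∣≤∣p-q∣+∣q∣ : ∀ p q → ℚ.∣ p ∣ ℚ.≤ ℚ.∣ p ℚ.- q ∣ ℚ.+ ℚ.∣ q ∣
  ∣p∣≤∣p-q∣+∣q∣ p q = subst (λ r → ℚ.∣ r ∣ ℚ.≤ ℚ.∣ p ℚ.- q ∣ ℚ.+ ℚ.∣ q ∣)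
      (solve 2 (λ p q → (p :- q) :+ q := p) refl p q)
      (ℚP.∣p+q∣≤∣p∣+∣q∣ (p ℚ.- q) q)
    where open +-*-Solver

  ∣p-q∣< : ∀ p q {ε} → p ℚ.< q ℚ.+ ε → q ℚ.< p ℚ.+ ε → ℚ.∣ p ℚ.- q ∣ ℚ.< ε
  ∣p-q∣< p q {ε} h₁ h₂ with ℚP.∣p∣≡p∨∣p∣≡-p (p ℚ.- q)
  ... | inj₁ e = subst₂ ℚ._<_ (sym e)
      (solve 2 (λ q ε → q :+ ε :- q := ε) refl q ε) (ℚP.+-monoˡ-< (ℚ.- q) h₁)
    where open +-*-Solver
  ... | inj₂ e = subst₂ ℚ._<_ (trans (solve 2 (λ p q → q :- p := :- (p :- q)) refl p q) (sym e))
      (solve 2 (λ p ε → p :+ ε :- p := ε) refl p ε) (ℚP.+-monoˡ-< (ℚ.- p) h₂)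
    where open +-*-Solver

  abs-cauchy : ∀ {x} → Cauchy x → Cauchy (λ n → ℚ.∣ x n ∣)
  abs-cauchy {x} cx ε 0<ε with cx ε 0<ε
  ... | N , h = N , λ m n m≥ n≥ → bound m n (h m n m≥ n≥) (h n m n≥ m≥)
    where
    below : ∀ p q → ℚ.∣ p ℚ.- q ∣ ℚ.< ε → ℚ.∣ p ∣ ℚ.< ℚ.∣ q ∣ ℚ.+ ε
    below p q h = ℚP.≤-<-trans (∣p∣≤∣p-q∣+∣q∣ p q)
      (subst (ℚ.∣ p ℚ.- q ∣ ℚ.+ ℚ.∣ q ∣ ℚ.<_) (ℚP.+-comm ε ℚ.∣ q ∣)
        (ℚP.+-monoˡ-< ℚ.∣ q ∣ h))
    bound : ∀ m n → ℚ.∣ x m ℚ.- x n ∣ ℚ.< ε → ℚ.∣ x n ℚ.- x m ∣ ℚ.< ε →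
            ℚ.∣ ℚ.∣ x m ∣ ℚ.- ℚ.∣ x n ∣ ∣ ℚ.< ε
    bound m n h₁ h₂ = ∣p-q∣< ℚ.∣ x m ∣ ℚ.∣ x n ∣ (below (x m) (x n) h₁) (below (x n) (x m) h₂)

  bounded : ∀ {x} → Cauchy x →
    ∃[ B ] (0ℚ ℚ.< B × ∃[ N ] (∀ n → N ℕ.≤ n → ℚ.∣ x n ∣ ℚ.< B))
  bounded {x} cx with cx 1ℚ (ℚP.positive⁻¹ 1ℚ)
  ... | N , h = 1ℚ ℚ.+ ℚ.∣ x N ∣
      , ℚP.+-mono-<-≤ (ℚP.positive⁻¹ 1ℚ) (ℚP.0≤∣p∣ (x N))
      , N
      , λ n n≥ → ℚP.≤-<-trans (∣p∣≤∣p-q∣+∣q∣ (x n) (x N))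
                   (ℚP.+-monoˡ-< ℚ.∣ x N ∣ (h n N n≥ ℕP.≤-refl))

  scale : ∀ B → 0ℚ ℚ.< B → ∀ ε → 0ℚ ℚ.< ε →
          ∃[ δ ] (0ℚ ℚ.< δ × δ ℚ.* B ≡ ε)
  scale B 0<B ε 0<ε = ε ℚ.* r
      , ℚP.<-respˡ-≡ (ℚP.*-zeroˡ r) (ℚP.*-monoˡ-<-pos r 0<ε)
      , trans (ℚP.*-assoc ε r B) (trans (cong (ε ℚ.*_) (ℚP.*-inverseˡ B)) (ℚP.*-identityʳ ε))
    where
    instance
      posB : ℚ.Positive B
      posB = ℚ.positive 0<B
      nzB : ℚ.NonZero B
      nzB = ℚP.pos⇒nonZero B
    r : ℚ
    r = ℚ.1/ B
    instance
      posr : ℚ.Positive r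
      posr = ℚP.1/pos⇒pos B

  *-distribʳ-- : ∀ r p q → p ℚ.* r ℚ.- q ℚ.* r ≡ (p ℚ.- q) ℚ.* r
  *-distribʳ-- r p q = trans (cong (p ℚ.* r ℚ.+_) (ℚP.neg-distribˡ-* q r))
                             (sym (ℚP.*-distribʳ-+ r p (ℚ.- q)))

  ∣pq∣< : ∀ p q B {δ} → 0ℚ ℚ.< B → ℚ.∣ p ∣ ℚ.< δ → ℚ.∣ q ∣ ℚ.< B → ℚ.∣ p ℚ.* q ∣ ℚ.< δ ℚ.* B
  ∣pq∣< p q B {δ} 0<B hp hq = begin-strict
      ℚ.∣ p ℚ.* q ∣          ≡⟨ ℚP.∣p*q∣≡∣p∣*∣q∣ p q ⟩
      ℚ.∣ p ∣ ℚ.* ℚ.∣ q ∣    ≤⟨ ℚP.*-monoˡ-≤-nonNeg ℚ.∣ p ∣ {{ℚP.∣-∣-nonNeg p}} (ℚP.<⇒≤ hq) ⟩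
      ℚ.∣ p ∣ ℚ.* B          <⟨ ℚP.*-monoˡ-<-pos B {{ℚ.positive 0<B}} hp ⟩
      δ ℚ.* B                ∎
    where open ℚP.≤-Reasoning

  *-diff : ∀ a b c d → a ℚ.* b ℚ.- c ℚ.* d ≡ (a ℚ.- c) ℚ.* b ℚ.+ (b ℚ.- d) ℚ.* c
  *-diff a b c d = trans
      (through (a ℚ.* b) (c ℚ.* b) (c ℚ.* d))
      (cong₂ ℚ._+_ (*-distribʳ-- b a c)
        (trans (cong₂ ℚ._-_ (ℚP.*-comm c b) (ℚP.*-comm c d)) (*-distribʳ-- c b d)))
    where
    through : ∀ u v w → u ℚ.- w ≡ (u ℚ.- v) ℚ.+ (v ℚ.- w)
    through = solve 3 (λ u v w → u :- w := (u :- v) :+ (v :- w)) refl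
      where open +-*-Solver

  *-close : ∀ a b c d {A B δ γ ε} → 0ℚ ℚ.< A → 0ℚ ℚ.< B →
    δ ℚ.* B ≡ ½ ℚ.* ε → γ ℚ.* A ≡ ½ ℚ.* ε →
    ℚ.∣ a ℚ.- c ∣ ℚ.< δ → ℚ.∣ b ℚ.- d ∣ ℚ.< γ → ℚ.∣ b ∣ ℚ.< B → ℚ.∣ c ∣ ℚ.< A →
    ℚ.∣ a ℚ.* b ℚ.- c ℚ.* d ∣ ℚ.< ε
  *-close a b c d {A} {B} {δ} {γ} {ε} 0<A 0<B eδ eγ ha hb hB hA = begin-strict
      ℚ.∣ a ℚ.* b ℚ.- c ℚ.* d ∣
        ≡⟨ cong ℚ.∣_∣ (*-diff a b c d) ⟩
      ℚ.∣ (a ℚ.- c) ℚ.* b ℚ.+ (b ℚ.- d) ℚ.* c ∣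
        ≤⟨ ℚP.∣p+q∣≤∣p∣+∣q∣ ((a ℚ.- c) ℚ.* b) ((b ℚ.- d) ℚ.* c) ⟩
      ℚ.∣ (a ℚ.- c) ℚ.* b ∣ ℚ.+ ℚ.∣ (b ℚ.- d) ℚ.* c ∣
        <⟨ ℚP.+-mono-< (∣pq∣< (a ℚ.- c) b B 0<B ha hB) (∣pq∣< (b ℚ.- d) c A 0<A hb hA) ⟩
      δ ℚ.* B ℚ.+ γ ℚ.* A
        ≡⟨ cong₂ ℚ._+_ eδ eγ ⟩
      ½ ℚ.* ε ℚ.+ ½ ℚ.* ε
        ≡⟨ halves ε ⟩
      ε ∎
    where open ℚP.≤-Reasoning

  *-cauchy : ∀ {x y} → Cauchy x → Cauchy y → Cauchy (λ n → x n ℚ.* y n)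
  *-cauchy {x} {y} cx cy ε 0<ε =
    let A , 0<A , M₁ , hA = bounded {x} cx
        B , 0<B , M₂ , hB = bounded {y} cy
        δ , 0<δ , eδ = scale B 0<B (½ ℚ.* ε) (half-pos 0<ε)
        γ , 0<γ , eγ = scale A 0<A (½ ℚ.* ε) (half-pos 0<ε)
        N₁ , hx = cx δ 0<δ
        N₂ , hy = cy γ 0<γ
        M = M₁ ℕ.⊔ M₂
        N = N₁ ℕ.⊔ N₂
    in M ℕ.⊔ N , λ m n m≥ n≥ →
      *-close (x m) (y m) (x n) (y n) 0<A 0<B eδ eγ
        (hx m n (ℕP.m⊔n≤o⇒m≤o N₁ N₂ (ℕP.m⊔n≤o⇒n≤o M N m≥))
                (ℕP.m⊔n≤o⇒m≤o N₁ N₂ (ℕP.m⊔n≤o⇒n≤o M N n≥)))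
        (hy m n (ℕP.m⊔n≤o⇒n≤o N₁ N₂ (ℕP.m⊔n≤o⇒n≤o M N m≥))
                (ℕP.m⊔n≤o⇒n≤o N₁ N₂ (ℕP.m⊔n≤o⇒n≤o M N n≥)))
        (hB m (ℕP.m⊔n≤o⇒n≤o M₁ M₂ (ℕP.m⊔n≤o⇒m≤o M N m≥)))
        (hA n (ℕP.m⊔n≤o⇒m≤o M₁ M₂ (ℕP.m⊔n≤o⇒m≤o M N n≥)))

fromℚ : ℚ → ℝ
fromℚ q = mkℝ (λ _ → q) (const-cauchy q)

0ℝ 1ℝ : ℝ
0ℝ = fromℚ 0ℚ
1ℝ = fromℚ 1ℚ

_+_ : ℝ → ℝ → ℝ
x + y = mkℝ (λ n → seq x n ℚ.+ seq y n) (+-cauchy {seq x} {seq y} (cauchy x) (cauchy y))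

-_ : ℝ → ℝ
- x = mkℝ (λ n → ℚ.- seq x n) (neg-cauchy {seq x} (cauchy x))

_-_ : ℝ → ℝ → ℝ
x - y = x + (- y)

_*_ : ℝ → ℝ → ℝ
x * y = mkℝ (λ n → seq x n ℚ.* seq y n) (*-cauchy {seq x} {seq y} (cauchy x) (cauchy y))

∣_∣ : ℝ → ℝ
∣ x ∣ = mkℝ (λ n → ℚ.∣ seq x n ∣) (abs-cauchy {seq x} (cauchy x))

-- ⌊√ n ⌋ is the largest r with r * r ≤ n.
⌊√_⌋ : ℕ → ℕ
⌊√ zero ⌋  = 0
⌊√ suc n ⌋ with suc ⌊√ n ⌋ ℕ.* suc ⌊√ n ⌋ ℕ.≤? suc n
... | yes _ = suc ⌊√ n ⌋
... | no  _ = ⌊√ n ⌋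

⌊√⌋-lower : ∀ n → ⌊√ n ⌋ ℕ.* ⌊√ n ⌋ ℕ.≤ n
⌊√⌋-lower zero = z≤n
⌊√⌋-lower (suc n) with suc ⌊√ n ⌋ ℕ.* suc ⌊√ n ⌋ ℕ.≤? suc n
... | yes p = p
... | no  _ = ℕP.m≤n⇒m≤1+n (⌊√⌋-lower n)

⌊√⌋-upper : ∀ n → n ℕ.< suc ⌊√ n ⌋ ℕ.* suc ⌊√ n ⌋
⌊√⌋-upper zero = s≤s z≤n
⌊√⌋-upper (suc n) with suc ⌊√ n ⌋ ℕ.* suc ⌊√ n ⌋ ℕ.≤? suc n
... | yes _ = ℕP.≤-<-trans (⌊√⌋-upper n)
                (ℕP.*-mono-< {suc ⌊√ n ⌋} (ℕP.n<1+n _) (ℕP.n<1+n _))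
... | no ¬p = ℕP.≰⇒> ¬p

-- √n rounded down to a multiple of 1/(k+1)
√approx : ℕ → ℕ → ℚ
√approx n k = + ⌊√ n ℕ.* (suc k ℕ.* suc k) ⌋ / suc k

private
  square-cancel-< : ∀ {a b} → a ℕ.* a ℕ.< b ℕ.* b → a ℕ.< b
  square-cancel-< {a} {b} h with a ℕ.<? b
  ... | yes p = p
  ... | no ¬p = ⊥-elim (ℕP.<⇒≱ h (ℕP.*-mono-≤ (ℕP.≮⇒≥ ¬p) (ℕP.≮⇒≥ ¬p)))

  √-cross : ∀ n k m → ⌊√ n ℕ.* (suc k ℕ.* suc k) ⌋ ℕ.* suc m
                    ℕ.< suc ⌊√ n ℕ.* (suc m ℕ.* suc m) ⌋ ℕ.* suc k
  √-cross n k m = square-cancel-< (begin-strict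
      (p ℕ.* M) ℕ.* (p ℕ.* M)                ≡⟨ ℕP.[m*n]*[o*p]≡[m*o]*[n*p] p M p M ⟩
      (p ℕ.* p) ℕ.* (M ℕ.* M)                ≤⟨ ℕP.*-monoˡ-≤ (M ℕ.* M) (⌊√⌋-lower (n ℕ.* (K ℕ.* K))) ⟩
      (n ℕ.* (K ℕ.* K)) ℕ.* (M ℕ.* M)        ≡⟨ ℕP.*-assoc n (K ℕ.* K) (M ℕ.* M) ⟩
      n ℕ.* ((K ℕ.* K) ℕ.* (M ℕ.* M))        ≡⟨ cong (n ℕ.*_) (ℕP.*-comm (K ℕ.* K) (M ℕ.* M)) ⟩
      n ℕ.* ((M ℕ.* M) ℕ.* (K ℕ.* K))        ≡⟨ ℕP.*-assoc n (M ℕ.* M) (K ℕ.* K) ⟨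
      (n ℕ.* (M ℕ.* M)) ℕ.* (K ℕ.* K)        <⟨ ℕP.*-monoˡ-< (K ℕ.* K) (⌊√⌋-upper (n ℕ.* (M ℕ.* M))) ⟩
      (suc q ℕ.* suc q) ℕ.* (K ℕ.* K)        ≡⟨ ℕP.[m*n]*[o*p]≡[m*o]*[n*p] (suc q) (suc q) K K ⟩
      (suc q ℕ.* K) ℕ.* (suc q ℕ.* K)        ∎)
    where
    open ℕP.≤-Reasoning
    K = suc k
    M = suc m
    p = ⌊√ n ℕ.* (K ℕ.* K) ⌋
    q = ⌊√ n ℕ.* (M ℕ.* M) ⌋

  frac-mono-< : ∀ a k b m → a ℕ.* suc m ℕ.< b ℕ.* suc k → + a / suc k ℚ.< + b / suc m
  frac-mono-< a k b m h = ℚP.toℚᵘ-cancel-< (begin-strict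
      toℚᵘ (+ a / suc k)   ≃⟨ ℚP.toℚᵘ-fromℚᵘ (ℚᵘ.mkℚᵘ (+ a) k) ⟩
      ℚᵘ.mkℚᵘ (+ a) k      <⟨ ℚᵘ.*<* (subst₂ ℤ._<_ (ℤP.pos-* a (suc m)) (ℤP.pos-* b (suc k)) (ℤ.+<+ h)) ⟩
      ℚᵘ.mkℚᵘ (+ b) m      ≃⟨ ℚP.toℚᵘ-fromℚᵘ (ℚᵘ.mkℚᵘ (+ b) m) ⟨
      toℚᵘ (+ b / suc m)   ∎)
    where open ℚᵘP.≤-Reasoning

  frac-suc : ∀ a m → + suc a / suc m ≡ + a / suc m ℚ.+ + 1 / suc m
  frac-suc a m = ℚP.toℚᵘ-injective (begin-equality
      toℚᵘ (+ suc a / suc m)                      ≃⟨ ℚP.toℚᵘ-fromℚᵘ (ℚᵘ.mkℚᵘ (+ suc a) m) ⟩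
      ℚᵘ.mkℚᵘ (+ suc a) m                         ≃⟨ ℚᵘ.*≡* (cross (+ a) (+ suc m)) ⟩
      ℚᵘ.mkℚᵘ (+ a) m ℚᵘ.+ ℚᵘ.mkℚᵘ (+ 1) m        ≃⟨ ℚᵘP.+-cong (ℚP.toℚᵘ-fromℚᵘ (ℚᵘ.mkℚᵘ (+ a) m))
                                                                 (ℚP.toℚᵘ-fromℚᵘ (ℚᵘ.mkℚᵘ (+ 1) m)) ⟨
      toℚᵘ (+ a / suc m) ℚᵘ.+ toℚᵘ (+ 1 / suc m)  ≃⟨ ℚP.toℚᵘ-homo-+ (+ a / suc m) (+ 1 / suc m) ⟨
      toℚᵘ (+ a / suc m ℚ.+ + 1 / suc m)          ∎)
    where
    open ℚᵘP.≤-Reasoning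
    cross : ∀ x y → (+ 1 ℤ.+ x) ℤ.* (y ℤ.* y) ≡ (x ℤ.* y ℤ.+ + 1 ℤ.* y) ℤ.* y
    cross = solve 2 (λ x y → (con (+ 1) :+ x) :* (y :* y) := (x :* y :+ con (+ 1) :* y) :* y) refl
      where open ℤS.+-*-Solver

  archimedean : ∀ ε → 0ℚ ℚ.< ε → ∃[ N ] (∀ n → N ℕ.≤ n → + 1 / suc n ℚ.< ε)
  archimedean ε@(ℚ.mkℚ (+ zero) d c) 0<ε = ⊥-elim (ℤP.<-irrefl refl (ℚP.drop-*<* 0<ε))
  archimedean ε@(ℚ.mkℚ (ℤ.-[1+ a ]) d c) 0<ε with ℚP.drop-*<* 0<ε
  ... | ()
  archimedean ε@(ℚ.mkℚ (+ suc a) d c) 0<ε = suc d , λ n n≥ → subst (+ 1 / suc n ℚ.<_)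
    (ℚP.↥p/↧p≡p ε)
    (frac-mono-< 1 n (suc a) d (begin-strict
      1 ℕ.* suc d      ≡⟨ ℕP.*-identityˡ (suc d) ⟩
      suc d            <⟨ s≤s n≥ ⟩
      suc n            ≤⟨ ℕP.m≤m+n (suc n) (a ℕ.* suc n) ⟩
      suc a ℕ.* suc n  ∎))
    where open ℕP.≤-Reasoning

√-step : ∀ n k m → √approx n k ℚ.< √approx n m ℚ.+ + 1 / suc m
√-step n k m = subst (√approx n k ℚ.<_)
    (frac-suc ⌊√ n ℕ.* (suc m ℕ.* suc m) ⌋ m)
    (frac-mono-< ⌊√ n ℕ.* (suc k ℕ.* suc k) ⌋ k (suc ⌊√ n ℕ.* (suc m ℕ.* suc m) ⌋) m
      (√-cross n k m))

√-cauchy : ∀ n → Cauchy (√approx n)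
√-cauchy n ε 0<ε with archimedean ε 0<ε
... | N , h = N , λ k m k≥ m≥ → ∣p-q∣< (√approx n k) (√approx n m)
    (ℚP.<-trans (√-step n k m) (ℚP.+-monoʳ-< (√approx n m) (h m m≥)))
    (ℚP.<-trans (√-step n m k) (ℚP.+-monoʳ-< (√approx n k) (h k k≥)))

√ : ℕ → ℝ
√ n = mkℝ (√approx n) (√-cauchy n)

------------------------------------------------------------------------
-- Sums and series, indexed from 1

sum₁ : ℕ → ((j : ℕ) → .{{NonZero j}} → ℝ) → ℝ
sum₁ zero    f = 0ℝ
sum₁ (suc n) f = sum₁ n f + f (suc n)

HasSum : ((j : ℕ) → .{{NonZero j}} → ℝ) → ℝ → Set
HasSum f S = ∀ ε → 0ℚ ℚ.< ε →
  ∃[ N ] (∀ n → N ℕ.≤ n → ∣ sum₁ n f - S ∣ < fromℚ ε)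

-- (-1)ʲ⁺¹
sign : ℕ → ℤ
sign j = -1ℤ ℤ.^ (j ℕ.+ 1)

-- m ^ (-(k - 1/2)), written as √m / m ^ k
infix 9 _^-[_-½]
_^-[_-½] : (m k : ℕ) → .{{NonZero m}} → ℝ
(m ^-[ k -½]) = fromℚ ((+ 1 / (m ℕ.^ k)) {{ℕP.m^n≢0 m k}}) * √ m

-- IsZeta[ k -½] z : z is the value ζ(k - 1/2), k ≥ 1.
--
-- For k ≥ 2 the argument exceeds 1 and ζ is its Dirichlet series.
--
-- For k = 1 the value is that of the analytic continuation.  In the half-plane
-- Re s > 0 (s ≠ 1) the continuation is the function given by
--   (1 - 2^(1-s)) ζ(s) = η(s) = Σ_{m ≥ 1} (-1)^(m+1) m^(-s):
-- for Re s > 1 this holds by splitting off the even terms, and the series on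
-- the right converges to an analytic function for Re s > 0.  At s = 1/2 the
-- factor is 1 - 2^(1/2) ≠ 0, so z is determined.
IsZeta[_-½] : (k : ℕ) → .{{NonZero k}} → ℝ → Set
IsZeta[ 1 -½]             z =
  HasSum (λ m → fromℚ (sign m / 1) * m ^-[ 1 -½]) ((1ℝ - √ 2) * z)
IsZeta[ k@(suc (suc _)) -½] z = HasSum (λ m → m ^-[ k -½]) z

private
  2k-1≢0 : ∀ k → .{{NonZero k}} → NonZero (2 ℕ.* k ℕ.∸ 1)
  2k-1≢0 (suc k) = subst NonZero (sym (ℕP.+-suc k (k ℕ.+ 0))) _

-- (-1)ᵏ⁺¹ / ((2k - 1) 8ᵏ) · binom(2k, k)
coeff : (k : ℕ) → .{{NonZero k}} → ℚ
coeff k = ((sign k ℤ.* + ((2 ℕ.* k) C k)) / ((2 ℕ.* k ℕ.∸ 1) ℕ.* 8 ℕ.^ k))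
  {{ℕP.m*n≢0 (2 ℕ.* k ℕ.∸ 1) (8 ℕ.^ k) {{2k-1≢0 k}} {{ℕP.m^n≢0 8 k}}}}

-- IsConstantC c : c = 1 + √2 Σ_{k ≥ 1} coeff k · ζ(k - 1/2), together with the
-- convergence of that series.
IsConstantC : ℝ → Set
IsConstantC c =
  Σ[ ζ ∈ ((k : ℕ) → .{{NonZero k}} → ℝ) ] ((∀ k → .{{_ : NonZero k}} → IsZeta[ k -½] (ζ k)) ×
  Σ[ S ∈ ℝ ] (HasSum (λ k → fromℚ (coeff k) * ζ k) S ×
          c ≈ 1ℝ + √ 2 * S))

{-# OPTIONS --safe #-}

-- For n = 2M + 1 put A = Σ_{j ≤ n} (-1)^(j+1) √j and B(M) = A - √n/2 - 1/(8√n).  Expanding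
-- √(N ± 1) to third order around N = 2M + 2 gives |B(M+1) - B(M)| ≤ 3/n² - 3/(n+2)², so B
-- converges to some C with |B(M) - C| ≤ 3/n², and multiplying by √n ≤ n yields the estimate.
--
-- To identify C, write A = 1 + Σ_{m ≤ M} (√(2m+1) - √(2m)) and expand each difference by the
-- binomial polynomial P_K(x) = Σ_{k ≤ K} binom(1/2,k) xᵏ at x = 1/(2m).  The remainders sum to
-- O(2^-K) uniformly in M, so letting M → ∞ for fixed K compares C with the K-th partial sum of
-- the series; the divergent part 2√M of Σ m^(-1/2) cancels against √n/2.  Both expansions rest
-- on |P_K(x)² - (1+x)| ≤ 2|x|^(K+1) for |x| ≤ 1/2, and dividing by √(1+x) + P_K(x) is harmless
-- after scaling because √m ≥ 1.

module Submission where

-- The weights 1/2 and 1/8 in B are forced: with N = n + 1 and √(N ± 1) replaced by their cubic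
-- binomial polynomials, every term of relative order below N^-4 cancels, and what remains is
-- exactly 5/64 · √N / (N²(N² - 1)).
--
-- The bound on P_K(x)² - (1+x) is purely algebraic. Each coefficient of P_K² above x^K is twice a
-- partial self-convolution of binom(1/2,k). This has a closed form, which bounds the coefficient by
-- 1, and a geometric sum gives the factor 2.
--
-- No two infinite sums are interchanged: K is fixed while M grows, and the increments in M are
-- dominated by those of an explicit null sequence. The same domination produces C and all zeta
-- values together with their rates. ζ(1/2) is built as the limit of Σ_{m ≤ n} m^(-1/2) - 2√n, the
-- form in which it enters C, and only then matched with the alternating series that specifies it.
--
-- The order on Cauchy reals is not decidable, and comparing reals by evaluation would unfold proofs
-- of the Cauchy property. Hence the analysis is carried out over an abstract ordered ring with
-- square roots and transferred to ℝ at the end.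

module Rationals where
  open import Data.Nat as ℕ using (ℕ; zero; suc)
  import Data.Integer as ℤ
  import Data.Integer.Properties as ℤP
  open import Data.Integer using (ℤ) renaming (+_ to ⁺_)
  open import Data.Rational
  import Data.Rational.Properties as ℚP
  import Data.Rational.Unnormalised as ℚᵘ
  import Data.Rational.Unnormalised.Properties as ℚᵘP
  open import Data.Rational.Solver using (module +-*-Solver)
  import Data.Integer.Solver as ℤS
  open import Data.Product using (_,_; ∃-syntax)
  open import Data.Sum using (inj₁; inj₂)
  open import Relation.Binary.PropositionalEquality hiding (J)
  open +-*-Solver

  -- Rational arithmetic.

  2ℚ ⅛ : ℚ
  2ℚ = 1ℚ + 1ℚ
  ⅛  = ½ * (½ * ½)

  -- Recursive rather than a fraction: `nat (suc n)` unfolds to `1ℚ + nat n`, which the ring solver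
  -- can use, whereas `_/_` normalises by a gcd.
  nat : ℕ → ℚ
  nat zero    = 0ℚ
  nat (suc n) = 1ℚ + nat n

  inv : ℕ → ℚ
  inv n = ⁺ 1 / suc n

  infixr 8 _^_
  _^_ : ℚ → ℕ → ℚ
  x ^ zero  = 1ℚ
  x ^ suc n = x * x ^ n

  toℚᵘ-/ : ∀ z d → toℚᵘ (z / suc d) ℚᵘ.≃ ℚᵘ.mkℚᵘ z d
  toℚᵘ-/ z d = ℚP.toℚᵘ-fromℚᵘ (ℚᵘ.mkℚᵘ z d)

  /1-+ : ∀ a b → (a ℤ.+ b) / 1 ≡ a / 1 + b / 1
  /1-+ a b = ℚP.toℚᵘ-injective (begin-equality
      toℚᵘ ((a ℤ.+ b) / 1)                 ≃⟨ toℚᵘ-/ (a ℤ.+ b) 0 ⟩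
      ℚᵘ.mkℚᵘ (a ℤ.+ b) 0                  ≃⟨ ℚᵘ.*≡* (cross a b) ⟩
      ℚᵘ.mkℚᵘ a 0 ℚᵘ.+ ℚᵘ.mkℚᵘ b 0         ≃⟨ ℚᵘP.+-cong (toℚᵘ-/ a 0) (toℚᵘ-/ b 0) ⟨
      toℚᵘ (a / 1) ℚᵘ.+ toℚᵘ (b / 1)       ≃⟨ ℚP.toℚᵘ-homo-+ (a / 1) (b / 1) ⟨
      toℚᵘ (a / 1 + b / 1)                 ∎)
    where
    open ℚᵘP.≤-Reasoning
    cross : ∀ a b → (a ℤ.+ b) ℤ.* ⁺ 1 ≡ (a ℤ.* ⁺ 1 ℤ.+ b ℤ.* ⁺ 1) ℤ.* ⁺ 1
    cross = ℤS.+-*-Solver.solve 2 (λ a b → (a S.:+ b) S.:* S.con (⁺ 1) S.:= (a S.:* S.con (⁺ 1) S.:+ b S.:* S.con (⁺ 1)) S.:* S.con (⁺ 1)) refl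
      where module S = ℤS.+-*-Solver

  /1-* : ∀ a b → (a ℤ.* b) / 1 ≡ (a / 1) * (b / 1)
  /1-* a b = ℚP.toℚᵘ-injective (begin-equality
      toℚᵘ ((a ℤ.* b) / 1)                 ≃⟨ toℚᵘ-/ (a ℤ.* b) 0 ⟩
      ℚᵘ.mkℚᵘ a 0 ℚᵘ.* ℚᵘ.mkℚᵘ b 0         ≃⟨ ℚᵘP.*-cong (toℚᵘ-/ a 0) (toℚᵘ-/ b 0) ⟨
      toℚᵘ (a / 1) ℚᵘ.* toℚᵘ (b / 1)       ≃⟨ ℚP.toℚᵘ-homo-* (a / 1) (b / 1) ⟨
      toℚᵘ ((a / 1) * (b / 1))             ∎)
    where open ℚᵘP.≤-Reasoning

  /-denominator : ∀ a d .{{_ : ℕ.NonZero d}} → (a / d) * (⁺ d / 1) ≡ a / 1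
  /-denominator a (suc d) = ℚP.toℚᵘ-injective (begin-equality
      toℚᵘ ((a / suc d) * (⁺ suc d / 1))          ≃⟨ ℚP.toℚᵘ-homo-* (a / suc d) (⁺ suc d / 1) ⟩
      toℚᵘ (a / suc d) ℚᵘ.* toℚᵘ (⁺ suc d / 1)    ≃⟨ ℚᵘP.*-cong (toℚᵘ-/ a d) (toℚᵘ-/ (⁺ suc d) 0) ⟩
      ℚᵘ.mkℚᵘ a d ℚᵘ.* ℚᵘ.mkℚᵘ (⁺ suc d) 0        ≃⟨ ℚᵘ.*≡* (cross a (⁺ suc d)) ⟩
      ℚᵘ.mkℚᵘ a 0                                 ≃⟨ toℚᵘ-/ a 0 ⟨
      toℚᵘ (a / 1)                                ∎)
    where
    open ℚᵘP.≤-Reasoning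
    cross : ∀ a d → (a ℤ.* d) ℤ.* ⁺ 1 ≡ a ℤ.* (d ℤ.* ⁺ 1)
    cross a d = ℤP.*-assoc a d (⁺ 1)

  nat≡/1 : ∀ n → nat n ≡ ⁺ n / 1
  nat≡/1 zero    = refl
  nat≡/1 (suc n) = trans (cong (1ℚ +_) (nat≡/1 n)) (sym (/1-+ (⁺ 1) (⁺ n)))

  /-nat : ∀ a d .{{_ : ℕ.NonZero d}} → (a / d) * nat d ≡ a / 1
  /-nat a d = trans (cong ((a / d) *_) (nat≡/1 d)) (/-denominator a d)

  nat-inv : ∀ n → nat (suc n) * inv n ≡ 1ℚ
  nat-inv n = trans (ℚP.*-comm (nat (suc n)) (inv n)) (/-nat (⁺ 1) (suc n))

  nat-+ : ∀ m n → nat (m ℕ.+ n) ≡ nat m + nat n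
  nat-+ zero    n = sym (ℚP.+-identityˡ (nat n))
  nat-+ (suc m) n = trans (cong (1ℚ +_) (nat-+ m n)) (sym (ℚP.+-assoc 1ℚ (nat m) (nat n)))

  nat-* : ∀ m n → nat (m ℕ.* n) ≡ nat m * nat n
  nat-* zero    n = sym (ℚP.*-zeroˡ (nat n))
  nat-* (suc m) n = trans (nat-+ n (m ℕ.* n)) (trans (cong (nat n +_) (nat-* m n))
    (solve 2 (λ m n → n :+ m :* n := (con 1ℚ :+ m) :* n) refl (nat m) (nat n)))

  0≤1 : 0ℚ ≤ 1ℚ
  0≤1 = ℚP.nonNegative⁻¹ 1ℚ

  0≤½ : 0ℚ ≤ ½
  0≤½ = ℚP.nonNegative⁻¹ ½

  0≤+ : ∀ {p q} → 0ℚ ≤ p → 0ℚ ≤ q → 0ℚ ≤ p + q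
  0≤+ = ℚP.+-mono-≤

  0≤* : ∀ {p q} → 0ℚ ≤ p → 0ℚ ≤ q → 0ℚ ≤ p * q
  0≤* {p} {q} 0≤p 0≤q = subst (_≤ p * q) (ℚP.*-zeroʳ p)
    (ℚP.*-monoˡ-≤-nonNeg p {{nonNegative 0≤p}} 0≤q)

  0≤⇒≤ : ∀ {p q} d → q ≡ p + d → 0ℚ ≤ d → p ≤ q
  0≤⇒≤ {p} {q} d eq 0≤d = subst₂ _≤_ (ℚP.+-identityʳ p) (sym eq) (ℚP.+-monoʳ-≤ p 0≤d)

  ≤⇒0≤ : ∀ {p q} → p ≤ q → 0ℚ ≤ q - p
  ≤⇒0≤ {p} {q} p≤q = subst (_≤ q - p) (ℚP.+-inverseʳ p) (ℚP.+-monoˡ-≤ (- p) p≤q)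

  *-mono-≤ : ∀ {p q r s} → 0ℚ ≤ p → 0ℚ ≤ s → p ≤ q → r ≤ s → p * r ≤ q * s
  *-mono-≤ {p} {q} {r} {s} 0≤p 0≤s p≤q r≤s = ℚP.≤-trans
    (ℚP.*-monoˡ-≤-nonNeg p {{nonNegative 0≤p}} r≤s)
    (ℚP.*-monoʳ-≤-nonNeg s {{nonNegative 0≤s}} p≤q)

  0≤nat : ∀ n → 0ℚ ≤ nat n
  0≤nat zero    = ℚP.≤-refl
  0≤nat (suc n) = 0≤+ 0≤1 (0≤nat n)

  1≤nat : ∀ n → 1ℚ ≤ nat (suc n)
  1≤nat n = 0≤⇒≤ (nat n) refl (0≤nat n)

  nat-mono : ∀ {m n} → m ℕ.≤ n → nat m ≤ nat n
  nat-mono {n = n} ℕ.z≤n   = 0≤nat n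
  nat-mono (ℕ.s≤s m≤n)     = ℚP.+-monoʳ-≤ 1ℚ (nat-mono m≤n)

  nat-pos : ∀ n → Positive (nat (suc n))
  nat-pos n = positive (ℚP.<-≤-trans (ℚP.positive⁻¹ 1ℚ) (1≤nat n))

  0<inv : ∀ n → 0ℚ < inv n
  0<inv n = ℚP.positive⁻¹ (inv n) {{ℚP.normalize-pos 1 (suc n)}}

  0≤inv : ∀ n → 0ℚ ≤ inv n
  0≤inv n = ℚP.<⇒≤ (0<inv n)

  *-cancel-nat : ∀ n {p q} → nat (suc n) * p ≡ nat (suc n) * q → p ≡ q
  *-cancel-nat n {p} {q} eq = begin
      p                            ≡⟨ undo p ⟩
      inv n * (nat (suc n) * p)    ≡⟨ cong (inv n *_) eq ⟩
      inv n * (nat (suc n) * q)    ≡⟨ undo q ⟨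
      q                            ∎
    where
    open ≡-Reasoning
    undo : ∀ p → p ≡ inv n * (nat (suc n) * p)
    undo p = trans (sym (ℚP.*-identityˡ p)) (trans (cong (_* p) (sym (nat-inv n)))
      (solve 3 (λ a b p → (a :* b) :* p := b :* (a :* p)) refl (nat (suc n)) (inv n) p))

  ∣p∣≤ : ∀ {p q} → p ≤ q → - p ≤ q → ∣ p ∣ ≤ q
  ∣p∣≤ {p} p≤q -p≤q with ℚP.∣p∣≡p∨∣p∣≡-p p
  ... | inj₁ e = subst (_≤ _) (sym e) p≤q
  ... | inj₂ e = subst (_≤ _) (sym e) -p≤q

  p≤∣p∣ : ∀ p → p ≤ ∣ p ∣
  p≤∣p∣ p with ℚP.≤-total 0ℚ p
  ... | inj₁ 0≤p = ℚP.≤-reflexive (sym (ℚP.0≤p⇒∣p∣≡p 0≤p))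
  ... | inj₂ p≤0 = ℚP.≤-trans p≤0 (ℚP.0≤∣p∣ p)

  -p≤∣p∣ : ∀ p → - p ≤ ∣ p ∣
  -p≤∣p∣ p = subst (- p ≤_) (ℚP.∣-p∣≡∣p∣ p) (p≤∣p∣ (- p))

  ∣*∣≤ : ∀ {p q c d} → ∣ p ∣ ≤ c → ∣ q ∣ ≤ d → ∣ p * q ∣ ≤ c * d
  ∣*∣≤ {p} {q} {c} {d} hp hq = subst (_≤ c * d) (sym (ℚP.∣p*q∣≡∣p∣*∣q∣ p q))
    (*-mono-≤ (ℚP.0≤∣p∣ p) (ℚP.≤-trans (ℚP.0≤∣p∣ q) hq) hp hq)

  ∣+∣≤ : ∀ {p q c d} → ∣ p ∣ ≤ c → ∣ q ∣ ≤ d → ∣ p + q ∣ ≤ c + d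
  ∣+∣≤ {p} {q} hp hq = ℚP.≤-trans (ℚP.∣p+q∣≤∣p∣+∣q∣ p q) (ℚP.+-mono-≤ hp hq)

  -- The binomial series of √(1 + x)

  -- b k = binom(1/2, k)
  b : ℕ → ℚ
  b zero    = 1ℚ
  b (suc k) = b k * (½ - nat k) * inv k

  b-rec : ∀ k → nat (suc k) * b (suc k) ≡ (½ - nat k) * b k
  b-rec k = trans (solve 4 (λ n β h i → n :* (β :* h :* i) := (h :* β) :* (n :* i)) refl (nat (suc k)) (b k) (½ - nat k) (inv k))
    (trans (cong ((½ - nat k) * b k *_) (nat-inv k)) (ℚP.*-identityʳ ((½ - nat k) * b k)))

  -- The left side does not increase with k: by `b-rec` the next value is obtained by multiplying
  -- with |½ - (k+1)| / (k+1) ≤ 1. It starts at ½.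
  nat*∣b∣≤½ : ∀ k → nat (suc k) * ∣ b (suc k) ∣ ≤ ½
  nat*∣b∣≤½ zero    = ℚP.≤-refl
  nat*∣b∣≤½ (suc k) = begin
      nat (suc (suc k)) * ∣ b (suc (suc k)) ∣         ≡⟨ cong (_* ∣ b (suc (suc k)) ∣) (ℚP.0≤p⇒∣p∣≡p (0≤nat (suc (suc k)))) ⟨
      ∣ nat (suc (suc k)) ∣ * ∣ b (suc (suc k)) ∣     ≡⟨ ℚP.∣p*q∣≡∣p∣*∣q∣ (nat (suc (suc k))) (b (suc (suc k))) ⟨
      ∣ nat (suc (suc k)) * b (suc (suc k)) ∣         ≡⟨ cong ∣_∣ (b-rec (suc k)) ⟩
      ∣ (½ - nat (suc k)) * b (suc k) ∣               ≤⟨ ∣*∣≤ {½ - nat (suc k)} {b (suc k)} half-shift ℚP.≤-refl ⟩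
      nat (suc k) * ∣ b (suc k) ∣                     ≤⟨ nat*∣b∣≤½ k ⟩
      ½                                               ∎
    where
    open ℚP.≤-Reasoning
    half-shift : ∣ ½ - nat (suc k) ∣ ≤ nat (suc k)
    half-shift = ∣p∣≤
      (0≤⇒≤ (½ + (nat k + nat k) + 1ℚ) (solve 1 (λ n → con 1ℚ :+ n := (con ½ :- (con 1ℚ :+ n)) :+ (con ½ :+ (n :+ n) :+ con 1ℚ)) refl (nat k))
        (0≤+ (0≤+ 0≤½ (0≤+ (0≤nat k) (0≤nat k))) 0≤1))
      (0≤⇒≤ ½ (solve 1 (λ n → con 1ℚ :+ n := :- (con ½ :- (con 1ℚ :+ n)) :+ con ½) refl (nat k)) 0≤½)

  ∣b∣≤½ : ∀ k → ∣ b (suc k) ∣ ≤ ½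
  ∣b∣≤½ k = ℚP.≤-trans (subst (_≤ nat (suc k) * ∣ b (suc k) ∣) (ℚP.*-identityˡ ∣ b (suc k) ∣)
    (ℚP.*-monoʳ-≤-nonNeg ∣ b (suc k) ∣ {{ℚP.∣-∣-nonNeg (b (suc k))}} (1≤nat k))) (nat*∣b∣≤½ k)

  -- t p j = Σ_{i ≤ p} b i · b (p + 1 + j - i)
  t : ℕ → ℕ → ℚ
  t zero    j = b (suc j)
  t (suc p) j = t p (suc j) + b (suc p) * b (suc j)

  -- The coefficient of x^k in the derivative of √(1 + x).
  u : ℕ → ℚ
  u k = nat (suc k) * b (suc k)

  -- The truncated convolutions are Gosper summable; this is their closed form, cleared of denominators.
  t-closed : ∀ p j → (1ℚ + nat p + nat j) * (nat p + nat j) * t p j ≡ 2ℚ * (nat j - nat p) * (u p * u j)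
  t-closed zero j = solve 2 (λ n β →
      (con 1ℚ :+ con 0ℚ :+ n) :* (con 0ℚ :+ n) :* β
        := con 2ℚ :* (n :- con 0ℚ) :* (con (u 0) :* ((con 1ℚ :+ n) :* β))) refl (nat j) (b (suc j))
  t-closed (suc p) j = begin
      (1ℚ + (1ℚ + P) + J) * ((1ℚ + P) + J) * (t p (suc j) + β * γ)
        ≡⟨ solve 5 (λ P J T β γ → (con 1ℚ :+ (con 1ℚ :+ P) :+ J) :* ((con 1ℚ :+ P) :+ J) :* (T :+ β :* γ)
             := (con 1ℚ :+ P :+ (con 1ℚ :+ J)) :* (P :+ (con 1ℚ :+ J)) :* T
                :+ (con 1ℚ :+ (con 1ℚ :+ P) :+ J) :* ((con 1ℚ :+ P) :+ J) :* (β :* γ)) refl P J (t p (suc j)) β γ ⟩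
      (1ℚ + P + (1ℚ + J)) * (P + (1ℚ + J)) * t p (suc j) + (1ℚ + (1ℚ + P) + J) * ((1ℚ + P) + J) * (β * γ)
        ≡⟨ cong (_+ (1ℚ + (1ℚ + P) + J) * ((1ℚ + P) + J) * (β * γ)) (t-closed p (suc j)) ⟩
      2ℚ * ((1ℚ + J) - P) * (u p * u (suc j)) + (1ℚ + (1ℚ + P) + J) * ((1ℚ + P) + J) * (β * γ)
        ≡⟨ cong (λ z → 2ℚ * ((1ℚ + J) - P) * (u p * z) + (1ℚ + (1ℚ + P) + J) * ((1ℚ + P) + J) * (β * γ)) (b-rec (suc j)) ⟩
      2ℚ * ((1ℚ + J) - P) * ((1ℚ + P) * β * ((½ - (1ℚ + J)) * γ)) + (1ℚ + (1ℚ + P) + J) * ((1ℚ + P) + J) * (β * γ)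
        ≡⟨ solve 4 (λ P J β γ → con 2ℚ :* ((con 1ℚ :+ J) :- P) :* ((con 1ℚ :+ P) :* β :* ((con ½ :- (con 1ℚ :+ J)) :* γ)) :+ (con 1ℚ :+ (con 1ℚ :+ P) :+ J) :* ((con 1ℚ :+ P) :+ J) :* (β :* γ)
             := con 2ℚ :* (J :- (con 1ℚ :+ P)) :* ((con ½ :- (con 1ℚ :+ P)) :* β :* ((con 1ℚ :+ J) :* γ))) refl P J β γ ⟩
      2ℚ * (J - (1ℚ + P)) * ((½ - (1ℚ + P)) * β * ((1ℚ + J) * γ))
        ≡⟨ cong (λ z → 2ℚ * (J - (1ℚ + P)) * (z * ((1ℚ + J) * γ))) (b-rec (suc p)) ⟨
      2ℚ * (J - (1ℚ + P)) * (u (suc p) * u j) ∎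
    where
    open ≡-Reasoning
    P = nat p
    J = nat j
    β = b (suc p)
    γ = b (suc j)

  -- For p ≥ 1 and j < p this is the coefficient of x^(p+1+j) in P_p(x)². The full convolution of
  -- that order vanishes and is symmetric about its middle; twice the sum over i ≤ p is the full
  -- convolution plus the block j < i ≤ p, and this block is what P_p² contributes.
  2t : ℕ → ℕ → ℚ
  2t p j = t p j + t p j

  -- The convolution of order k+2 lacks only its last summand, `b (suc (suc k))` times `b 0`. The
  -- value is read off the closed form by cancelling k+1 and k+2, so the vanishing of the full
  -- convolution is never invoked.
  2t-0 : ∀ k → 2t (suc k) 0 ≡ - (b (suc (suc k)) + b (suc (suc k)))
  2t-0 k = trans (cong (λ z → z + z) t≡) (sym (ℚP.neg-distrib-+ β β))
    where
    β = b (suc (suc k))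
    K = nat (suc k)
    t≡ : t (suc k) 0 ≡ - β
    t≡ = *-cancel-nat k (*-cancel-nat (suc k) (trans
      (solve 2 (λ K x → (con 1ℚ :+ K) :* (K :* x) := (con 1ℚ :+ K :+ con 0ℚ) :* (K :+ con 0ℚ) :* x) refl K (t (suc k) 0))
      (trans (t-closed (suc k) 0)
      (solve 2 (λ K β → con 2ℚ :* (con 0ℚ :- K) :* ((con 1ℚ :+ K) :* β :* con (u 0)) := (con 1ℚ :+ K) :* (K :* :- β)) refl K β))))

  -- Exactly half of a symmetric convolution of odd order 2k+3; in the closed form the factor j - p
  -- vanishes.
  2t-diag : ∀ k → 2t (suc k) (suc k) ≡ 0ℚ
  2t-diag k = cong (λ z → z + z) (*-cancel-nat k (*-cancel-nat (suc k ℕ.+ suc k) (*-cancel-nat 1 (trans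
      (cong (λ z → nat 2 * ((1ℚ + z) * (K * x))) (nat-+ (suc k) (suc k)))
      (trans (solve 2 (λ K x → con (nat 2) :* ((con 1ℚ :+ (K :+ K)) :* (K :* x)) := (con 1ℚ :+ K :+ K) :* (K :+ K) :* x) refl K x)
      (trans (t-closed (suc k) (suc k))
      (trans (solve 2 (λ K v → con 2ℚ :* (K :- K) :* (v :* v) := con 0ℚ) refl K (u (suc k)))
      (sym (trans (cong (λ z → nat 2 * (nat (suc (suc k ℕ.+ suc k)) * z)) (ℚP.*-zeroʳ K))
        (trans (cong (nat 2 *_) (ℚP.*-zeroʳ (nat (suc (suc k ℕ.+ suc k))))) refl))))))))))
    where
    K = nat (suc k)
    x = t (suc k) (suc k)

  -- Twice the lower half of the convolution of even order 2k+2; only the central square is missing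
  -- from the full sum.
  2t-next : ∀ k → 2t k (suc k) ≡ - (b (suc k) * b (suc k))
  2t-next k = *-cancel-nat k (*-cancel-nat (k ℕ.+ k) (trans
      (cong (λ z → (1ℚ + z) * ((1ℚ + K) * (x + x))) (nat-+ k k))
      (trans (solve 2 (λ K x → (con 1ℚ :+ (K :+ K)) :* ((con 1ℚ :+ K) :* (x :+ x)) := (con 1ℚ :+ K :+ (con 1ℚ :+ K)) :* (K :+ (con 1ℚ :+ K)) :* x) refl K x)
      (trans (t-closed k (suc k))
      (trans (cong (λ z → 2ℚ * ((1ℚ + K) - K) * (u k * z)) (b-rec (suc k)))
      (trans (solve 2 (λ K β → con 2ℚ :* ((con 1ℚ :+ K) :- K) :* ((con 1ℚ :+ K) :* β :* ((con ½ :- (con 1ℚ :+ K)) :* β)) := (con 1ℚ :+ (K :+ K)) :* ((con 1ℚ :+ K) :* :- (β :* β))) refl K β)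
      (cong (λ z → (1ℚ + z) * ((1ℚ + K) * - (β * β))) (sym (nat-+ k k)))))))))
    where
    K = nat k
    x = t k (suc k)
    β = b (suc k)

  -- In the closed form |j - p| ≤ p + j cancels one factor of the left side and each value of `u` is
  -- at most ½, so |t| ≤ ½ / (1 + p + j).
  ∣2t∣≤1 : ∀ k j → ∣ 2t (suc k) j ∣ ≤ 1ℚ
  ∣2t∣≤1 k j = ∣+∣≤ {t (suc k) j} {t (suc k) j} ∣t∣≤½ ∣t∣≤½
    where
    open ℚP.≤-Reasoning
    K = nat (suc k)
    J = nat j
    x = t (suc k) j
    0≤K+J : 0ℚ ≤ K + J
    0≤K+J = 0≤+ (0≤nat (suc k)) (0≤nat j)
    0≤1+K+J : 0ℚ ≤ 1ℚ + K + J
    0≤1+K+J = 0≤+ (0≤+ 0≤1 (0≤nat (suc k))) (0≤nat j)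
    0<K+J : Positive (K + J)
    0<K+J = positive (ℚP.<-≤-trans (ℚP.positive⁻¹ 1ℚ)
            (ℚP.≤-trans (1≤nat k) (0≤⇒≤ J refl (0≤nat j))))
    ∣u∣≤½ : ∀ i → ∣ u i ∣ ≤ ½
    ∣u∣≤½ i = subst (_≤ ½) (trans (cong (_* ∣ b (suc i) ∣) (sym (ℚP.0≤p⇒∣p∣≡p (0≤nat (suc i))))) (sym (ℚP.∣p*q∣≡∣p∣*∣q∣ (nat (suc i)) (b (suc i))))) (nat*∣b∣≤½ i)
    diff : ∣ J - K ∣ ≤ K + J
    diff = ∣p∣≤
      (0≤⇒≤ (K + K) (solve 2 (λ K J → K :+ J := (J :- K) :+ (K :+ K)) refl K J) (0≤+ (0≤nat (suc k)) (0≤nat (suc k))))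
      (0≤⇒≤ (J + J) (solve 2 (λ K J → K :+ J := :- (J :- K) :+ (J :+ J)) refl K J) (0≤+ (0≤nat j) (0≤nat j)))
    weighted : (K + J) * ((1ℚ + K + J) * ∣ x ∣) ≤ (K + J) * ½
    weighted = begin
      (K + J) * ((1ℚ + K + J) * ∣ x ∣)
        ≡⟨ solve 3 (λ a b x → a :* (b :* x) := b :* a :* x) refl (K + J) (1ℚ + K + J) ∣ x ∣ ⟩
      (1ℚ + K + J) * (K + J) * ∣ x ∣
        ≡⟨ cong (_* ∣ x ∣) (ℚP.0≤p⇒∣p∣≡p (0≤* 0≤1+K+J 0≤K+J)) ⟨
      ∣ (1ℚ + K + J) * (K + J) ∣ * ∣ x ∣
        ≡⟨ ℚP.∣p*q∣≡∣p∣*∣q∣ ((1ℚ + K + J) * (K + J)) x ⟨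
      ∣ (1ℚ + K + J) * (K + J) * x ∣
        ≡⟨ cong ∣_∣ (t-closed (suc k) j) ⟩
      ∣ 2ℚ * (J - K) * (u (suc k) * u j) ∣
        ≤⟨ ∣*∣≤ {2ℚ * (J - K)} {u (suc k) * u j} (∣*∣≤ {2ℚ} {J - K} ℚP.≤-refl diff) (∣*∣≤ {u (suc k)} {u j} (∣u∣≤½ (suc k)) (∣u∣≤½ j)) ⟩
      2ℚ * (K + J) * (½ * ½)
        ≡⟨ solve 1 (λ s → con 2ℚ :* s :* con (½ * ½) := s :* con ½) refl (K + J) ⟩
      (K + J) * ½ ∎
    ∣t∣≤½ : ∣ x ∣ ≤ ½
    ∣t∣≤½ = ℚP.≤-trans
      (0≤⇒≤ ((K + J) * ∣ x ∣) (solve 3 (λ K J x → (con 1ℚ :+ K :+ J) :* x := x :+ (K :+ J) :* x) refl K J ∣ x ∣)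
        (0≤* 0≤K+J (ℚP.0≤∣p∣ x)))
      (ℚP.*-cancelˡ-≤-pos (K + J) {{0<K+J}} weighted)

  -- Squares of the truncated binomial series.

  horner : (ℕ → ℚ) → ℕ → ℚ → ℚ
  horner c zero    x = 0ℚ
  horner c (suc n) x = c 0 + x * horner (λ i → c (suc i)) n x

  horner-snoc : ∀ c n x → horner c (suc n) x ≡ horner c n x + c n * x ^ n
  horner-snoc c zero    x = solve 2 (λ c x → c :+ x :* con 0ℚ := con 0ℚ :+ c :* con 1ℚ) refl (c 0) x
  horner-snoc c (suc n) x = trans
    (cong (λ z → c 0 + x * z) (horner-snoc (λ i → c (suc i)) n x))
    (solve 5 (λ c x h d p → c :+ x :* (h :+ d :* p) := c :+ x :* h :+ d :* (x :* p)) refl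
      (c 0) x (horner (λ i → c (suc i)) n x) (c (suc n)) (x ^ n))

  horner-linear : ∀ c d s n x → horner (λ i → c i + s * d i) n x ≡ horner c n x + s * horner d n x
  horner-linear c d s zero    x = solve 1 (λ s → con 0ℚ := con 0ℚ :+ s :* con 0ℚ) refl s
  horner-linear c d s (suc n) x = trans
    (cong (λ z → c 0 + s * d 0 + x * z) (horner-linear (λ i → c (suc i)) (λ i → d (suc i)) s n x))
    (solve 6 (λ c s d x h g → c :+ s :* d :+ x :* (h :+ s :* g) := c :+ x :* h :+ s :* (d :+ x :* g)) refl
      (c 0) s (d 0) x (horner (λ i → c (suc i)) n x) (horner (λ i → d (suc i)) n x))

  horner-cong : ∀ {c d} → (∀ i → c i ≡ d i) → ∀ n x → horner c n x ≡ horner d n x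
  horner-cong eq zero    x = refl
  horner-cong eq (suc n) x = cong₂ (λ a h → a + x * h) (eq 0) (horner-cong (λ i → eq (suc i)) n x)

  -- The bound reproduces itself because 2 is the fixed point of h ↦ 1 + h/2.
  ∣horner∣≤2 : ∀ c n x → (∀ i → ∣ c i ∣ ≤ 1ℚ) → ∣ x ∣ ≤ ½ → ∣ horner c n x ∣ ≤ 2ℚ
  ∣horner∣≤2 c zero    x hc hx = ℚP.nonNegative⁻¹ 2ℚ
  ∣horner∣≤2 c (suc n) x hc hx = ∣+∣≤ {c 0} {x * horner (λ i → c (suc i)) n x} (hc 0)
    (∣*∣≤ {x} {horner (λ i → c (suc i)) n x} hx (∣horner∣≤2 (λ i → c (suc i)) n x (λ i → hc (suc i)) hx))

  P : ℕ → ℚ → ℚ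
  P k = horner b (suc k)

  -- The square has degree 2k+2, which accounts for the k+1 coefficients from x^(k+2) on. The
  -- induction adds one monomial to P and moves the boundary of the tail up by one power, so the
  -- lowest tail coefficient has to disappear.
  P²-tail : ∀ k x → P (suc k) x * P (suc k) x ≡ 1ℚ + x + x ^ suc (suc k) * horner (2t (suc k)) (suc k) x
  P²-tail zero x = solve 1 (λ x →
      (con 1ℚ :+ x :* (con (b 1) :+ x :* con 0ℚ)) :* (con 1ℚ :+ x :* (con (b 1) :+ x :* con 0ℚ))
      := con 1ℚ :+ x :+ (x :* (x :* con 1ℚ)) :* (con (2t 1 0) :+ x :* con 0ℚ)) refl x
  P²-tail (suc k) x = begin
      P (suc K) x * P (suc K) x
        ≡⟨ cong (λ z → z * z) (horner-snoc b (suc K) x) ⟩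
      (p + β * X) * (p + β * X)
        ≡⟨ solve 3 (λ p β X → (p :+ β :* X) :* (p :+ β :* X) := p :* p :+ X :* (con 2ℚ :* β :* p :+ β :* β :* X)) refl p β X ⟩
      p * p + X * (2ℚ * β * p + β * β * X)
        ≡⟨ cong (_+ X * (2ℚ * β * p + β * β * X)) (P²-tail k x) ⟩
      1ℚ + x + X * e + X * (2ℚ * β * p + β * β * X)
        ≡⟨ solve 5 (λ x X e p β → con 1ℚ :+ x :+ X :* e :+ X :* (con 2ℚ :* β :* p :+ β :* β :* X)
             := con 1ℚ :+ x :+ X :* (e :+ con 2ℚ :* β :* p :+ β :* β :* X)) refl x X e p β ⟩
      1ℚ + x + X * (e + 2ℚ * β * p + β * β * X)
        ≡⟨ cong (λ z → 1ℚ + x + X * z) shift ⟨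
      1ℚ + x + X * (x * horner (2t (suc K)) (suc K) x)
        ≡⟨ solve 3 (λ x X h → con 1ℚ :+ x :+ X :* (x :* h) := con 1ℚ :+ x :+ (x :* X) :* h) refl x X (horner (2t (suc K)) (suc K) x) ⟩
      1ℚ + x + x ^ suc (suc K) * horner (2t (suc K)) (suc K) x ∎
    where
    open ≡-Reasoning
    K = suc k
    β = b (suc K)
    X = x ^ suc K
    p = P K x
    e = horner (2t K) K x
    h₁ = horner (λ i → 2t K (suc i)) (suc K) x
    h₂ = horner (λ i → b (suc i)) (suc K) x
    2t≡ : ∀ i → 2t (suc K) i ≡ 2t K (suc i) + 2ℚ * β * b (suc i)
    2t≡ i = solve 3 (λ T β γ → (T :+ β :* γ) :+ (T :+ β :* γ) := T :+ T :+ con 2ℚ :* β :* γ) refl (t K (suc i)) β (b (suc i))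
    -- Two coefficients beyond the old tail are taken: the diagonal one is zero and the next is -β²,
    -- matching the square of the added monomial.
    first : 2t K 0 + x * h₁ ≡ e - β * β * X
    first = trans (horner-snoc (2t K) (suc K) x) (trans (cong₂ _+_ (horner-snoc (2t K) K x) (cong (_* X) (2t-next K)))
      (trans (cong (λ z → e + z * x ^ K + - (β * β) * X) (2t-diag k))
        (solve 4 (λ e y β X → e :+ con 0ℚ :* y :+ (:- (β :* β)) :* X := e :- β :* β :* X) refl e (x ^ K) β X)))
    second : 1ℚ + x * h₂ ≡ p + β * X
    second = horner-snoc b (suc K) x
    shift : x * horner (2t (suc K)) (suc K) x ≡ e + 2ℚ * β * p + β * β * X
    shift = begin
      x * horner (2t (suc K)) (suc K) x
        ≡⟨ cong (x *_) (trans (horner-cong 2t≡ (suc K) x) (horner-linear (λ i → 2t K (suc i)) (λ i → b (suc i)) (2ℚ * β) (suc K) x)) ⟩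
      x * (h₁ + 2ℚ * β * h₂)
        ≡⟨ solve 5 (λ x h₁ β h₂ c → x :* (h₁ :+ con 2ℚ :* β :* h₂) := (c :+ x :* h₁) :- c :+ con 2ℚ :* β :* ((con 1ℚ :+ x :* h₂) :- con 1ℚ)) refl x h₁ β h₂ (2t K 0) ⟩
      (2t K 0 + x * h₁) - 2t K 0 + 2ℚ * β * ((1ℚ + x * h₂) - 1ℚ)
        ≡⟨ cong₂ (λ y z → y - 2t K 0 + 2ℚ * β * (z - 1ℚ)) first second ⟩
      (e - β * β * X) - 2t K 0 + 2ℚ * β * ((p + β * X) - 1ℚ)
        -- The lowest old coefficient is -2β and cancels against twice the product of β with the
        -- constant term 1 of P.
        ≡⟨ cong (λ z → (e - β * β * X) - z + 2ℚ * β * ((p + β * X) - 1ℚ)) (2t-0 k) ⟩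
      (e - β * β * X) - - (β + β) + 2ℚ * β * ((p + β * X) - 1ℚ)
        ≡⟨ solve 4 (λ e β X p → (e :- β :* β :* X) :- (:- (β :+ β)) :+ con 2ℚ :* β :* ((p :+ β :* X) :- con 1ℚ) := e :+ con 2ℚ :* β :* p :+ β :* β :* X) refl e β X p ⟩
      e + 2ℚ * β * p + β * β * X ∎

  -- P differs from 1 by at most ½ · 2. Nonnegativity keeps the sum of a root and its approximation
  -- at least 1, as the division in `√-near` requires.
  0≤P : ∀ k x → ∣ x ∣ ≤ ½ → 0ℚ ≤ P k x
  0≤P k x hx = 0≤⇒≤ (1ℚ + y) (sym (ℚP.+-identityˡ (1ℚ + y)))
      (subst (_≤ 1ℚ + y) (ℚP.+-inverseˡ y)
        (ℚP.+-monoˡ-≤ y (ℚP.≤-trans (-p≤∣p∣ y) ∣y∣≤1)))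
    where
    h = horner (λ i → b (suc i)) k x
    y = x * h
    ∣y∣≤1 : ∣ y ∣ ≤ 1ℚ
    ∣y∣≤1 = ∣*∣≤ {x} {h} hx (∣horner∣≤2 (λ i → b (suc i)) k x
      (λ i → ℚP.≤-trans (∣b∣≤½ i) (0≤⇒≤ {½} {1ℚ} ½ refl 0≤½)) hx)

  ∣P²-[1+x]∣≤ : ∀ k x → ∣ x ∣ ≤ ½ →
    ∣ (1ℚ + x) - P (suc k) x * P (suc k) x ∣ ≤ ∣ x ^ suc (suc k) ∣ * 2ℚ
  ∣P²-[1+x]∣≤ k x hx = subst (λ z → ∣ z ∣ ≤ ∣ X ∣ * 2ℚ)
      (sym (trans (cong (λ z → (1ℚ + x) - z) (P²-tail k x)) (solve 3 (λ x X h → (con 1ℚ :+ x) :- (con 1ℚ :+ x :+ X :* h) := X :* (:- h)) refl x X h)))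
      (∣*∣≤ {X} { - h} ℚP.≤-refl (subst (_≤ 2ℚ) (sym (ℚP.∣-p∣≡∣p∣ h)) (∣horner∣≤2 (2t (suc k)) (suc k) x (∣2t∣≤1 k) hx)))
    where
    X = x ^ suc (suc k)
    h = horner (2t (suc k)) (suc k) x

  -- Reciprocals

  inv-nat : ∀ n → inv n * nat (suc n) ≡ 1ℚ
  inv-nat n = trans (ℚP.*-comm (inv n) (nat (suc n))) (nat-inv n)

  *-cancel-nat-≤ : ∀ n {p q} → nat (suc n) * p ≤ nat (suc n) * q → p ≤ q
  *-cancel-nat-≤ n = ℚP.*-cancelˡ-≤-pos (nat (suc n)) {{nat-pos n}}

  inv-antimono : ∀ {m n} → m ℕ.≤ n → inv n ≤ inv m
  inv-antimono {m} {n} m≤n = *-cancel-nat-≤ n (begin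
      nat (suc n) * inv n    ≡⟨ trans (nat-inv n) (sym (nat-inv m)) ⟩
      nat (suc m) * inv m    ≤⟨ ℚP.*-monoʳ-≤-nonNeg (inv m) {{nonNegative (0≤inv m)}} (nat-mono (ℕ.s≤s m≤n)) ⟩
      nat (suc n) * inv m    ∎)
    where open ℚP.≤-Reasoning

  inv≤1 : ∀ n → inv n ≤ 1ℚ
  inv≤1 n = inv-antimono {0} {n} ℕ.z≤n

  inv-diff : ∀ n → inv n - inv (suc n) ≡ inv n * inv (suc n)
  inv-diff n = trans (solve 2 (λ i j → i :- j := i :* con 1ℚ :- j :* con 1ℚ) refl i j)
      (trans (cong₂ (λ y z → i * y - j * z) (sym (nat-inv (suc n))) (sym (nat-inv n)))
      (solve 3 (λ i j n → i :* ((con 1ℚ :+ n) :* j) :- j :* (n :* i) := i :* j) refl i j (nat (suc n))))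
    where
    i = inv n
    j = inv (suc n)

  inv≤2inv : ∀ n → inv n ≤ 2ℚ * inv (suc n)
  inv≤2inv n = 0≤⇒≤ (n′ * (i * j)) (begin
      2ℚ * j                          ≡⟨ solve 1 (λ j → con 2ℚ :* j := con 2ℚ :* (con 1ℚ :* j)) refl j ⟩
      2ℚ * (1ℚ * j)                   ≡⟨ cong (λ z → 2ℚ * (z * j)) (nat-inv n) ⟨
      2ℚ * ((1ℚ + n′) * i * j)        ≡⟨ solve 3 (λ n i j → con 2ℚ :* ((con 1ℚ :+ n) :* i :* j) := ((con 1ℚ :+ (con 1ℚ :+ n)) :* j) :* i :+ n :* (i :* j)) refl n′ i j ⟩
      (nat (suc (suc n)) * j) * i + n′ * (i * j)   ≡⟨ cong (λ z → z * i + n′ * (i * j)) (nat-inv (suc n)) ⟩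
      1ℚ * i + n′ * (i * j)           ≡⟨ cong (_+ n′ * (i * j)) (ℚP.*-identityˡ i) ⟩
      i + n′ * (i * j)                ∎)
      (0≤* (0≤nat n) (0≤* (0≤inv n) (0≤inv (suc n))))
    where
    open ≡-Reasoning
    i = inv n
    j = inv (suc n)
    n′ = nat n

  inv-*2 : ∀ n → inv (suc (n ℕ.* 2)) ≡ ½ * inv n
  inv-*2 n = *-cancel-nat (suc (n ℕ.* 2)) (trans (nat-inv (suc (n ℕ.* 2))) (sym (begin
      nat (suc n ℕ.* 2) * (½ * i)          ≡⟨ cong (_* (½ * i)) (nat-* (suc n) 2) ⟩
      nat (suc n) * nat 2 * (½ * i)        ≡⟨ solve 2 (λ n i → n :* con (nat 2) :* (con ½ :* i) := n :* i) refl (nat (suc n)) i ⟩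
      nat (suc n) * i                      ≡⟨ nat-inv n ⟩
      1ℚ                                   ∎)))
    where
    open ≡-Reasoning
    i = inv n

  archimedean : ∀ ε → 0ℚ < ε → ∃[ k ] inv k ≤ ε
  archimedean ε@(mkℚ (⁺ zero) d c)       0<ε with ℚP.drop-*<* 0<ε
  ... | ℤ.+<+ ()
  archimedean ε@(mkℚ (ℤ.-[1+ a ]) d c)   0<ε with ℚP.drop-*<* 0<ε
  ... | ()
  archimedean ε@(mkℚ (⁺ suc a) d c)      0<ε = d , *-cancel-nat-≤ d (begin
      nat (suc d) * inv d             ≡⟨ nat-inv d ⟩
      1ℚ                              ≤⟨ 1≤nat a ⟩
      nat (suc a)                     ≡⟨ nat≡/1 (suc a) ⟩
      (⁺ suc a) / 1                   ≡⟨ /-nat (⁺ suc a) (suc d) ⟨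
      (⁺ suc a) / suc d * nat (suc d) ≡⟨ cong (_* nat (suc d)) (ℚP.↥p/↧p≡p ε) ⟩
      ε * nat (suc d)                 ≡⟨ ℚP.*-comm ε (nat (suc d)) ⟩
      nat (suc d) * ε                 ∎)
    where open ℚP.≤-Reasoning

  0≤^ : ∀ {x} n → 0ℚ ≤ x → 0ℚ ≤ x ^ n
  0≤^ zero    0≤x = 0≤1
  0≤^ (suc n) 0≤x = 0≤* 0≤x (0≤^ n 0≤x)

  ^-mono : ∀ {x y} n → 0ℚ ≤ x → x ≤ y → x ^ n ≤ y ^ n
  ^-mono zero    0≤x x≤y = ℚP.≤-refl
  ^-mono (suc n) 0≤x x≤y = *-mono-≤ 0≤x (0≤^ n (ℚP.≤-trans 0≤x x≤y)) x≤y (^-mono n 0≤x x≤y)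

  ^≤1 : ∀ {x} n → 0ℚ ≤ x → x ≤ 1ℚ → x ^ n ≤ 1ℚ
  ^≤1 zero    0≤x x≤1 = ℚP.≤-refl
  ^≤1 (suc n) 0≤x x≤1 = *-mono-≤ 0≤x 0≤1 x≤1 (^≤1 n 0≤x x≤1)

  ^-distrib-* : ∀ x y n → (x * y) ^ n ≡ x ^ n * y ^ n
  ^-distrib-* x y zero    = refl
  ^-distrib-* x y (suc n) = trans (cong (x * y *_) (^-distrib-* x y n))
    (solve 4 (λ x y p q → x :* y :* (p :* q) := x :* p :* (y :* q)) refl x y (x ^ n) (y ^ n))

  -- Lets geometric decay be compared with the archimedean property, which speaks of reciprocals.
  ½^≤inv : ∀ n → ½ ^ n ≤ inv n
  ½^≤inv zero    = ℚP.≤-refl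
  ½^≤inv (suc n) = ℚP.≤-trans (ℚP.*-monoˡ-≤-nonNeg ½ (½^≤inv n))
    (ℚP.≤-trans (ℚP.*-monoˡ-≤-nonNeg ½ (inv≤2inv n)) (ℚP.≤-reflexive (solve 1 (λ j → con ½ :* (con 2ℚ :* j) := j) refl (inv (suc n)))))

  -- Reduces an equation that holds only modulo a relation a ≡ d to a ring identity with cofactor c.
  modulo : ∀ {x y c a d} → a ≡ d → x ≡ y + c * (a - d) → x ≡ y
  modulo {y = y} {c} {a} refl eq = trans eq (solve 3 (λ y c a → y :+ c :* (a :- a) := y) refl y c a)

  module Reciprocals (k : ℕ) where
    private
      i = inv k
      x = inv (suc k)
      j = inv (suc (suc k))

      -- This and `x-j` say i = x/(1-x) and j = x/(1+x). They are the relations modulo which the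
      -- remaining identities of the module become ring identities.
      i-x : i * (1ℚ - x) ≡ x
      i-x = trans (solve 2 (λ i x → i :* (con 1ℚ :- x) := i :- i :* x) refl i x) (trans (cong (λ z → i - z) (sym (inv-diff k)))
        (solve 2 (λ i x → i :- (i :- x) := x) refl i x))

      x-j : j * (1ℚ + x) ≡ x
      x-j = trans (solve 2 (λ j x → j :* (con 1ℚ :+ x) := j :+ x :* j) refl j x) (trans (cong (λ z → j + z) (sym (inv-diff (suc k))))
        (solve 2 (λ j x → j :+ (x :- j) := x) refl j x))

      i-j : i - j ≡ x * (i + j)
      i-j = modulo {c = 1ℚ} i-x (modulo {c = - 1ℚ} x-j (solve 3 (λ i x j →
        i :- j := x :* (i :+ j) :+ con 1ℚ :* (i :* (con 1ℚ :- x) :- x) :+ con (- 1ℚ) :* (j :* (con 1ℚ :+ x) :- x)) refl i x j))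

      x² : x * x ≡ i * j - x * x * (i * j)
      x² = trans (sym (cong₂ _*_ i-x x-j)) (solve 3 (λ i x j → i :* (con 1ℚ :- x) :* (j :* (con 1ℚ :+ x)) := i :* j :- x :* x :* (i :* j)) refl i x j)

    -- With N = k + 2, B(m + 1) - B(m) is α √(N+1) + β √(N-1) - √N, and δ √N is what remains after
    -- replacing √(N ± 1) by P 3 (± 1/N) √N.
    α β δ γ : ℚ
    α = ½ - ⅛ * j
    β = ½ + ⅛ * i
    δ = α * P 3 x + β * P 3 (- x) - 1ℚ
    γ = nat 5 * (⅛ * ⅛)

    -- The cofactors come from reducing i · x to i - x and j · x to x - j.
    δ≡ : δ ≡ γ * (x * x * (i * j))
    δ≡ = modulo {c = ⅛ * (½ + ⅛ * (1ℚ + x) + ½ * ⅛ * (1ℚ + x + x * x)) + ½ * γ * ((1ℚ + x) + x * j)} i-x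
        (modulo {c = - (⅛ * (½ - ⅛ * (x - 1ℚ) + ½ * ⅛ * (x * x - x + 1ℚ))) - ½ * γ * (- (x - 1ℚ) + x * i)} x-j
        (solve 3 (λ i x j →
          let p = λ y → con (b 0) :+ y :* (con (b 1) :+ y :* (con (b 2) :+ y :* (con (b 3) :+ y :* con 0ℚ))) in
          (con ½ :- con ⅛ :* j) :* p x :+ (con ½ :+ con ⅛ :* i) :* p (:- x) :- con 1ℚ
          := con γ :* (x :* x :* (i :* j))
             :+ (con ⅛ :* (con ½ :+ con ⅛ :* (con 1ℚ :+ x) :+ con (½ * ⅛) :* (con 1ℚ :+ x :+ x :* x)) :+ con (½ * γ) :* ((con 1ℚ :+ x) :+ x :* j))
                :* (i :* (con 1ℚ :- x) :- x)
             :+ (:- (con ⅛ :* (con ½ :- con ⅛ :* (x :- con 1ℚ) :+ con (½ * ⅛) :* (x :* x :- x :+ con 1ℚ))) :- con (½ * γ) :* (:- (x :- con 1ℚ) :+ x :* i))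
                :* (j :* (con 1ℚ :+ x) :- x)) refl i x j))

    private
      0≤ij : 0ℚ ≤ i * j
      0≤ij = 0≤* (0≤inv k) (0≤inv (suc (suc k)))
      0≤x : 0ℚ ≤ x
      0≤x = 0≤inv (suc k)
      0≤⅛ : 0ℚ ≤ ⅛
      0≤⅛ = ℚP.nonNegative⁻¹ ⅛

    ∣α∣≤1 : ∣ α ∣ ≤ 1ℚ
    ∣α∣≤1 = ∣p∣≤
      (0≤⇒≤ (½ + ⅛ * j) (solve 1 (λ j → con 1ℚ := (con ½ :- con ⅛ :* j) :+ (con ½ :+ con ⅛ :* j)) refl j)
        (0≤+ 0≤½ (0≤* 0≤⅛ (0≤inv (suc (suc k))))))
      (0≤⇒≤ (1ℚ + ½ - ⅛ * 1ℚ + ⅛ * (1ℚ - j)) (solve 1 (λ j → con 1ℚ := (:- (con ½ :- con ⅛ :* j)) :+ (con (1ℚ + ½ - ⅛ * 1ℚ) :+ con ⅛ :* (con 1ℚ :- j))) refl j)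
        (0≤+ (ℚP.nonNegative⁻¹ (1ℚ + ½ - ⅛ * 1ℚ)) (0≤* 0≤⅛ (≤⇒0≤ (inv≤1 (suc (suc k)))))))

    ∣β∣≤1 : ∣ β ∣ ≤ 1ℚ
    ∣β∣≤1 = ∣p∣≤
      (0≤⇒≤ (½ - ⅛ * 1ℚ + ⅛ * (1ℚ - i)) (solve 1 (λ i → con 1ℚ := (con ½ :+ con ⅛ :* i) :+ (con (½ - ⅛ * 1ℚ) :+ con ⅛ :* (con 1ℚ :- i))) refl i)
        (0≤+ (ℚP.nonNegative⁻¹ (½ - ⅛ * 1ℚ)) (0≤* 0≤⅛ (≤⇒0≤ (inv≤1 k)))))
      (0≤⇒≤ (1ℚ + ½ + ⅛ * i) (solve 1 (λ i → con 1ℚ := (:- (con ½ :+ con ⅛ :* i)) :+ (con (1ℚ + ½) :+ con ⅛ :* i)) refl i)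
        (0≤+ (ℚP.nonNegative⁻¹ (1ℚ + ½)) (0≤* 0≤⅛ (0≤inv k))))

    private
      N = nat (suc (suc k))
      N*x^4 : ∀ y → N * (y * (x * (x * (x * 1ℚ))) * 2ℚ) ≡ 2ℚ * y * (x * x)
      N*x^4 y = modulo {c = 2ℚ * y * (x * x)} (nat-inv (suc k)) (solve 3 (λ n x y → n :* (y :* (x :* (x :* (x :* con 1ℚ))) :* con 2ℚ)
        := con 2ℚ :* y :* (x :* x) :+ con 2ℚ :* y :* (x :* x) :* (n :* x :- con 1ℚ)) refl N x y)

    N*∣x⁴∣ : N * (∣ x ^ 4 ∣ * 2ℚ) ≡ 2ℚ * x * (x * x)
    N*∣x⁴∣ = trans (cong (λ z → N * (z * 2ℚ)) (ℚP.0≤p⇒∣p∣≡p (0≤^ 4 0≤x))) (N*x^4 x)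

    N*∣-x⁴∣ : N * (∣ (- x) ^ 4 ∣ * 2ℚ) ≡ 2ℚ * x * (x * x)
    N*∣-x⁴∣ = trans (cong (λ z → N * (∣ z ∣ * 2ℚ)) (solve 1 (λ x → (:- x) :* ((:- x) :* ((:- x) :* ((:- x) :* con 1ℚ))) := x :* (x :* (x :* (x :* con 1ℚ)))) refl x)) N*∣x⁴∣

    -- By `i-j` the right side is 3x(i+j)² = 3x(i-j)² + 12xij. On the left 4x³ = 4xij - 4x³ij and
    -- the last term is γxij. So 12 stands against 4 + γ, and the difference is a sum of nonnegative
    -- terms.
    error : 2ℚ * x * (x * x) + 2ℚ * x * (x * x) + γ * (x * x * (i * j)) * N ≤ nat 3 * (i * i) - nat 3 * (j * j)
    error = 0≤⇒≤ (nat 3 * x * ((i - j) * (i - j)) + nat 4 * x * (x * x * (i * j)) + (nat 8 - γ) * x * (i * j))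
        (trans (solve 2 (λ i j → con (nat 3) :* (i :* i) :- con (nat 3) :* (j :* j) := con (nat 3) :* (i :- j) :* (i :+ j)) refl i j)
        (trans (cong (λ z → nat 3 * z * (i + j)) i-j)
        (sym (trans (cong (_+ d) (cong₂ _+_ (cong (λ z → 2ℚ * x * z + 2ℚ * x * z) x²)
          (modulo {c = γ * (x * (i * j))} (nat-inv (suc k))
            (solve 4 (λ n x i j → con γ :* (x :* x :* (i :* j)) :* n := con γ :* (x :* (i :* j)) :+ con γ :* (x :* (i :* j)) :* (n :* x :- con 1ℚ)) refl N x i j))))
        (solve 3 (λ x i j → con 2ℚ :* x :* (i :* j :- x :* x :* (i :* j)) :+ con 2ℚ :* x :* (i :* j :- x :* x :* (i :* j)) :+ con γ :* (x :* (i :* j))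
            :+ (con (nat 3) :* x :* ((i :- j) :* (i :- j)) :+ con (nat 4) :* x :* (x :* x :* (i :* j)) :+ con (nat 8 - γ) :* x :* (i :* j))
            := con (nat 3) :* (x :* (i :+ j)) :* (i :+ j)) refl x i j)))))
        (0≤+ (0≤+ (0≤* (0≤* (0≤nat 3) 0≤x) 0≤sq) (0≤* (0≤* (0≤nat 4) 0≤x) (0≤* (0≤* 0≤x 0≤x) 0≤ij)))
          (0≤* (0≤* (ℚP.nonNegative⁻¹ (nat 8 - γ)) 0≤x) 0≤ij))
      where
      d = nat 3 * x * ((i - j) * (i - j)) + nat 4 * x * (x * x * (i * j)) + (nat 8 - γ) * x * (i * j)
      0≤i-j : 0ℚ ≤ i - j
      0≤i-j = subst (0ℚ ≤_) (sym i-j) (0≤* 0≤x (0≤+ (0≤inv k) (0≤inv (suc (suc k)))))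
      0≤sq : 0ℚ ≤ (i - j) * (i - j)
      0≤sq = 0≤* 0≤i-j 0≤i-j

  nat*[1+inv] : ∀ k → nat (suc (suc k)) ≡ nat (suc k) * (1ℚ + inv k)
  nat*[1+inv] k = sym (modulo {c = 1ℚ} (nat-inv k)
    (solve 2 (λ n x → n :* (con 1ℚ :+ x) := (con 1ℚ :+ n) :+ con 1ℚ :* (n :* x :- con 1ℚ)) refl (nat (suc k)) (inv k)))

  nat*[1-inv] : ∀ k → nat k ≡ nat (suc k) * (1ℚ + - inv k)
  nat*[1-inv] k = sym (modulo {c = - 1ℚ} (nat-inv k)
    (solve 2 (λ n x → (con 1ℚ :+ n) :* (con 1ℚ :- x) := n :+ con (- 1ℚ) :* ((con 1ℚ :+ n) :* x :- con 1ℚ)) refl (nat k) (inv k)))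

  ∣inv∣≤½ : ∀ k → ∣ inv (suc k) ∣ ≤ ½
  ∣inv∣≤½ k = subst (_≤ ½) (sym (ℚP.0≤p⇒∣p∣≡p (0≤inv (suc k)))) (inv-antimono {1} {suc k} (ℕ.s≤s ℕ.z≤n))

  -- Of the K+3 powers of x = 1/(2i+2) one cancels n, K are at most ½ each, and the last two give a
  -- quarter of `inv i` squared, which the difference of consecutive reciprocals dominates.
  remainder-bound : ∀ K i → nat (suc i ℕ.* 2) * (∣ inv (suc (i ℕ.* 2)) ^ suc (suc (suc K)) ∣ * 2ℚ) ≤ ½ ^ K * inv i - ½ ^ K * inv (suc i)
  remainder-bound K i = begin
      n * (∣ x ^ suc (suc (suc K)) ∣ * 2ℚ)
        ≡⟨ cong (λ z → n * (z * 2ℚ)) (ℚP.0≤p⇒∣p∣≡p (0≤^ (suc (suc (suc K))) 0≤x)) ⟩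
      n * (x * (x * (x * x ^ K)) * 2ℚ)
        ≡⟨ modulo {c = 2ℚ * (x * x * x ^ K)} (nat-inv (suc (i ℕ.* 2))) (solve 3 (λ n x y → n :* (x :* (x :* (x :* y)) :* con 2ℚ)
             := con 2ℚ :* (x :* x :* y) :+ con 2ℚ :* (x :* x :* y) :* (n :* x :- con 1ℚ)) refl n x (x ^ K)) ⟩
      2ℚ * (x * x * x ^ K)
        ≤⟨ ℚP.*-monoˡ-≤-nonNeg 2ℚ (*-mono-≤ (0≤* 0≤x 0≤x) (0≤^ K 0≤½) ℚP.≤-refl (^-mono K 0≤x x≤½)) ⟩
      2ℚ * (x * x * h)
        ≡⟨ cong (λ z → 2ℚ * (z * z * h)) (inv-*2 i) ⟩
      2ℚ * (½ * inv i * (½ * inv i) * h)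
        ≡⟨ solve 2 (λ i h → con 2ℚ :* (con ½ :* i :* (con ½ :* i) :* h) := h :* i :* con ½ :* i) refl (inv i) h ⟩
      h * inv i * ½ * inv i
        ≤⟨ *-mono-≤ (0≤* 0≤hi 0≤½) (0≤* (ℚP.nonNegative⁻¹ 2ℚ) (0≤inv (suc i))) ℚP.≤-refl (inv≤2inv i) ⟩
      h * inv i * ½ * (2ℚ * j)
        ≡⟨ solve 3 (λ h i j → h :* i :* con ½ :* (con 2ℚ :* j) := h :* (i :* j)) refl h (inv i) j ⟩
      h * (inv i * j)
        ≡⟨ cong (λ z → h * z) (inv-diff i) ⟨
      h * (inv i - j)
        ≡⟨ solve 3 (λ h i j → h :* (i :- j) := h :* i :- h :* j) refl h (inv i) j ⟩
      h * inv i - h * j ∎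
    where
    open ℚP.≤-Reasoning
    n = nat (suc i ℕ.* 2)
    x = inv (suc (i ℕ.* 2))
    h = ½ ^ K
    j = inv (suc i)
    0≤x : 0ℚ ≤ x
    0≤x = 0≤inv (suc (i ℕ.* 2))
    x≤½ : x ≤ ½
    x≤½ = inv-antimono {1} {suc (i ℕ.* 2)} (ℕ.s≤s ℕ.z≤n)
    0≤hi : 0ℚ ≤ h * inv i
    0≤hi = 0≤* (0≤^ K 0≤½) (0≤inv i)

  sgn : ℕ → ℚ
  sgn zero    = 1ℚ
  sgn (suc n) = - sgn n

  sgn-even : ∀ m → sgn (m ℕ.* 2) ≡ 1ℚ
  sgn-even zero    = refl
  sgn-even (suc m) = cong (λ z → - (- z)) (sgn-even m)

  -- The coefficient of √2 · m^(1/2-(k+1)) in the expansion of √(2m+1) around 2m.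
  coef : ℕ → ℚ
  coef k = b (suc k) * ½ ^ suc k

  nat*3inv² : ∀ k → nat (suc k) * (nat 3 * (inv k * inv k)) ≡ nat 3 * inv k
  nat*3inv² k = modulo {c = nat 3 * inv k} (nat-inv k)
    (solve 2 (λ n i → n :* (con (nat 3) :* (i :* i)) := con (nat 3) :* i :+ con (nat 3) :* i :* (n :* i :- con 1ℚ)) refl (nat (suc k)) (inv k))

-- Inequalities, square roots and limits in an abstract complete ordered ring.

module OrderedFields where
  open import Data.Nat as ℕ using (ℕ; zero; suc)
  import Data.Nat.Properties as ℕP
  open import Data.Rational as ℚ using (ℚ; 0ℚ; 1ℚ; ½)
  import Data.Rational.Properties as ℚP
  open import Data.Product using (_×_; _,_; ∃-syntax; proj₁; proj₂)
  open import Data.Maybe using (Maybe; just; nothing)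
  open import Relation.Nullary using (yes; no)
  open import Relation.Binary using (Preorder)
  open import Relation.Binary.PropositionalEquality as ≡ using (_≡_)
  open import Algebra.Bundles using (CommutativeRing)
  open import Algebra.Solver.Ring.AlmostCommutativeRing using (fromCommutativeRing; _-Raw-AlmostCommutative⟶_; Induced-equivalence)
  import Algebra.Solver.Ring
  open import Level using (0ℓ)
  open Rationals using (nat; inv; 2ℚ; P)

  -- Working over an interface keeps the Cauchy proofs inside real numbers away from conversion
  -- checking. Reciprocals occur only as rational constants, and 1/√n as a rational multiple of √n,
  -- so a ring structure suffices.
  record SqrtField : Set₁ where
    field
      commutativeRing : CommutativeRing 0ℓ 0ℓ
    open CommutativeRing commutativeRing public
      using (Carrier; _≈_; _+_; _*_; -_; _-_; 0#; 1#; refl; sym; trans; +-cong; *-cong; -‿cong; isEquivalence; +-comm)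
    infix 4 _≤_ ∣_∣≤_
    field
      _≤_          : Carrier → Carrier → Set
      ≤-reflexive  : ∀ {x y} → x ≈ y → x ≤ y
      ≤-trans      : ∀ {x y z} → x ≤ y → y ≤ z → x ≤ z
      ≤-antisym    : ∀ {x y} → x ≤ y → y ≤ x → x ≈ y
      -- Not totality, but enough case analysis for proving inequalities: on ℝ the order is ¬¬-stable.
      ≤-cases      : ∀ {x y v w} → (x ≤ y → v ≤ w) → (y ≤ x → v ≤ w) → v ≤ w
      +-mono-≤     : ∀ {x y v w} → x ≤ y → v ≤ w → x + v ≤ y + w
      ι            : ℚ → Carrier
      ι-0          : ι 0ℚ ≈ 0#
      ι-1          : ι 1ℚ ≈ 1#
      ι-+          : ∀ p q → ι (p ℚ.+ q) ≈ ι p + ι q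
      ι-*          : ∀ p q → ι (p ℚ.* q) ≈ ι p * ι q
      ι-neg        : ∀ p → ι (ℚ.- p) ≈ - ι p
      ι-mono       : ∀ {p q} → p ℚ.≤ q → ι p ≤ ι q
      0≤*          : ∀ {x y} → ι 0ℚ ≤ x → ι 0ℚ ≤ y → ι 0ℚ ≤ x * y
      archimedean  : ∀ {x y} → (∀ ε → 0ℚ ℚ.< ε → x ≤ y + ι ε) → x ≤ y

    -- A pair of inequalities, which avoids an absolute value operation in the interface.
    ∣_∣≤_ : Carrier → Carrier → Set
    ∣ x ∣≤ c = (x ≤ c) × (- x ≤ c)

    _⟶_ : (ℕ → Carrier) → Carrier → Set
    y ⟶ l = ∀ ε → 0ℚ ℚ.< ε → ∃[ N ] (∀ n → N ℕ.≤ n → ∣ y n - l ∣≤ ι ε)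

    field
      complete : ∀ y → (∀ ε → 0ℚ ℚ.< ε → ∃[ N ] (∀ m n → N ℕ.≤ m → N ℕ.≤ n → ∣ y m - y n ∣≤ ι ε)) →
                 ∃[ l ] (y ⟶ l)
      √        : ℕ → Carrier
      0≤√      : ∀ n → ι 0ℚ ≤ √ n
      √²       : ∀ n → √ n * √ n ≈ ι (nat n)

  0<½* : ∀ {ε} → 0ℚ ℚ.< ε → 0ℚ ℚ.< ½ ℚ.* ε
  0<½* 0<ε = ℚP.*-monoʳ-<-pos ½ 0<ε

  ½*+½* : ∀ ε → ½ ℚ.* ε ℚ.+ ½ ℚ.* ε ≡ ε
  ½*+½* ε = ≡.trans (≡.sym (ℚP.*-distribʳ-+ ε ½ ½)) (ℚP.*-identityˡ ε)

  module Basics (F : SqrtField) where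
    open SqrtField F public

    private
      morphism : CommutativeRing.rawRing ℚP.+-*-commutativeRing -Raw-AlmostCommutative⟶ fromCommutativeRing commutativeRing
      morphism = record
        { ⟦_⟧ = ι ; +-homo = ι-+ ; *-homo = ι-* ; -‿homo = ι-neg ; 0-homo = ι-0 ; 1-homo = ι-1 }

      _≟_ : ∀ p q → Maybe (Induced-equivalence morphism p q)
      p ≟ q with p ℚP.≟ q
      ... | yes p≡q = just (CommutativeRing.reflexive commutativeRing (≡.cong ι p≡q))
      ... | no  _   = nothing

    module Solver = Algebra.Solver.Ring (CommutativeRing.rawRing ℚP.+-*-commutativeRing)
      (fromCommutativeRing commutativeRing) morphism _≟_
    open Solver using (solve; con; _:=_; _:+_; _:*_; _:-_; :-_) public

    ι-cong : ∀ {p q} → p ≡ q → ι p ≈ ι q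
    ι-cong ≡.refl = refl

    0ι 1ι 2ι : Carrier
    0ι = ι 0ℚ
    1ι = ι 1ℚ
    2ι = ι 2ℚ

    preorder : Preorder 0ℓ 0ℓ 0ℓ
    preorder = record { Carrier = Carrier ; _≈_ = _≈_ ; _≲_ = _≤_
      ; isPreorder = record { isEquivalence = isEquivalence ; reflexive = ≤-reflexive ; trans = ≤-trans } }

    open import Relation.Binary.Reasoning.Preorder preorder public

    ≤-refl : ∀ {x} → x ≤ x
    ≤-refl = ≤-reflexive refl

    ≤-respˡ : ∀ {x y z} → x ≈ y → x ≤ z → y ≤ z
    ≤-respˡ x≈y = ≤-trans (≤-reflexive (sym x≈y))

    ≤-respʳ : ∀ {x y z} → x ≈ y → z ≤ x → z ≤ y
    ≤-respʳ x≈y z≤x = ≤-trans z≤x (≤-reflexive x≈y)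

    0≤⇒≤ : ∀ {x y} d → y ≈ x + d → 0ι ≤ d → x ≤ y
    0≤⇒≤ {x} {y} d eq 0≤d = begin
      x        ≈⟨ solve 1 (λ x → x := x :+ con 0ℚ) refl x ⟩
      x + 0ι   ≲⟨ +-mono-≤ ≤-refl 0≤d ⟩
      x + d    ≈⟨ eq ⟨
      y        ∎

    ≤⇒0≤ : ∀ {x y} → x ≤ y → 0ι ≤ y - x
    ≤⇒0≤ {x} {y} x≤y = begin
      0ι       ≈⟨ solve 1 (λ x → con 0ℚ := x :- x) refl x ⟩
      x - x    ≲⟨ +-mono-≤ x≤y ≤-refl ⟩
      y - x    ∎

    0≤+ : ∀ {x y} → 0ι ≤ x → 0ι ≤ y → 0ι ≤ x + y
    0≤+ 0≤x 0≤y = ≤-respˡ (solve 0 (con 0ℚ :+ con 0ℚ := con 0ℚ) refl) (+-mono-≤ 0≤x 0≤y)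

    0≤ι : ∀ {q} → 0ℚ ℚ.≤ q → 0ι ≤ ι q
    0≤ι = ι-mono

    *-monoˡ-≤ : ∀ {x y z} → 0ι ≤ z → x ≤ y → z * x ≤ z * y
    *-monoˡ-≤ {x} {y} {z} 0≤z x≤y = 0≤⇒≤ (z * (y - x))
      (solve 3 (λ x y z → z :* y := z :* x :+ z :* (y :- x)) refl x y z) (0≤* 0≤z (≤⇒0≤ x≤y))

    *-mono-≤ : ∀ {x y v w} → 0ι ≤ x → 0ι ≤ w → x ≤ y → v ≤ w → x * v ≤ y * w
    *-mono-≤ {x} {y} {v} {w} 0≤x 0≤w x≤y v≤w = ≤-trans (*-monoˡ-≤ 0≤x v≤w)
      (0≤⇒≤ (w * (y - x)) (solve 3 (λ x y w → y :* w := x :* w :+ w :* (y :- x)) refl x y w) (0≤* 0≤w (≤⇒0≤ x≤y)))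

    0≤half : ∀ {x} → 0ι ≤ x + x → 0ι ≤ x
    0≤half {x} h = ≤-respʳ (solve 1 (λ x → con ½ :* (x :+ x) := x) refl x) (0≤* (0≤ι Rationals.0≤½) h)

    ∣∣-cong : ∀ {x y c} → x ≈ y → ∣ x ∣≤ c → ∣ y ∣≤ c
    ∣∣-cong x≈y (h , k) = ≤-respˡ x≈y h , ≤-respˡ (-‿cong x≈y) k

    ∣∣-weaken : ∀ {x c d} → c ≤ d → ∣ x ∣≤ c → ∣ x ∣≤ d
    ∣∣-weaken c≤d (h , k) = ≤-trans h c≤d , ≤-trans k c≤d

    ∣-∣ : ∀ {x c} → ∣ x ∣≤ c → ∣ - x ∣≤ c
    ∣-∣ {x} (h , k) = k , ≤-respˡ (solve 1 (λ x → x := :- (:- x)) refl x) h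

    ∣+∣ : ∀ {x y c d} → ∣ x ∣≤ c → ∣ y ∣≤ d → ∣ x + y ∣≤ c + d
    ∣+∣ {x} {y} (h , k) (h′ , k′) = +-mono-≤ h h′ ,
      ≤-respˡ (solve 2 (λ x y → :- x :+ :- y := :- (x :+ y)) refl x y) (+-mono-≤ k k′)

    ∣∣⇒0≤ : ∀ {x c} → ∣ x ∣≤ c → 0ι ≤ c
    ∣∣⇒0≤ {x} (h , k) = 0≤half (≤-respˡ (solve 1 (λ x → x :+ :- x := con 0ℚ) refl x) (+-mono-≤ h k))

    0≤⇒∣∣ : ∀ {x c} → 0ι ≤ x → x ≤ c → ∣ x ∣≤ c
    0≤⇒∣∣ {x} {c} 0≤x x≤c = x≤c , 0≤⇒≤ (c + x) (solve 2 (λ x c → c := :- x :+ (c :+ x)) refl x c) (0≤+ (≤-trans 0≤x x≤c) 0≤x)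

    -- From 2(cd - xy) = (c-x)(d+y) + (c+x)(d-y), without distinguishing the signs of x and y.
    ∣*∣ : ∀ {x y c d} → ∣ x ∣≤ c → ∣ y ∣≤ d → ∣ x * y ∣≤ c * d
    ∣*∣ {x} {y} {c} {d} hx hy = upper hx hy ,
        ≤-respˡ (solve 2 (λ x y → (:- x) :* y := :- (x :* y)) refl x y) (upper (∣-∣ hx) hy)
      where
      upper : ∀ {x} → ∣ x ∣≤ c → ∣ y ∣≤ d → x * y ≤ c * d
      upper {x} (h , k) (h′ , k′) = 0≤⇒≤ (c * d - x * y)
        (solve 4 (λ x y c d → c :* d := x :* y :+ (c :* d :- x :* y)) refl x y c d)
        (0≤half (≤-respʳ
          (solve 4 (λ x y c d → (c :- x) :* (d :- :- y) :+ (c :- :- x) :* (d :- y) := (c :* d :- x :* y) :+ (c :* d :- x :* y)) refl x y c d)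
          (0≤+ (0≤* (≤⇒0≤ h) (≤⇒0≤ k′)) (0≤* (≤⇒0≤ k) (≤⇒0≤ h′)))))

    ∣ι∣ : ∀ {q c} → ℚ.∣ q ∣ ℚ.≤ c → ∣ ι q ∣≤ ι c
    ∣ι∣ {q} h = ι-mono (ℚP.≤-trans (Rationals.p≤∣p∣ q) h) , ≤-respˡ (ι-neg q) (ι-mono (ℚP.≤-trans (Rationals.-p≤∣p∣ q) h))

    -- This replaces division by s. For x ≥ 0 one has x ≤ xs ≤ c, and for x ≤ 0 already x ≤ 0 ≤ c.
    cancel-≤ : ∀ {x s c} → 1ι ≤ s → 0ι ≤ c → x * s ≤ c → x ≤ c
    cancel-≤ {x} {s} 1≤s 0≤c h = ≤-cases {0ι} {x}
      (λ 0≤x → ≤-trans (0≤⇒≤ (x * (s - 1ι)) (solve 2 (λ x s → x :* s := x :+ x :* (s :- con 1ℚ)) refl x s) (0≤* 0≤x (≤⇒0≤ 1≤s))) h)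
      (λ x≤0 → ≤-trans x≤0 0≤c)

    cancel-∣∣ : ∀ {x s c} → 1ι ≤ s → ∣ x * s ∣≤ c → ∣ x ∣≤ c
    cancel-∣∣ {x} {s} 1≤s h = cancel-≤ 1≤s (∣∣⇒0≤ h) (proj₁ h) ,
      cancel-≤ 1≤s (∣∣⇒0≤ h) (≤-respˡ (solve 2 (λ x s → :- (x :* s) := (:- x) :* s) refl x s) (proj₂ h))

    modulo : ∀ {x y c a d} → a ≈ d → x ≈ y + c * (a - d) → x ≈ y
    modulo {x} {y} {c} {a} {d} a≈d eq = trans eq (trans (+-cong refl (*-cong refl (+-cong a≈d refl)))
      (solve 3 (λ y c d → y :+ c :* (d :- d) := y) refl y c d))

    ∣∣≤0⇒≈ : ∀ {x y} → ∣ x - y ∣≤ 0ι → x ≈ y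
    ∣∣≤0⇒≈ {x} {y} (h , k) = ≤-antisym
      (0≤⇒≤ (0ι - (x - y)) (solve 2 (λ x y → y := x :+ (con 0ℚ :- (x :- y))) refl x y) (≤⇒0≤ h))
      (0≤⇒≤ (0ι - - (x - y)) (solve 2 (λ x y → x := y :+ (con 0ℚ :- (:- (x :- y)))) refl x y) (≤⇒0≤ k))

    -- Square roots

    1≤√ : ∀ n → 1ι ≤ √ (suc n)
    1≤√ n = ≤-cases {1ι} {√ (suc n)} (λ h → h) λ √≤1 → begin
      1ι                      ≲⟨ ι-mono (Rationals.1≤nat n) ⟩
      ι (nat (suc n))         ≈⟨ √² (suc n) ⟨
      √ (suc n) * √ (suc n)   ≲⟨ *-monoˡ-≤ (0≤√ (suc n)) √≤1 ⟩
      √ (suc n) * 1ι          ≈⟨ solve 1 (λ x → x :* con 1ℚ := x) refl (√ (suc n)) ⟩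
      √ (suc n)               ∎

    -- The difference of squares factors through √(n+1) + y ≥ 1, so passing from squares to roots
    -- does not increase the error. The gain of order √n is deliberately given away.
    √-near : ∀ n {y c} → 0ι ≤ y → ∣ ι (nat (suc n)) - y * y ∣≤ c → ∣ √ (suc n) - y ∣≤ c
    √-near n {y} 0≤y h = cancel-∣∣
      (≤-trans (1≤√ n) (0≤⇒≤ y refl 0≤y))
      (∣∣-cong (trans (+-cong (sym (√² (suc n))) refl)
         (solve 2 (λ a y → a :* a :- y :* y := (a :- y) :* (a :+ y)) refl (√ (suc n)) y)) h)

    √-unique : ∀ n {y} → 0ι ≤ y → y * y ≈ ι (nat (suc n)) → √ (suc n) ≈ y
    √-unique n {y} 0≤y eq = ∣∣≤0⇒≈ (√-near n 0≤y (∣∣-cong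
      (trans (solve 1 (λ x → con 0ℚ := x :- x) refl (y * y)) (+-cong eq refl))
      (∣ι∣ {0ℚ} ℚP.≤-refl)))

    √-* : ∀ m n → √ (suc m ℕ.* suc n) ≈ √ (suc m) * √ (suc n)
    √-* m n = √-unique (n ℕ.+ m ℕ.* suc n) (0≤* (0≤√ (suc m)) (0≤√ (suc n)))
      (trans (solve 2 (λ x y → (x :* y) :* (x :* y) := (x :* x) :* (y :* y)) refl (√ (suc m)) (√ (suc n)))
      (trans (*-cong (√² (suc m)) (√² (suc n)))
      (trans (sym (ι-* (nat (suc m)) (nat (suc n)))) (ι-cong (≡.sym (Rationals.nat-* (suc m) (suc n)))))))

    -- For y = P(x)√N the difference of squares is N((1+x) - P(x)²), which is rational.
    √-series : ∀ N N′ k x → nat (suc N′) ≡ nat N ℚ.* (1ℚ ℚ.+ x) → ℚ.∣ x ∣ ℚ.≤ ½ →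
      ∣ √ (suc N′) - ι (P (suc k) x) * √ N ∣≤ ι (nat N ℚ.* (ℚ.∣ x Rationals.^ suc (suc k) ∣ ℚ.* 2ℚ))
    √-series N N′ k x eq hx = √-near N′ (0≤* (0≤ι (Rationals.0≤P (suc k) x hx)) (0≤√ N))
        (∣∣-cong (sym diff) (∣ι∣ (Rationals.∣*∣≤ {nat N} {d} (ℚP.≤-reflexive (ℚP.0≤p⇒∣p∣≡p (Rationals.0≤nat N))) (Rationals.∣P²-[1+x]∣≤ k x hx))))
      where
      p = P (suc k) x
      d = (1ℚ ℚ.+ x) ℚ.- p ℚ.* p
      diff : ι (nat (suc N′)) - (ι p * √ N) * (ι p * √ N) ≈ ι (nat N ℚ.* d)
      diff = trans (+-cong (trans (ι-cong eq) (ι-* (nat N) (1ℚ ℚ.+ x))) (-‿cong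
          (trans (solve 2 (λ p s → (p :* s) :* (p :* s) := (s :* s) :* (p :* p)) refl (ι p) (√ N))
            (*-cong (√² N) refl))))
        (trans (solve 3 (λ n y p → n :* y :- n :* (p :* p) := n :* (y :- p :* p)) refl (ι (nat N)) (ι (1ℚ ℚ.+ x)) (ι p))
        (sym (trans (ι-* (nat N) d) (*-cong refl (trans (ι-+ (1ℚ ℚ.+ x) (ℚ.- (p ℚ.* p))) (+-cong refl (trans (ι-neg (p ℚ.* p)) (-‿cong (ι-* p p)))))))))

    -- Limits

    ⟶-cong : ∀ {y z : ℕ → Carrier} {l m} → (∀ n → y n ≈ z n) → l ≈ m → y ⟶ l → z ⟶ m
    ⟶-cong y≈z l≈m h ε 0<ε = let N , hN = h ε 0<ε in
      N , λ n N≤n → ∣∣-cong (+-cong (y≈z n) (-‿cong l≈m)) (hN n N≤n)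

    ⟶-+ : ∀ {y z l m} → y ⟶ l → z ⟶ m → (λ n → y n + z n) ⟶ (l + m)
    ⟶-+ {y} {z} {l} {m} h k ε 0<ε =
      let M , hM = h (½ ℚ.* ε) (0<½* 0<ε)
          N , kN = k (½ ℚ.* ε) (0<½* 0<ε)
      in M ℕ.⊔ N , λ n ≤n → ∣∣-weaken
           (≤-reflexive (trans (sym (ι-+ (½ ℚ.* ε) (½ ℚ.* ε))) (ι-cong (½*+½* ε))))
           (∣∣-cong (solve 4 (λ y l z m → (y :- l) :+ (z :- m) := (y :+ z) :- (l :+ m)) refl (y n) l (z n) m)
             (∣+∣ (hM n (ℕP.m⊔n≤o⇒m≤o M N ≤n)) (kN n (ℕP.m⊔n≤o⇒n≤o M N ≤n))))

    ⟶-const : ∀ c → (λ _ → c) ⟶ c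
    ⟶-const c ε 0<ε = 0 , λ _ _ → ∣∣-cong (solve 1 (λ c → con 0ℚ := c :- c) refl c) (∣ι∣ {0ℚ} (ℚP.<⇒≤ 0<ε))

    ⟶-* : ∀ {y l} B c → ∣ c ∣≤ ι (nat (suc B)) → y ⟶ l → (λ n → c * y n) ⟶ (c * l)
    ⟶-* {y} {l} B c hc h ε 0<ε =
      let N , hN = h (inv B ℚ.* ε) 0<ε′ in
      N , λ n N≤n → ∣∣-weaken (≤-reflexive (trans (sym (ι-* (nat (suc B)) (inv B ℚ.* ε))) (ι-cong undo)))
        (∣∣-cong (solve 3 (λ c y l → c :* (y :- l) := c :* y :- c :* l) refl c (y n) l) (∣*∣ hc (hN n N≤n)))
      where
      undo : nat (suc B) ℚ.* (inv B ℚ.* ε) ≡ ε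
      undo = ≡.trans (≡.sym (ℚP.*-assoc (nat (suc B)) (inv B) ε)) (≡.trans (≡.cong (ℚ._* ε) (Rationals.nat-inv B)) (ℚP.*-identityˡ ε))
      0<ε′ : 0ℚ ℚ.< inv B ℚ.* ε
      0<ε′ = ≡.subst (ℚ._< inv B ℚ.* ε) (ℚP.*-zeroʳ (inv B)) (ℚP.*-monoʳ-<-pos (inv B) {{ℚ.positive (Rationals.0<inv B)}} 0<ε)

    ⟶-neg : ∀ {y l} → y ⟶ l → (λ n → - y n) ⟶ (- l)
    ⟶-neg {y} {l} h = ⟶-cong (λ n → neg (y n)) (neg l) (⟶-* 0 (ι (ℚ.- 1ℚ)) (∣ι∣ ℚP.≤-refl) h)
      where
      neg : ∀ x → ι (ℚ.- 1ℚ) * x ≈ - x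
      neg = solve 1 (λ x → con (ℚ.- 1ℚ) :* x := :- x) refl

    ⟶-suc : ∀ (y : ℕ → Carrier) {l} → (λ n → y (suc n)) ⟶ l → y ⟶ l
    ⟶-suc y {l} h ε 0<ε = let N , hN = h ε 0<ε in suc N , λ { (suc n) (ℕ.s≤s N≤n) → hN n N≤n }

    ⟶-sub : ∀ (y : ℕ → Carrier) {l} (f : ℕ → ℕ) → (∀ n → n ℕ.≤ f n) → y ⟶ l → (λ n → y (f n)) ⟶ l
    ⟶-sub y f n≤fn h ε 0<ε = let N , hN = h ε 0<ε in N , λ n N≤n → hN (f n) (ℕP.≤-trans N≤n (n≤fn n))

    ⟶-squeeze : ∀ {y e : ℕ → Carrier} {l} → (∀ n → ∣ y n - l ∣≤ e n) → e ⟶ 0ι → y ⟶ l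
    ⟶-squeeze {e = e} hy he ε 0<ε = let N , hN = he ε 0<ε in
      N , λ n N≤n → ∣∣-weaken (≤-respˡ (solve 1 (λ x → x :- con 0ℚ := x) refl (e n)) (proj₁ (hN n N≤n))) (hy n)

    ⟶-∣∣ : ∀ {y : ℕ → Carrier} {l c} → y ⟶ l → (∀ n → ∣ y n ∣≤ c) → ∣ l ∣≤ c
    ⟶-∣∣ {y} {l} {c} h hc = archimedean (λ ε 0<ε → proj₁ (near ε 0<ε)) , archimedean (λ ε 0<ε → proj₂ (near ε 0<ε))
      where
      near : ∀ ε → 0ℚ ℚ.< ε → ∣ l ∣≤ c + ι ε
      near ε 0<ε = let N , hN = h ε 0<ε in ∣∣-cong (solve 2 (λ y l → y :+ :- (y :- l) := l) refl (y N) l)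
        (∣+∣ (hc N) (∣-∣ (hN N ℕP.≤-refl)))

    telescope : ∀ (y e : ℕ → Carrier) → (∀ n → ∣ y (suc n) - y n ∣≤ e n - e (suc n)) → ∀ m d → ∣ y (m ℕ.+ d) - y m ∣≤ e m - e (m ℕ.+ d)
    telescope y e h m zero rewrite ℕP.+-identityʳ m =
      ∣∣-weaken (≤-reflexive (solve 1 (λ c → con 0ℚ := c :- c) refl (e m)))
        (∣∣-cong (solve 1 (λ c → con 0ℚ := c :- c) refl (y m)) (∣ι∣ {0ℚ} ℚP.≤-refl))
    telescope y e h m (suc d) rewrite ℕP.+-suc m d =
      ∣∣-weaken (≤-reflexive (add (e (suc n)) (e n) (e m)))
        (∣∣-cong (solve 3 (λ a b c → (a :- b) :+ (b :- c) := a :- c) refl (y (suc n)) (y n) (y m)) (∣+∣ (h n) (telescope y e h m d)))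
      where
      n = m ℕ.+ d
      add : ∀ a b c → (b - a) + (c - b) ≈ c - a
      add = solve 3 (λ a b c → (b :- a) :+ (c :- b) := c :- a) refl

    telescope-≤ : ∀ (y e : ℕ → Carrier) → (∀ n → ∣ y (suc n) - y n ∣≤ e n - e (suc n)) → (∀ n → 0ι ≤ e n) →
                  ∀ {m n} → m ℕ.≤ n → ∣ y n - y m ∣≤ e m
    telescope-≤ y e h 0≤e {m} {n} m≤n = ≡.subst (λ k → ∣ y k - y m ∣≤ e m) (ℕP.m+[n∸m]≡n m≤n)
      (∣∣-weaken (0≤⇒≤ (e k) (solve 2 (λ a b → a := (a :- b) :+ b) refl (e m) (e k)) (0≤e k)) (telescope y e h m (n ℕ.∸ m)))
      where k = m ℕ.+ (n ℕ.∸ m)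

    -- For n ≥ m the increments sum to |y n - y m| ≤ e m. This makes y a Cauchy sequence, and
    -- letting n grow turns the same bound into the rate of convergence.
    telescope-limit : ∀ (y e : ℕ → Carrier) → (∀ n → ∣ y (suc n) - y n ∣≤ e n - e (suc n)) → (∀ n → 0ι ≤ e n) → e ⟶ 0ι →
                      ∃[ l ] (∀ n → ∣ y n - l ∣≤ e n)
    telescope-limit y e h 0≤e e⟶0 = l , bound
      where
      cauchy : ∀ ε → 0ℚ ℚ.< ε → ∃[ N ] (∀ m n → N ℕ.≤ m → N ℕ.≤ n → ∣ y m - y n ∣≤ ι ε)
      cauchy ε 0<ε = let N , hN = e⟶0 (½ ℚ.* ε) (0<½* 0<ε) in
        N , λ m n N≤m N≤n →
          let small = ≤-respˡ (solve 1 (λ x → x :- con 0ℚ := x) refl (e N)) (proj₁ (hN N ℕP.≤-refl)) in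
          ∣∣-weaken (≤-trans (+-mono-≤ small small) (≤-reflexive (trans (sym (ι-+ (½ ℚ.* ε) (½ ℚ.* ε))) (ι-cong (½*+½* ε)))))
            (∣∣-cong (solve 3 (λ a b c → (a :- c) :+ (:- (b :- c)) := a :- b) refl (y m) (y n) (y N))
              (∣+∣ (telescope-≤ y e h 0≤e N≤m) (∣-∣ (telescope-≤ y e h 0≤e N≤n))))
      l = proj₁ (complete y cauchy)
      y⟶l = proj₂ (complete y cauchy)
      bound : ∀ m → ∣ y m - l ∣≤ e m
      bound m = ∣∣-cong (solve 2 (λ a l → :- (l :+ :- a) := a :- l) refl (y m) l)
        (∣-∣ (⟶-∣∣ (⟶-+ (⟶-sub y (m ℕ.+_) (λ n → ℕP.m≤n+m n m) y⟶l) (⟶-const (- y m)))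
          (λ n → telescope-≤ y e h 0≤e (ℕP.m≤m+n m n))))

-- The zeta values at half-integers and the alternating series.

module ZetaValues where
  open import Data.Nat as ℕ using (ℕ; zero; suc)
  import Data.Nat.Properties as ℕP
  open import Data.Rational as ℚ using (ℚ; 0ℚ; 1ℚ; ½)
  import Data.Rational.Properties as ℚP
  open import Data.Product using (_,_; ∃-syntax; proj₁; proj₂)
  open import Data.Sum using (_⊎_; inj₁; inj₂)
  open import Relation.Binary.PropositionalEquality as ≡ using (_≡_)
  open Rationals using (nat; inv; 2ℚ; sgn; sgn-even)
  open OrderedFields

  module Zeta (F : SqrtField) where
    open Basics F public

    sum : (ℕ → Carrier) → ℕ → Carrier
    sum f zero    = 0ι
    sum f (suc n) = sum f n + f n

    -- s k n = (n + 1) ^ (1/2 - k)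
    s : ℕ → ℕ → Carrier
    s k n = ι (inv n Rationals.^ k) * √ (suc n)

    -- p n = 1 / √(n + 1)
    p : ℕ → Carrier
    p n = ι (inv n) * √ (suc n)

    √-diff² : ∀ n → √ (suc n) * √ (suc n) ≈ √ n * √ n + 1ι
    √-diff² n = trans (√² (suc n)) (trans (ι-+ 1ℚ (nat n)) (trans (+-comm 1ι (ι (nat n))) (+-cong (sym (√² n)) refl)))

    √-mono : ∀ n → √ n ≤ √ (suc n)
    √-mono n = 0≤⇒≤ (- (u - v)) (solve 2 (λ u v → v := u :+ (:- (u :- v))) refl u v)
        (≤-respʳ (solve 1 (λ d → con 0ℚ :- d := :- d) refl (u - v)) (≤⇒0≤ u-v≤0))
      where
      u = √ n
      v = √ (suc n)
      u-v≤0 : u - v ≤ 0ι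
      u-v≤0 = cancel-≤ {s = v + u} (≤-trans (1≤√ n) (0≤⇒≤ u refl (0≤√ n))) ≤-refl
        (≤-respˡ (sym (modulo {c = - 1ι} (√-diff² n)
          (solve 2 (λ u v → (u :- v) :* (v :+ u) := :- con 1ℚ :+ (:- con 1ℚ) :* (v :* v :- (u :* u :+ con 1ℚ))) refl u v)))
        (≤-respˡ (ι-neg 1ℚ) (ι-mono (ℚP.nonPositive⁻¹ (ℚ.- 1ℚ)))))

    p-√ : ∀ n → p n * √ (suc n) ≈ 1ι
    p-√ n = trans (solve 2 (λ i u → i :* u :* u := i :* (u :* u)) refl (ι (inv n)) (√ (suc n)))
      (trans (*-cong refl (√² (suc n))) (trans (sym (ι-* (inv n) (nat (suc n)))) (ι-cong (Rationals.inv-nat n))))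

    p² : ∀ n → p n * p n ≈ ι (inv n)
    p² n = trans (solve 2 (λ p iu → p :* iu := iu :* p) refl (p n) (p n))
      (trans (solve 3 (λ i u p → i :* u :* p := i :* (p :* u)) refl (ι (inv n)) (√ (suc n)) (p n))
      (trans (*-cong refl (p-√ n)) (solve 1 (λ i → i :* con 1ℚ := i) refl (ι (inv n)))))

    0≤p : ∀ n → 0ι ≤ p n
    0≤p n = 0≤* (0≤ι (Rationals.0≤inv n)) (0≤√ (suc n))

    p-small : ∀ k n → suc k ℕ.* suc k ℕ.≤ suc n → p n ≤ ι (inv k)
    p-small k n h = 0≤⇒≤ (p n * (ι (inv k) * (r - m)))
        (trans (modulo {c = ι (inv k)} (sym (p-√ n))
            (solve 3 (λ i p r → i := i :* (p :* r) :+ i :* (con 1ℚ :- p :* r)) refl (ι (inv k)) (p n) r))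
          (modulo {c = p n} inv-m
            (solve 4 (λ i p r m → i :* (p :* r) := p :+ p :* (i :* (r :- m)) :+ p :* (i :* m :- con 1ℚ)) refl (ι (inv k)) (p n) r m)))
        (0≤* (0≤p n) (0≤* (0≤ι (Rationals.0≤inv k)) 0≤r-m))
      where
      r = √ (suc n)
      m = ι (nat (suc k))
      inv-m : ι (inv k) * m ≈ 1ι
      inv-m = trans (sym (ι-* (inv k) (nat (suc k)))) (ι-cong (Rationals.inv-nat k))
      m²≤r² : m * m ≤ r * r
      m²≤r² = ≤-respˡ (trans (ι-cong (Rationals.nat-* (suc k) (suc k))) (ι-* (nat (suc k)) (nat (suc k))))
        (≤-respʳ (sym (√² (suc n))) (ι-mono (Rationals.nat-mono h)))
      0≤r-m : 0ι ≤ r - m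
      0≤r-m = ≤⇒0≤ (0≤⇒≤ (0ι - (m - r)) (solve 2 (λ m r → r := m :+ (con 0ℚ :- (m :- r))) refl m r)
        (≤⇒0≤ (cancel-≤ {s = r + m} (≤-trans (1≤√ n) (0≤⇒≤ m refl (0≤ι (Rationals.0≤nat (suc k))))) ≤-refl
          (0≤⇒≤ (r * r - m * m) (solve 2 (λ m r → con 0ℚ := (m :- r) :* (r :+ m) :+ (r :* r :- m :* m)) refl m r) (≤⇒0≤ m²≤r²)))))

    0≤⇒⟶0 : ∀ {y : ℕ → Carrier} → (∀ n → 0ι ≤ y n) → (∀ ε → 0ℚ ℚ.< ε → ∃[ N ] (∀ n → N ℕ.≤ n → y n ≤ ι ε)) → y ⟶ 0ι
    0≤⇒⟶0 {y} 0≤y h ε 0<ε = let N , hN = h ε 0<ε in N , λ n N≤n →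
      ∣∣-cong (solve 1 (λ y → y := y :- con 0ℚ) refl (y n)) (0≤⇒∣∣ (0≤y n) (hN n N≤n))

    p⟶0 : p ⟶ 0ι
    p⟶0 = 0≤⇒⟶0 0≤p (λ ε 0<ε → let k , k≤ = Rationals.archimedean ε 0<ε in suc k ℕ.* suc k ,
      λ n N≤n → ≤-trans (p-small k n (ℕP.m≤n⇒m≤1+n N≤n)) (ι-mono k≤))

    module Consecutive (n : ℕ) where
      private
        u = √ (suc n)
        v = √ (suc (suc n))
        q = p (suc n)
      δ : Carrier
      δ = v - u

      0≤δ : 0ι ≤ δ
      0≤δ = ≤⇒0≤ (√-mono (suc n))

      -- Since v² - u² = 1 and p u = 1, expanding around u gives p = p(v² - u²) = 2δ + pδ².
      2δ≤p : 2ι * δ ≤ p n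
      2δ≤p = 0≤⇒≤ (p n * (δ * δ))
        (modulo {c = 2ι * (v - u)} (p-√ n) (modulo {c = - p n} (√-diff² (suc n))
          (solve 3 (λ p u v → p := con 2ℚ :* (v :- u) :+ p :* ((v :- u) :* (v :- u)) :+ con 2ℚ :* (v :- u) :* (p :* u :- con 1ℚ)
              :+ (:- p) :* (v :* v :- (u :* u :+ con 1ℚ))) refl (p n) u v)))
        (0≤* (0≤p n) (0≤* 0≤δ 0≤δ))

      -- Expanding around v instead gives 2δ = q + qδ². Together with `2δ≤p` this is the comparison
      -- of m^(-1/2) with the increments of 2√m.
      p≤2δ : q ≤ 2ι * δ
      p≤2δ = 0≤⇒≤ (q * (δ * δ))
        (modulo {c = - (2ι * (v - u))} (p-√ (suc n)) (modulo {c = q} (√-diff² (suc n))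
          (solve 3 (λ q u v → con 2ℚ :* (v :- u) := q :+ q :* ((v :- u) :* (v :- u)) :+ (:- (con 2ℚ :* (v :- u))) :* (q :* v :- con 1ℚ)
              :+ q :* (v :* v :- (u :* u :+ con 1ℚ))) refl q u v)))
        (0≤* (0≤p (suc n)) (0≤* 0≤δ 0≤δ))

      p-diff : p n - q ≈ p n * q * δ
      p-diff = modulo {c = q} (p-√ n) (modulo {c = - p n} (p-√ (suc n))
        (solve 4 (λ p q u v → p :- q := p :* q :* (v :- u) :+ q :* (p :* u :- con 1ℚ) :+ (:- p) :* (q :* v :- con 1ℚ)) refl (p n) q u v))

      p-anti : q ≤ p n
      p-anti = 0≤⇒≤ (p n * q * δ) (trans (solve 2 (λ p q → p := q :+ (p :- q)) refl (p n) q) (+-cong refl p-diff))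
        (0≤* (0≤* (0≤p n) (0≤p (suc n))) 0≤δ)

      -- The summand m^(-3/2) is dominated by a telescoping difference: p - q = pqδ, where q ≤ p and
      -- q ≤ 2δ.
      p³≤2[p-q] : q * q * q ≤ 2ι * (p n - q)
      p³≤2[p-q] = begin
        q * q * q            ≈⟨ solve 1 (λ q → q :* q :* q := (q :* q) :* q) refl q ⟩
        (q * q) * q          ≲⟨ *-mono-≤ (0≤* (0≤p (suc n)) (0≤p (suc n))) (≤-trans (0≤p (suc n)) p≤2δ) (*-mono-≤ (0≤p (suc n)) (0≤p (suc n)) p-anti ≤-refl) p≤2δ ⟩
        (p n * q) * (2ι * δ) ≈⟨ solve 3 (λ p q d → (p :* q) :* (con 2ℚ :* d) := con 2ℚ :* (p :* q :* d)) refl (p n) q δ ⟩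
        2ι * (p n * q * δ)   ≈⟨ *-cong refl p-diff ⟨
        2ι * (p n - q)       ∎

    s-1 : ∀ n → s 1 n ≈ p n
    s-1 n = *-cong (ι-cong (ℚP.*-identityʳ (inv n))) refl

    0≤s : ∀ k n → 0ι ≤ s k n
    0≤s k n = 0≤* (0≤ι (Rationals.0≤^ k (Rationals.0≤inv n))) (0≤√ (suc n))

    -- Exponent 3/2 is the slowest decay among the convergent cases, so one rate serves all of them.
    s≤p³ : ∀ k n → s (suc (suc k)) n ≤ p n * p n * p n
    s≤p³ k n = begin
      ι (i ℚ.* (i ℚ.* i Rationals.^ k)) * √ (suc n)   ≲⟨ *-mono-≤ (0≤ι (Rationals.0≤* (Rationals.0≤inv n) (Rationals.0≤* (Rationals.0≤inv n) (Rationals.0≤^ k (Rationals.0≤inv n))))) (0≤√ (suc n)) (ι-mono i^k≤) ≤-refl ⟩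
      ι (i ℚ.* i) * √ (suc n)                 ≈⟨ *-cong (ι-* i i) refl ⟩
      ι i * ι i * √ (suc n)                   ≈⟨ solve 2 (λ i u → i :* i :* u := i :* (i :* u)) refl (ι i) (√ (suc n)) ⟩
      ι i * p n                               ≈⟨ *-cong (p² n) refl ⟨
      p n * p n * p n                         ∎
      where
      i = inv n
      i^k≤ : i ℚ.* (i ℚ.* i Rationals.^ k) ℚ.≤ i ℚ.* i
      i^k≤ = Rationals.*-mono-≤ (Rationals.0≤inv n) (Rationals.0≤inv n) ℚP.≤-refl
        (ℚP.≤-trans (Rationals.*-mono-≤ (Rationals.0≤inv n) Rationals.0≤1 ℚP.≤-refl (Rationals.^≤1 k (Rationals.0≤inv n) (Rationals.inv≤1 n))) (ℚP.≤-reflexive (ℚP.*-identityʳ i)))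

    Z : ℕ → ℕ → Carrier
    Z k = sum (s k)

    -- Y k converges to ζ(k + 1/2); for k = 0 the divergent part 2√n of the sum is removed
    Y : ℕ → ℕ → Carrier
    Y zero    n = Z 1 n - 2ι * √ n
    Y (suc k) n = Z (suc (suc k)) n

    private
      -- For k = 0 the increment q - 2δ is nonpositive and of size at most p - q; for larger k it is
      -- at most q³. Both are dominated by increments of multiples of 1/√n.
      half-line : ∀ k → ∃[ l ] (∀ n → ∣ Y k (suc n) - l ∣≤ 2ι * p n)
      half-line zero = proj₁ limit , λ n → ∣∣-weaken (0≤⇒≤ (p n) (solve 1 (λ p → con 2ℚ :* p := p :+ p) refl (p n)) (0≤p n)) (proj₂ limit n)
        where
        step : ∀ n → ∣ Y 0 (suc (suc n)) - Y 0 (suc n) ∣≤ p n - p (suc n)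
        step n = ∣∣-cong (trans (+-cong (-‿cong refl) (sym (s-1 (suc n))))
              (solve 4 (λ z t u v → (:- (con 2ℚ :* (v :- u))) :+ t := (z :+ t :- con 2ℚ :* v) :- (z :- con 2ℚ :* u)) refl (Z 1 (suc n)) (s 1 (suc n)) (√ (suc n)) (√ (suc (suc n)))))
            (∣∣-cong (solve 2 (λ d q → :- (d :- q) := (:- d) :+ q) refl (2ι * δ) (p (suc n)))
              (∣-∣ (0≤⇒∣∣ (≤⇒0≤ p≤2δ) (+-mono-≤ 2δ≤p ≤-refl))))
          where open Consecutive n
        limit = telescope-limit (λ n → Y 0 (suc n)) p step 0≤p p⟶0
      half-line (suc k) = telescope-limit (λ n → Y (suc k) (suc n)) (λ n → 2ι * p n) step
          (λ n → 0≤* (0≤ι (ℚP.nonNegative⁻¹ 2ℚ)) (0≤p n))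
          (⟶-cong (λ n → refl) (solve 0 (con 2ℚ :* con 0ℚ := con 0ℚ) refl) (⟶-* 1 2ι (∣ι∣ {2ℚ} ℚP.≤-refl) p⟶0))
        where
        step : ∀ n → ∣ Y (suc k) (suc (suc n)) - Y (suc k) (suc n) ∣≤ 2ι * p n - 2ι * p (suc n)
        step n = ∣∣-cong (solve 2 (λ z t → t := (z :+ t) :- z) refl (Z (suc (suc k)) (suc n)) (s (suc (suc k)) (suc n)))
          (0≤⇒∣∣ (0≤s (suc (suc k)) (suc n)) (≤-trans (s≤p³ k (suc n))
            (≤-respʳ (solve 2 (λ p q → con 2ℚ :* (p :- q) := con 2ℚ :* p :- con 2ℚ :* q) refl (p n) (p (suc n))) p³≤2[p-q])))
          where open Consecutive n

    ζ : ℕ → Carrier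
    ζ k = proj₁ (half-line k)

    Y⟶ζ : ∀ k → Y k ⟶ ζ k
    Y⟶ζ k = ⟶-suc (Y k) (⟶-squeeze (proj₂ (half-line k))
      (⟶-cong (λ n → refl) (solve 0 (con 2ℚ :* con 0ℚ := con 0ℚ) refl) (⟶-* 1 2ι (∣ι∣ {2ℚ} ℚP.≤-refl) p⟶0)))

    alternating : (ℕ → Carrier) → ℕ → Carrier
    alternating f = sum (λ j → ι (sgn j) * f j)

    alternating-odd : ∀ f m → alternating f (suc (m ℕ.* 2)) ≈ alternating f (m ℕ.* 2) + f (m ℕ.* 2)
    alternating-odd f m = +-cong refl (trans (*-cong (ι-cong (sgn-even m)) refl)
      (solve 1 (λ x → con 1ℚ :* x := x) refl (f (m ℕ.* 2))))

    alternating-even : ∀ f m → alternating f (suc m ℕ.* 2) ≈ alternating f (m ℕ.* 2) + f (m ℕ.* 2) - f (suc (m ℕ.* 2))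
    alternating-even f m = +-cong (alternating-odd f m) (trans (*-cong (ι-cong (≡.cong ℚ.-_ (sgn-even m))) refl)
      (solve 1 (λ x → con (ℚ.- 1ℚ) :* x := :- x) refl (f (suc (m ℕ.* 2)))))

    √-double : ∀ m → √ (suc m ℕ.* 2) ≈ √ (suc m) * √ 2
    √-double m = √-* m 1

    eta : ℕ → Carrier
    eta = alternating (s 1)

    -- The alternating sum is the full sum minus twice its even-indexed terms, and 2(2j)^(-1/2) = √2
    -- · j^(-1/2).
    eta-even : ∀ m → eta (m ℕ.* 2) ≈ Z 1 (m ℕ.* 2) - √ 2 * Z 1 m
    eta-even zero    = solve 1 (λ r → con 0ℚ := con 0ℚ :- r :* con 0ℚ) refl (√ 2)
    eta-even (suc m) = trans (alternating-even (s 1) m) (trans (+-cong (+-cong (eta-even m) refl) refl)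
      (modulo {c = 1ι} (sym double)
        (solve 6 (λ z r z′ t w x → (z :- r :* z′) :+ t :- w := (z :+ t :+ w) :- r :* (z′ :+ x) :+ con 1ℚ :* (r :* x :- con 2ℚ :* w)) refl
           (Z 1 (m ℕ.* 2)) (√ 2) (Z 1 m) (s 1 (m ℕ.* 2)) (s 1 (suc (m ℕ.* 2))) (s 1 m))))
      where
      double : 2ι * s 1 (suc (m ℕ.* 2)) ≈ √ 2 * s 1 m
      double = trans (*-cong refl (trans (s-1 (suc (m ℕ.* 2))) (*-cong (trans (ι-cong (Rationals.inv-*2 m)) (ι-* ½ (inv m))) (√-double m))))
        (trans (solve 3 (λ i u r → con 2ℚ :* (con ½ :* i :* (u :* r)) := r :* (i :* u)) refl (ι (inv m)) (√ (suc m)) (√ 2))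
        (*-cong refl (sym (s-1 m))))

    m≤m*2 : ∀ m → m ℕ.≤ m ℕ.* 2
    m≤m*2 m = ℕP.m≤m*n m 2

    √2≤2 : √ 2 ≤ ι 2ℚ
    √2≤2 = begin
      √ 2          ≈⟨ solve 1 (λ x → x := x :* con 1ℚ) refl (√ 2) ⟩
      √ 2 * 1ι     ≲⟨ *-monoˡ-≤ (0≤√ 2) (1≤√ 1) ⟩
      √ 2 * √ 2    ≈⟨ √² 2 ⟩
      ι 2ℚ         ∎

    ∣√2∣≤2 : ∣ √ 2 ∣≤ ι (nat 2)
    ∣√2∣≤2 = 0≤⇒∣∣ (0≤√ 2) √2≤2

    parity : ∀ {f : ℕ → Carrier} {l} → (λ m → f (m ℕ.* 2)) ⟶ l → (λ m → f (suc (m ℕ.* 2))) ⟶ l → f ⟶ l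
    parity {f} {l} he ho ε 0<ε =
      let M , hM = he ε 0<ε
          N , hN = ho ε 0<ε
      in (M ℕ.⊔ N) ℕ.* 2 , λ n ≤n → go M N n hM hN ≤n
      where
      split : ∀ n → ∃[ m ] (n ≡ m ℕ.* 2) ⊎ ∃[ m ] (n ≡ suc (m ℕ.* 2))
      split zero = inj₁ (0 , ≡.refl)
      split (suc n) with split n
      ... | inj₁ (m , eq) = inj₂ (m , ≡.cong suc eq)
      ... | inj₂ (m , eq) = inj₁ (suc m , ≡.cong suc eq)
      go : ∀ M N n → (∀ m → M ℕ.≤ m → ∣ f (m ℕ.* 2) - l ∣≤ ι ε) → (∀ m → N ℕ.≤ m → ∣ f (suc (m ℕ.* 2)) - l ∣≤ ι ε) →
           (M ℕ.⊔ N) ℕ.* 2 ℕ.≤ n → ∣ f n - l ∣≤ ι ε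
      go M N n hM hN ≤n with split n
      ... | inj₁ (m , ≡.refl) = hM m (ℕP.m⊔n≤o⇒m≤o M N (ℕP.*-cancelʳ-≤ (M ℕ.⊔ N) m 2 ≤n))
      ... | inj₂ (m , ≡.refl) = hN m (ℕP.m⊔n≤o⇒n≤o M N (half (M ℕ.⊔ N) m ≤n))
        where
        half : ∀ a m → a ℕ.* 2 ℕ.≤ suc (m ℕ.* 2) → a ℕ.≤ m
        half zero    m       _ = ℕ.z≤n
        half (suc a) (suc m) (ℕ.s≤s (ℕ.s≤s h)) = ℕ.s≤s (half a m h)

    -- In Y(2m) - √2 Y(m) the corrections 2√(2m) and √2 · 2√m cancel, so the even partial sums
    -- converge to ζ - √2 ζ. The odd ones differ from them by a null sequence.
    eta⟶ : eta ⟶ ((1ι - √ 2) * ζ 0)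
    eta⟶ = parity even (⟶-cong odd≈ (solve 1 (λ l → l :+ con 0ℚ := l) refl ((1ι - √ 2) * ζ 0))
        (⟶-+ even (⟶-sub p (ℕ._* 2) m≤m*2 p⟶0)))
      where
      odd≈ : ∀ m → eta (m ℕ.* 2) + p (m ℕ.* 2) ≈ eta (suc (m ℕ.* 2))
      odd≈ m = sym (trans (alternating-odd (s 1) m) (+-cong refl (s-1 (m ℕ.* 2))))
      even-Y : ∀ m → Y 0 (suc m ℕ.* 2) + (- (√ 2 * Y 0 (suc m))) ≈ eta (suc m ℕ.* 2)
      even-Y m = sym (trans (eta-even (suc m)) (modulo {c = 2ι} (√-double m)
        (solve 5 (λ z z′ r u w → z :- r :* z′ := (z :- con 2ℚ :* w) :+ (:- (r :* (z′ :- con 2ℚ :* u))) :+ con 2ℚ :* (w :- u :* r)) refl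
          (Z 1 (suc m ℕ.* 2)) (Z 1 (suc m)) (√ 2) (√ (suc m)) (√ (suc m ℕ.* 2)))))
      even : (λ m → eta (m ℕ.* 2)) ⟶ ((1ι - √ 2) * ζ 0)
      even = ⟶-suc (λ m → eta (m ℕ.* 2)) (⟶-cong even-Y (solve 2 (λ z r → z :+ (:- (r :* z)) := (con 1ℚ :- r) :* z) refl (ζ 0) (√ 2))
        (⟶-+ (⟶-sub (Y 0) (λ m → suc m ℕ.* 2) (λ m → ℕP.≤-trans (ℕP.n≤1+n m) (m≤m*2 (suc m))) (Y⟶ζ 0))
             (⟶-neg (⟶-* 1 (√ 2) ∣√2∣≤2 (⟶-sub (Y 0) suc ℕP.n≤1+n (Y⟶ζ 0))))))

-- The limit C, the error estimate and the series for C.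

module Constant where
  open import Data.Nat as ℕ using (ℕ; zero; suc)
  import Data.Nat.Properties as ℕP
  open import Data.Rational as ℚ using (ℚ; 0ℚ; 1ℚ; ½)
  import Data.Rational.Properties as ℚP
  open import Data.Product using (_,_; ∃-syntax; proj₁; proj₂)
  open import Relation.Binary.PropositionalEquality as ≡ using (_≡_)
  open Rationals using (nat; inv; 2ℚ; ⅛; P; b; sgn; coef)
  open OrderedFields
  open ZetaValues

  module Constant (F : SqrtField) where
    open Zeta F public

    A : ℕ → Carrier
    A = alternating (λ j → √ (suc j))

    B : ℕ → Carrier
    B m = A (suc (m ℕ.* 2)) - ι ½ * √ (suc (m ℕ.* 2)) - ι ⅛ * p (m ℕ.* 2)

    e : ℕ → ℚ
    e m = nat 3 ℚ.* (inv (m ℕ.* 2) ℚ.* inv (m ℕ.* 2))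

    √≤nat : ∀ n → √ (suc n) ≤ ι (nat (suc n))
    √≤nat n = begin
      √ (suc n)               ≈⟨ solve 1 (λ x → x := x :* con 1ℚ) refl (√ (suc n)) ⟩
      √ (suc n) * 1ι          ≲⟨ *-monoˡ-≤ (0≤√ (suc n)) (1≤√ n) ⟩
      √ (suc n) * √ (suc n)   ≈⟨ √² (suc n) ⟩
      ι (nat (suc n))         ∎

    A-odd-suc : ∀ m → A (suc (suc m ℕ.* 2)) ≈ A (suc (m ℕ.* 2)) + (√ (suc (suc (suc (m ℕ.* 2)))) - √ (suc (suc (m ℕ.* 2))))
    A-odd-suc m = trans (alternating-odd (λ j → √ (suc j)) (suc m)) (trans (+-cong (alternating-even (λ j → √ (suc j)) m) refl)
      (trans (solve 4 (λ a x u c → a :+ x :- u :+ c := a :+ x :+ (c :- u)) refl (A (m ℕ.* 2)) (√ (suc (m ℕ.* 2))) (√ (suc (suc (m ℕ.* 2)))) (√ (suc (suc (suc (m ℕ.* 2))))))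
        (+-cong (sym (alternating-odd (λ j → √ (suc j)) m)) refl)))

    -- Both outer roots are expanded around the middle one, √N with N = 2m+2. The error consists of
    -- their two remainders, weighted by |α| ≤ 1 and |β| ≤ 1, and of δ√N, where √N is simply bounded
    -- by N.
    B-step : ∀ m → ∣ B (suc m) - B m ∣≤ ι (e m) - ι (e (suc m))
    B-step m = ∣∣-weaken bound (∣∣-cong (sym split)
        (∣+∣ (∣+∣ (∣*∣ (∣ι∣ ∣α∣≤1) hc) (∣*∣ (∣ι∣ ∣β∣≤1) ha))
             (∣*∣ (∣ι∣ {δ} (ℚP.≤-reflexive (≡.trans (≡.cong ℚ.∣_∣ δ≡) (ℚP.0≤p⇒∣p∣≡p 0≤δ)))) (0≤⇒∣∣ (0≤√ (suc (suc k))) (√≤nat (suc k))))))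
      where
      k = m ℕ.* 2
      open Rationals.Reciprocals k
      i = inv k
      x = inv (suc k)
      j = inv (suc (suc k))
      a = √ (suc k)
      u = √ (suc (suc k))
      c = √ (suc (suc (suc k)))
      p⁺ = P 3 x
      p⁻ = P 3 (ℚ.- x)
      x³ = 2ℚ ℚ.* x ℚ.* (x ℚ.* x)
      δ′ = γ ℚ.* (x ℚ.* x ℚ.* (i ℚ.* j))
      0≤δ : 0ℚ ℚ.≤ δ′
      0≤δ = Rationals.0≤* (ℚP.nonNegative⁻¹ γ) (Rationals.0≤* (Rationals.0≤* (Rationals.0≤inv (suc k)) (Rationals.0≤inv (suc k))) (Rationals.0≤* (Rationals.0≤inv k) (Rationals.0≤inv (suc (suc k)))))
      hc : ∣ c - ι p⁺ * u ∣≤ ι x³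
      hc = ∣∣-weaken (≤-reflexive (ι-cong N*∣x⁴∣)) (√-series (suc (suc k)) (suc (suc k)) 2 x
        (Rationals.nat*[1+inv] (suc k)) (Rationals.∣inv∣≤½ k))
      ha : ∣ a - ι p⁻ * u ∣≤ ι x³
      ha = ∣∣-weaken (≤-reflexive (ι-cong N*∣-x⁴∣)) (√-series (suc (suc k)) k 2 (ℚ.- x)
        (Rationals.nat*[1-inv] (suc k)) (≡.subst (ℚ._≤ ½) (≡.sym (ℚP.∣-p∣≡∣p∣ x)) (Rationals.∣inv∣≤½ k)))
      ια : ι α ≈ ι ½ - ι ⅛ * ι j
      ια = trans (ι-+ ½ (ℚ.- (⅛ ℚ.* j))) (+-cong refl (trans (ι-neg (⅛ ℚ.* j)) (-‿cong (ι-* ⅛ j))))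
      ιβ : ι β ≈ ι ½ + ι ⅛ * ι i
      ιβ = trans (ι-+ ½ (⅛ ℚ.* i)) (+-cong refl (ι-* ⅛ i))
      ιδ : ι δ ≈ (ι ½ - ι ⅛ * ι j) * ι p⁺ + (ι ½ + ι ⅛ * ι i) * ι p⁻ - 1ι
      ιδ = trans (ι-+ (α ℚ.* p⁺ ℚ.+ β ℚ.* p⁻) (ℚ.- 1ℚ)) (+-cong
        (trans (ι-+ (α ℚ.* p⁺) (β ℚ.* p⁻)) (+-cong (trans (ι-* α p⁺) (*-cong ια refl)) (trans (ι-* β p⁻) (*-cong ιβ refl)))) (ι-neg 1ℚ))
      split : B (suc m) - B m ≈ ι α * (c - ι p⁺ * u) + ι β * (a - ι p⁻ * u) + ι δ * u
      split = trans (+-cong (+-cong (+-cong (A-odd-suc m) refl) refl) refl)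
        (trans (solve 8 (λ A a u c i j p⁺ p⁻ →
            (A :+ (c :- u) :- con ½ :* c :- con ⅛ :* (j :* c)) :- (A :- con ½ :* a :- con ⅛ :* (i :* a))
            := (con ½ :- con ⅛ :* j) :* (c :- p⁺ :* u) :+ (con ½ :+ con ⅛ :* i) :* (a :- p⁻ :* u)
               :+ ((con ½ :- con ⅛ :* j) :* p⁺ :+ (con ½ :+ con ⅛ :* i) :* p⁻ :- con 1ℚ) :* u) refl
            (A (suc k)) a u c (ι i) (ι j) (ι p⁺) (ι p⁻))
        (sym (+-cong (+-cong (*-cong ια refl) (*-cong ιβ refl)) (*-cong ιδ refl))))
      bound : ι 1ℚ * ι x³ + ι 1ℚ * ι x³ + ι δ′ * ι (nat (suc (suc k))) ≤ ι (e m) - ι (e (suc m))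
      bound = begin
        1ι * ι x³ + 1ι * ι x³ + ι δ′ * ι (nat (suc (suc k)))
          ≈⟨ solve 2 (λ x y → con 1ℚ :* x :+ con 1ℚ :* x :+ y := x :+ x :+ y) refl (ι x³) (ι δ′ * ι (nat (suc (suc k)))) ⟩
        ι x³ + ι x³ + ι δ′ * ι (nat (suc (suc k)))
          ≈⟨ trans (ι-+ (x³ ℚ.+ x³) (δ′ ℚ.* nat (suc (suc k)))) (+-cong (ι-+ x³ x³) (ι-* δ′ (nat (suc (suc k))))) ⟨
        ι (x³ ℚ.+ x³ ℚ.+ δ′ ℚ.* nat (suc (suc k)))
          ≲⟨ ι-mono error ⟩
        ι (e m ℚ.- e (suc m))
          ≈⟨ trans (ι-+ (e m) (ℚ.- e (suc m))) (+-cong refl (ι-neg (e (suc m)))) ⟩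
        ι (e m) - ι (e (suc m)) ∎

    0≤e : ∀ m → 0ℚ ℚ.≤ e m
    0≤e m = Rationals.0≤* (Rationals.0≤nat 3) (Rationals.0≤* (Rationals.0≤inv (m ℕ.* 2)) (Rationals.0≤inv (m ℕ.* 2)))

    e⟶0 : (λ m → ι (e m)) ⟶ 0ι
    e⟶0 = 0≤⇒⟶0 (λ m → 0≤ι (0≤e m)) λ ε 0<ε →
      let k , k≤ = Rationals.archimedean (inv 2 ℚ.* ε) (≡.subst (ℚ._< inv 2 ℚ.* ε) (ℚP.*-zeroʳ (inv 2)) (ℚP.*-monoʳ-<-pos (inv 2) {{ℚ.positive (Rationals.0<inv 2)}} 0<ε))
      in k , λ n k≤n → ι-mono (ℚP.≤-trans
        (Rationals.*-mono-≤ (Rationals.0≤nat 3) (Rationals.0≤* (Rationals.0≤inv 2) (ℚP.<⇒≤ 0<ε)) ℚP.≤-refl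
          (ℚP.≤-trans (Rationals.*-mono-≤ (Rationals.0≤inv (n ℕ.* 2)) Rationals.0≤1 ℚP.≤-refl (Rationals.inv≤1 (n ℕ.* 2)))
          (ℚP.≤-trans (ℚP.≤-reflexive (ℚP.*-identityʳ (inv (n ℕ.* 2))))
          (ℚP.≤-trans (Rationals.inv-antimono (ℕP.≤-trans k≤n (m≤m*2 n))) k≤))))
        (ℚP.≤-reflexive (≡.trans (≡.sym (ℚP.*-assoc (nat 3) (inv 2) ε)) (ℚP.*-identityˡ ε))))

    private
      B-limit : ∃[ l ] (∀ m → ∣ B m - l ∣≤ ι (e m))
      B-limit = telescope-limit B (λ m → ι (e m)) B-step (λ m → 0≤ι (0≤e m)) e⟶0

    C : Carrier
    C = proj₁ B-limit

    B⟶C : B ⟶ C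
    B⟶C = ⟶-squeeze (proj₂ B-limit) e⟶0

    sum-√* : ∀ n k → sum (λ j → ι (sgn j) * √ (suc j ℕ.* suc n)) k ≈ A k * √ (suc n)
    sum-√* n zero    = solve 1 (λ x → con 0ℚ := con 0ℚ :* x) refl (√ (suc n))
    sum-√* n (suc k) = trans (+-cong (sum-√* n k) (*-cong refl (√-* k n)))
      (solve 4 (λ a r s t → a :* r :+ s :* (t :* r) := (a :+ s :* t) :* r) refl (A k) (√ (suc n)) (ι (sgn k)) (√ (suc k)))

    asymptotics : ∀ m → let n = suc (m ℕ.* 2) in
      ∣ sum (λ j → ι (sgn j) * √ (suc j ℕ.* n)) n - ι (½ ℚ.* nat n) - C * √ n - ι ⅛ ∣≤ ι (nat 3) * ι (inv (m ℕ.* 2))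
    asymptotics m = ∣∣-weaken bound (∣∣-cong (sym split)
        (∣*∣ (0≤⇒∣∣ (0≤√ n) (√≤nat k)) (proj₂ B-limit m)))
      where
      k = m ℕ.* 2
      n = suc k
      split : sum (λ j → ι (sgn j) * √ (suc j ℕ.* n)) n - ι (½ ℚ.* nat n) - C * √ n - ι ⅛ ≈ √ n * (B m - C)
      split = trans (+-cong (+-cong (+-cong (sum-√* k n) (-‿cong (trans (ι-* ½ (nat n)) (*-cong refl (sym (√² n)))))) refl) refl)
        (modulo {c = ι ⅛} (p-√ k) (solve 4 (λ a r c p → a :* r :- con ½ :* (r :* r) :- c :* r :- con ⅛
          := r :* (a :- con ½ :* r :- con ⅛ :* p :- c) :+ con ⅛ :* (p :* r :- con 1ℚ)) refl (A n) (√ n) C (p k)))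
      bound : ι (nat n) * ι (e m) ≤ ι (nat 3) * ι (inv k)
      bound = ≤-reflexive (trans (sym (ι-* (nat n) (e m))) (trans (ι-cong (Rationals.nat*3inv² k)) (ι-* (nat 3) (inv k))))

    -- The series for C

    W : ℕ → ℕ → Carrier
    W K m = sum (λ k → ι (coef k) * Z (suc k) m) K

    -- The exchange of the two finite sums, one value of m at a time: it isolates the terms
    -- belonging to a single root.
    W-suc : ∀ K m → W K (suc m) ≈ W K m + sum (λ k → ι (coef k) * s (suc k) m) K
    W-suc zero    m = solve 0 (con 0ℚ := con 0ℚ :+ con 0ℚ) refl
    W-suc (suc K) m = trans (+-cong (W-suc K m) refl)
      (solve 5 (λ w t c z s → w :+ t :+ c :* (z :+ s) := w :+ c :* z :+ (t :+ c :* s)) refl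
        (W K m) (sum (λ k → ι (coef k) * s (suc k) m) K) (ι (coef K)) (Z (suc K) m) (s (suc K) m))

    -- Termwise, √(2m) (2m)^(-k) = √2 · 2^(-k) · m^(1/2-k) with m = i+1.
    P-expand : ∀ K i → ι (P K (inv (suc (i ℕ.* 2)))) * √ (suc i ℕ.* 2)
      ≈ √ (suc i ℕ.* 2) + √ 2 * sum (λ k → ι (coef k) * s (suc k) i) K
    P-expand zero i = trans (*-cong (ι-cong (≡.trans (≡.cong (λ z → 1ℚ ℚ.+ z) (ℚP.*-zeroʳ (inv (suc (i ℕ.* 2))))) (ℚP.+-identityʳ 1ℚ))) refl)
      (solve 2 (λ w r → con 1ℚ :* w := w :+ r :* con 0ℚ) refl (√ (suc i ℕ.* 2)) (√ 2))
    P-expand (suc K) i = trans (*-cong (trans (ι-cong (Rationals.horner-snoc b (suc K) x)) (ι-+ (P K x) (b (suc K) ℚ.* x Rationals.^ suc K))) refl)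
      (trans (solve 3 (λ p t w → (p :+ t) :* w := p :* w :+ t :* w) refl (ι (P K x)) (ι (b (suc K) ℚ.* x Rationals.^ suc K)) w)
      (trans (+-cong (P-expand K i) (trans (*-cong (trans (ι-cong coef≡) (ι-* (coef K) (inv i Rationals.^ suc K))) (√-double i))
        (solve 4 (λ c v u r → c :* v :* (u :* r) := r :* (c :* (v :* u))) refl (ι (coef K)) (ι (inv i Rationals.^ suc K)) (√ (suc i)) (√ 2))))
      (solve 4 (λ w r t y → w :+ r :* t :+ r :* y := w :+ r :* (t :+ y)) refl w (√ 2) (sum (λ k → ι (coef k) * s (suc k) i) K) (ι (coef K) * s (suc K) i))))
      where
      x = inv (suc (i ℕ.* 2))
      w = √ (suc i ℕ.* 2)
      coef≡ : b (suc K) ℚ.* x Rationals.^ suc K ≡ coef K ℚ.* inv i Rationals.^ suc K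
      coef≡ = ≡.trans (≡.cong (λ z → b (suc K) ℚ.* z Rationals.^ suc K) (Rationals.inv-*2 i)) (≡.trans (≡.cong (b (suc K) ℚ.*_) (Rationals.^-distrib-* ½ (inv i) (suc K)))
        (≡.sym (ℚP.*-assoc (b (suc K)) (½ Rationals.^ suc K) (inv i Rationals.^ suc K))))

    -- V K m = Σ_{1 ≤ i ≤ m} (√(2i+1) - √(2i) P_K(1/(2i)))
    V : ℕ → ℕ → Carrier
    V K m = A (suc (m ℕ.* 2)) - 1ι - √ 2 * W K m

    -- The increment is √(2i+3) minus its binomial approximation around 2i+2. Degree K+2 is used
    -- because two powers of 1/(2i+2) pay for the summation over i and one cancels the factor 2i+2,
    -- leaving K powers for 2^-K.
    V-step : ∀ K i → ∣ V (suc (suc K)) (suc i) - V (suc (suc K)) i ∣≤ ι (½ Rationals.^ K ℚ.* inv i) - ι (½ Rationals.^ K ℚ.* inv (suc i))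
    V-step K i = ∣∣-weaken (≤-trans (ι-mono (Rationals.remainder-bound K i)) (≤-reflexive (trans (ι-+ (h ℚ.* inv i) (ℚ.- (h ℚ.* inv (suc i)))) (+-cong refl (ι-neg (h ℚ.* inv (suc i)))))))
        (∣∣-cong (sym split) (√-series (suc i ℕ.* 2) (suc i ℕ.* 2) (suc K) x
        (Rationals.nat*[1+inv] (suc (i ℕ.* 2))) (Rationals.∣inv∣≤½ (i ℕ.* 2))))
      where
      x = inv (suc (i ℕ.* 2))
      h = ½ Rationals.^ K
      K₂ = suc (suc K)
      S = sum (λ k → ι (coef k) * s (suc k) i) K₂
      split : V K₂ (suc i) - V K₂ i ≈ √ (suc (suc i ℕ.* 2)) - ι (P K₂ x) * √ (suc i ℕ.* 2)
      split = trans (+-cong (+-cong (+-cong (A-odd-suc i) refl) (-‿cong (*-cong refl (W-suc K₂ i)))) refl)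
        (trans (solve 6 (λ a c u r w t → (a :+ (c :- u) :- con 1ℚ :- r :* (w :+ t)) :- (a :- con 1ℚ :- r :* w) := c :- (u :+ r :* t)) refl
          (A (suc (i ℕ.* 2))) (√ (suc (suc i ℕ.* 2))) (√ (suc i ℕ.* 2)) (√ 2) (W K₂ i) S)
        (+-cong refl (-‿cong (sym (P-expand K₂ i)))))

    W-0 : ∀ K → W K 0 ≈ 0ι
    W-0 zero    = refl
    W-0 (suc K) = trans (+-cong (W-0 K) refl) (solve 1 (λ c → con 0ℚ :+ c :* con 0ℚ := con 0ℚ) refl (ι (coef K)))

    V-0 : ∀ K → V K 0 ≈ 0ι
    V-0 K = trans (+-cong (+-cong (+-cong refl (*-cong refl √1≈1)) refl) (-‿cong (*-cong refl (W-0 K))))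
        (solve 1 (λ r → con 0ℚ :+ con 1ℚ :* con 1ℚ :- con 1ℚ :- r :* con 0ℚ := con 0ℚ) refl (√ 2))
      where
      √1≈1 : √ 1 ≈ 1ι
      √1≈1 = √-unique 0 (0≤ι Rationals.0≤1) (solve 0 (con 1ℚ :* con 1ℚ := con 1ℚ) refl)

    -- Uniform in m: V vanishes at 0 and the dominating sequence starts at 2^-K.
    V-bound : ∀ K m → ∣ V (suc (suc K)) m ∣≤ ι (½ Rationals.^ K)
    V-bound K m = ∣∣-weaken (≤-reflexive (ι-cong (ℚP.*-identityʳ (½ Rationals.^ K))))
      (∣∣-cong (trans (+-cong refl (-‿cong (V-0 (suc (suc K))))) (solve 1 (λ v → v :- con 0ℚ := v) refl (V (suc (suc K)) m)))
        (telescope-≤ (V (suc (suc K))) (λ i → ι (½ Rationals.^ K ℚ.* inv i)) (V-step K)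
          (λ i → 0≤ι (Rationals.0≤* (Rationals.0≤^ K Rationals.0≤½) (Rationals.0≤inv i))) {0} {m} ℕ.z≤n))

    W′ : ℕ → ℕ → Carrier
    W′ K m = sum (λ k → ι (coef k) * Y k m) K

    -- Only the term of ζ(1/2) carries a divergent part, 2√m with coefficient 1/4.
    W-Y : ∀ K m → W (suc K) m ≈ W′ (suc K) m + ι ½ * √ m
    W-Y zero    m = solve 2 (λ z r → con 0ℚ :+ con (coef 0) :* z := con 0ℚ :+ con (coef 0) :* (z :- con 2ℚ :* r) :+ con ½ :* r) refl (Z 1 m) (√ m)
    W-Y (suc K) m = trans (+-cong (W-Y K m) refl)
      (solve 3 (λ w r t → w :+ r :+ t := w :+ t :+ r) refl (W′ (suc K) m) (ι ½ * √ m) (ι (coef (suc K)) * Z (suc (suc K)) m))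

    partial : ℕ → Carrier
    partial = sum (λ k → ι (coef k) * ζ k)

    W′⟶partial : ∀ K → W′ K ⟶ partial K
    W′⟶partial zero    = ⟶-const 0ι
    W′⟶partial (suc K) = ⟶-+ (W′⟶partial K) (⟶-* 0 (ι (coef K)) (∣ι∣ ∣coef∣≤1) (Y⟶ζ K))
      where
      ∣coef∣≤1 : ℚ.∣ coef K ∣ ℚ.≤ nat 1
      ∣coef∣≤1 = Rationals.∣*∣≤ {b (suc K)} {½ Rationals.^ suc K} {1ℚ} {1ℚ} (ℚP.≤-trans (Rationals.∣b∣≤½ K) (Rationals.inv≤1 1))
        (≡.subst (ℚ._≤ 1ℚ) (≡.sym (ℚP.0≤p⇒∣p∣≡p (Rationals.0≤^ (suc K) Rationals.0≤½))) (Rationals.^≤1 (suc K) Rationals.0≤½ (Rationals.inv≤1 1)))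

    gap : ℕ → Carrier
    gap m = √ (suc (suc m ℕ.* 2)) - √ (suc m ℕ.* 2)

    gap⟶0 : gap ⟶ 0ι
    gap⟶0 = ⟶-squeeze bound (⟶-sub p (λ m → suc (m ℕ.* 2)) (λ m → ℕP.≤-trans (m≤m*2 m) (ℕP.n≤1+n (m ℕ.* 2))) p⟶0)
      where
      bound : ∀ m → ∣ gap m - 0ι ∣≤ p (suc (m ℕ.* 2))
      bound m = ∣∣-cong (solve 1 (λ d → d := d :- con 0ℚ) refl (gap m))
          (0≤⇒∣∣ 0≤δ (≤-trans (0≤⇒≤ δ (solve 1 (λ d → con 2ℚ :* d := d :+ d) refl δ) 0≤δ) 2δ≤p))
        where open Consecutive (suc (m ℕ.* 2))

    -- The divergent part √2 · ½√m equals ½√(2m); against the ½√n contained in B it leaves half of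
    -- `gap`, which tends to 0.
    V⟶ : ∀ K → (λ m → V (suc K) (suc m)) ⟶ (C - 1ι - √ 2 * partial (suc K))
    V⟶ K = ⟶-cong split limit
        (⟶-+ (⟶-sub B suc ℕP.n≤1+n B⟶C)
        (⟶-+ (⟶-const (- 1ι))
        (⟶-+ (⟶-neg (⟶-* 1 (√ 2) ∣√2∣≤2 (⟶-sub (W′ (suc K)) suc ℕP.n≤1+n (W′⟶partial (suc K)))))
        (⟶-+ (⟶-* 0 (ι ⅛) (∣ι∣ (Rationals.inv≤1 7)) (⟶-sub p (λ m → suc m ℕ.* 2) (λ m → ℕP.≤-trans (ℕP.n≤1+n m) (m≤m*2 (suc m))) p⟶0))
             (⟶-* 0 (ι ½) (∣ι∣ (Rationals.inv≤1 1)) gap⟶0)))))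
      where
      split : ∀ m → B (suc m) + (- 1ι + (- (√ 2 * W′ (suc K) (suc m)) + (ι ⅛ * p (suc m ℕ.* 2) + ι ½ * gap m))) ≈ V (suc K) (suc m)
      split m = sym (trans (+-cong refl (-‿cong (*-cong refl (W-Y K (suc m)))))
        (modulo {c = ι ½} (√-double m) (solve 7 (λ a r w u v c p → a :- con 1ℚ :- r :* (w :+ con ½ :* u)
           := (a :- con ½ :* c :- con ⅛ :* p) :+ (:- con 1ℚ :+ (:- (r :* w) :+ (con ⅛ :* p :+ con ½ :* (c :- v)))) :+ con ½ :* (v :- u :* r)) refl
           (A (suc (suc m ℕ.* 2))) (√ 2) (W′ (suc K) (suc m)) (√ (suc m)) (√ (suc m ℕ.* 2)) (√ (suc (suc m ℕ.* 2))) (p (suc m ℕ.* 2)))))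
      limit : C + (- 1ι + (- (√ 2 * partial (suc K)) + (ι ⅛ * 0ι + ι ½ * 0ι))) ≈ C - 1ι - √ 2 * partial (suc K)
      limit = solve 3 (λ c r w → c :+ (:- con 1ℚ :+ (:- (r :* w) :+ (con ⅛ :* con 0ℚ :+ con ½ :* con 0ℚ))) := c :- con 1ℚ :- r :* w) refl C (√ 2) (partial (suc K))

    partial-bound : ∀ K → ∣ C - 1ι - √ 2 * partial (suc (suc K)) ∣≤ ι (½ Rationals.^ K)
    partial-bound K = ⟶-∣∣ (V⟶ (suc K)) (λ m → V-bound K (suc m))

    -- This is (C - 1)/√2, written without division.
    S : Carrier
    S = ι ½ * √ 2 * (C - 1ι)

    C≈ : C ≈ 1ι + √ 2 * S
    C≈ = modulo {c = - (ι ½ * (C - 1ι))} (√² 2) (solve 2 (λ c r → c := con 1ℚ :+ r :* (con ½ :* r :* (c :- con 1ℚ))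
        :+ (:- (con ½ :* (c :- con 1ℚ))) :* (r :* r :- con (nat 2))) refl C (√ 2))

    partial⟶S : partial ⟶ S
    partial⟶S = ⟶-suc partial (⟶-suc (λ K → partial (suc K)) (⟶-squeeze bound ½^⟶0))
      where
      ½^⟶0 : (λ K → ι (½ Rationals.^ K)) ⟶ 0ι
      ½^⟶0 = 0≤⇒⟶0 (λ K → 0≤ι (Rationals.0≤^ K Rationals.0≤½)) λ ε 0<ε →
        let k , k≤ = Rationals.archimedean ε 0<ε in k , λ n k≤n → ι-mono (ℚP.≤-trans (Rationals.½^≤inv n) (ℚP.≤-trans (Rationals.inv-antimono k≤n) k≤))
      ∣½√2∣≤1 : ∣ ι ½ * √ 2 ∣≤ 1ι
      ∣½√2∣≤1 = 0≤⇒∣∣ (0≤* (0≤ι Rationals.0≤½) (0≤√ 2)) (≤-respʳ (solve 0 (con ½ :* con 2ℚ := con 1ℚ) refl) (*-monoˡ-≤ (0≤ι Rationals.0≤½) √2≤2))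
      bound : ∀ K → ∣ partial (suc (suc K)) - S ∣≤ ι (½ Rationals.^ K)
      bound K = ∣∣-cong
        (sym (modulo {c = - (ι ½ * w)} (√² 2) (solve 3 (λ w r c → w :- con ½ :* r :* (c :- con 1ℚ)
          := :- (con ½ :* r :* (c :- con 1ℚ :- r :* w)) :+ (:- (con ½ :* w)) :* (r :* r :- con (nat 2))) refl w (√ 2) C)))
        (∣-∣ (∣∣-weaken (≤-reflexive (solve 1 (λ h → con 1ℚ :* h := h) refl (ι (½ Rationals.^ K)))) (∣*∣ ∣½√2∣≤1 (partial-bound K))))
        where w = partial (suc (suc K))

-- The coefficients as central binomial coefficients.

module Coefficients where
  open import Data.Nat as ℕ using (ℕ; zero; suc; _!)
  import Data.Nat.Properties as ℕP
  open import Data.Nat.Combinatorics using (_C_; nCk≡n!/k![n-k]!; k![n∸k]!∣n!)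
  open import Data.Nat.DivMod using (m/n*n≡m)
  import Data.Integer as ℤ
  open import Data.Integer using (-1ℤ)
  open import Data.Rational
  import Data.Rational.Properties as ℚP
  open import Data.Rational.Solver using (module +-*-Solver)
  open import Relation.Binary.PropositionalEquality hiding (J)
  open Rationals
  open import Defs using (sign; coeff)
  open +-*-Solver

  central : ∀ k → ((2 ℕ.* k) C k) ℕ.* (k ! ℕ.* k !) ≡ (2 ℕ.* k) !
  central k = trans (cong (ℕ._* (k ! ℕ.* k !)) (nCk≡n!/k![n-k]! k≤2k))
      (trans (cong (λ j → _/ₙ_ ((2 ℕ.* k) !) (k ! ℕ.* (2 ℕ.* k ℕ.∸ k) !) {{k ℕP.!* (2 ℕ.* k ℕ.∸ k) !≢0}} ℕ.* (k ! ℕ.* j !)) (sym 2k∸k))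
        (m/n*n≡m {{k ℕP.!* (2 ℕ.* k ℕ.∸ k) !≢0}} (k![n∸k]!∣n! k≤2k)))
    where
    open import Data.Nat.DivMod renaming (_/_ to _/ₙ_) using ()
    k≤2k : k ℕ.≤ 2 ℕ.* k
    k≤2k = ℕP.m≤m+n k (k ℕ.+ 0)
    2k∸k : 2 ℕ.* k ℕ.∸ k ≡ k
    2k∸k = trans (ℕP.m+n∸m≡n k (k ℕ.+ 0)) (ℕP.+-identityʳ k)

  signℚ : ℕ → ℚ
  signℚ k = sign k / 1

  signℚ-suc : ∀ k → signℚ (suc k) ≡ - signℚ k
  signℚ-suc k = trans (/1-* -1ℤ (sign k)) (solve 1 (λ x → con (- 1ℚ) :* x := :- x) refl (signℚ k))

  -- Passing from k to k+1 multiplies both sides by -2(k+1)(2k+1). The factor 2k-1 is formed in ℚ,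
  -- so that the induction can start at k = 0, where it is -1.
  b-factorial : ∀ k → b k * nat 4 ^ k * (2ℚ * nat k - 1ℚ) * (nat (k !) * nat (k !)) ≡ signℚ k * nat ((2 ℕ.* k) !)
  b-factorial zero    = refl
  b-factorial (suc k) = begin
      b k * (½ - N) * inv k * (nat 4 * f) * (2ℚ * (1ℚ + N) - 1ℚ) * (nat (suc k ℕ.* k !) * nat (suc k ℕ.* k !))
        ≡⟨ cong (λ z → b k * (½ - N) * inv k * (nat 4 * f) * (2ℚ * (1ℚ + N) - 1ℚ) * (z * z)) (nat-* (suc k) (k !)) ⟩
      b k * (½ - N) * inv k * (nat 4 * f) * (2ℚ * (1ℚ + N) - 1ℚ) * ((1ℚ + N) * g * ((1ℚ + N) * g))
        ≡⟨ solve 5 (λ β n i f g → β :* (con ½ :- n) :* i :* (con (nat 4) :* f) :* (con 2ℚ :* (con 1ℚ :+ n) :- con 1ℚ) :* ((con 1ℚ :+ n) :* g :* ((con 1ℚ :+ n) :* g))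
             := (:- (β :* f :* (con 2ℚ :* n :- con 1ℚ) :* (g :* g))) :* (con 2ℚ :* (con 1ℚ :+ n) :* (con 1ℚ :+ con 2ℚ :* n)) :* ((con 1ℚ :+ n) :* i)) refl (b k) N (inv k) f g ⟩
      - (b k * f * (2ℚ * N - 1ℚ) * (g * g)) * (2ℚ * (1ℚ + N) * (1ℚ + 2ℚ * N)) * ((1ℚ + N) * inv k)
        ≡⟨ cong₂ (λ y z → - y * (2ℚ * (1ℚ + N) * (1ℚ + 2ℚ * N)) * z) (b-factorial k) (nat-inv k) ⟩
      - (signℚ k * h) * (2ℚ * (1ℚ + N) * (1ℚ + 2ℚ * N)) * 1ℚ
        ≡⟨ solve 3 (λ s h n → :- (s :* h) :* (con 2ℚ :* (con 1ℚ :+ n) :* (con 1ℚ :+ con 2ℚ :* n)) :* con 1ℚ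
             := (:- s) :* ((con 1ℚ :+ (con 1ℚ :+ con (nat 2) :* n)) :* ((con 1ℚ :+ con (nat 2) :* n) :* h))) refl (signℚ k) h N ⟩
      - signℚ k * ((1ℚ + (1ℚ + nat 2 * N)) * ((1ℚ + nat 2 * N) * h))
        ≡⟨ cong₂ _*_ (signℚ-suc k) (trans (nat-* (suc (suc (2 ℕ.* k))) ((suc (2 ℕ.* k)) !)) (cong₂ (λ y z → (1ℚ + (1ℚ + y)) * z) (nat-* 2 k)
             (trans (nat-* (suc (2 ℕ.* k)) ((2 ℕ.* k) !)) (cong (λ y → (1ℚ + y) * h) (nat-* 2 k))))) ⟨
      signℚ (suc k) * nat ((suc (suc (2 ℕ.* k))) !)
        ≡⟨ cong (λ z → signℚ (suc k) * nat (suc z !)) (ℕP.+-suc k (k ℕ.+ 0)) ⟨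
      signℚ (suc k) * nat ((2 ℕ.* suc k) !) ∎
    where
    open ≡-Reasoning
    N = nat k
    f = nat 4 ^ k
    g = nat (k !)
    h = nat ((2 ℕ.* k) !)

  *-cancelʳ-nat : ∀ n .{{_ : ℕ.NonZero n}} {p q} → p * nat n ≡ q * nat n → p ≡ q
  *-cancelʳ-nat (suc n) {p} {q} eq = *-cancel-nat n (trans (ℚP.*-comm (nat (suc n)) p) (trans eq (ℚP.*-comm q (nat (suc n)))))

  nat-^ : ∀ m k → nat (m ℕ.^ k) ≡ nat m ^ k
  nat-^ m zero    = refl
  nat-^ m (suc k) = trans (nat-* m (m ℕ.^ k)) (cong (nat m *_) (nat-^ m k))

  b-central : ∀ k → b k * nat 4 ^ k * (2ℚ * nat k - 1ℚ) ≡ signℚ k * nat ((2 ℕ.* k) C k)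
  b-central k = *-cancelʳ-nat (k ! ℕ.* k !) {{ℕP.m*n≢0 (k !) (k !) {{k ℕP.!≢0}} {{k ℕP.!≢0}}}} (begin
      b k * nat 4 ^ k * (2ℚ * nat k - 1ℚ) * nat (k ! ℕ.* k !)         ≡⟨ cong (b k * nat 4 ^ k * (2ℚ * nat k - 1ℚ) *_) (nat-* (k !) (k !)) ⟩
      b k * nat 4 ^ k * (2ℚ * nat k - 1ℚ) * (nat (k !) * nat (k !))   ≡⟨ b-factorial k ⟩
      signℚ k * nat ((2 ℕ.* k) !)                                       ≡⟨ cong (λ z → signℚ k * nat z) (central k) ⟨
      signℚ k * nat (((2 ℕ.* k) C k) ℕ.* (k ! ℕ.* k !))                 ≡⟨ cong (signℚ k *_) (nat-* ((2 ℕ.* k) C k) (k ! ℕ.* k !)) ⟩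
      signℚ k * (nat ((2 ℕ.* k) C k) * nat (k ! ℕ.* k !))               ≡⟨ ℚP.*-assoc (signℚ k) (nat ((2 ℕ.* k) C k)) (nat (k ! ℕ.* k !)) ⟨
      signℚ k * nat ((2 ℕ.* k) C k) * nat (k ! ℕ.* k !)                 ∎)
    where open ≡-Reasoning

  -- Since fractions are stored in lowest terms, equations with `_/_` are established by clearing
  -- the denominator.
  /-unique : ∀ z d .{{_ : ℕ.NonZero d}} {q} → q * nat d ≡ z / 1 → z / d ≡ q
  /-unique z d eq = *-cancelʳ-nat d (trans (/-nat z d) (sym eq))

  -- The 8^K in the denominator is 4^K from binom(1/2,K) times 2^K from expanding at x = 1/(2m).
  coeff≡ : ∀ k → coeff (suc k) ≡ b (suc k) * ½ ^ suc k
  coeff≡ k = /-unique (sign K ℤ.* ℤ.+ c) (m ℕ.* 8 ℕ.^ K) {{_}} (begin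
      b K * ½ ^ K * nat (m ℕ.* 8 ℕ.^ K)                ≡⟨ cong (b K * ½ ^ K *_) (trans (nat-* m (8 ℕ.^ K)) (cong₂ _*_ m≡ (nat-^ 8 K))) ⟩
      b K * ½ ^ K * ((2ℚ * nat K - 1ℚ) * nat 8 ^ K)    ≡⟨ solve 4 (λ β h m e → β :* h :* (m :* e) := β :* (h :* e) :* m) refl (b K) (½ ^ K) (2ℚ * nat K - 1ℚ) (nat 8 ^ K) ⟩
      b K * (½ ^ K * nat 8 ^ K) * (2ℚ * nat K - 1ℚ)    ≡⟨ cong (λ z → b K * z * (2ℚ * nat K - 1ℚ)) (^-distrib-* ½ (nat 8) K) ⟨
      b K * nat 4 ^ K * (2ℚ * nat K - 1ℚ)              ≡⟨ b-central K ⟩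
      signℚ K * nat c                                    ≡⟨ cong (signℚ K *_) (nat≡/1 c) ⟩
      signℚ K * (ℤ.+ c / 1)                              ≡⟨ /1-* (sign K) (ℤ.+ c) ⟨
      (sign K ℤ.* ℤ.+ c) / 1                           ∎)
    where
    open ≡-Reasoning
    K = suc k
    m = 2 ℕ.* K ℕ.∸ 1
    c = (2 ℕ.* K) C K
    m≡ : nat m ≡ 2ℚ * nat K - 1ℚ
    m≡ = trans (nat-+ k (suc (k ℕ.+ 0))) (trans (cong (λ z → nat k + (1ℚ + nat z)) (ℕP.+-identityʳ k))
      (solve 1 (λ n → n :+ (con 1ℚ :+ n) := con 2ℚ :* (con 1ℚ :+ n) :- con 1ℚ) refl (nat k)))

-- The Cauchy reals as a complete ordered ring with square roots.

module RealField where
  open import Data.Nat as ℕ using (ℕ; suc)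
  import Data.Nat.Properties as ℕP
  import Data.Integer as ℤ
  open import Data.Rational as ℚ using (ℚ; 0ℚ; 1ℚ; ½)
  import Data.Rational.Properties as ℚP
  open import Data.Rational.Solver using (module +-*-Solver)
  open import Data.Product using (_×_; _,_; ∃-syntax; proj₁; proj₂)
  open import Data.Sum using (_⊎_; inj₁; inj₂)
  open import Data.Empty using (⊥-elim)
  open import Relation.Nullary using (¬_; yes; no)
  open import Relation.Binary.PropositionalEquality hiding (J)
  open import Algebra.Bundles using (CommutativeRing)
  open import Level using (0ℓ)
  open Rationals using (nat; inv; 2ℚ)
  open OrderedFields using (SqrtField; 0<½*; ½*+½*)
  open import Defs
  open Coefficients using (/-unique)
  open +-*-Solver

  Eventually : (ℕ → Set) → Set
  Eventually p = ∃[ N ] (∀ n → N ℕ.≤ n → p n)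

  zipWith : ∀ {p q r : ℕ → Set} → (∀ n → p n → q n → r n) → Eventually p → Eventually q → Eventually r
  zipWith f (M , hM) (N , hN) = M ℕ.⊔ N , λ n ≤n →
    f n (hM n (ℕP.m⊔n≤o⇒m≤o M N ≤n)) (hN n (ℕP.m⊔n≤o⇒n≤o M N ≤n))

  mapE : ∀ {p q : ℕ → Set} → (∀ n → p n → q n) → Eventually p → Eventually q
  mapE f (N , hN) = N , λ n ≤n → f n (hN n ≤n)

  Null : (ℕ → ℚ) → Set
  Null z = ∀ ε → 0ℚ ℚ.< ε → Eventually (λ n → ℚ.∣ z n ∣ ℚ.< ε)

  null-cong : ∀ {z w : ℕ → ℚ} → (∀ n → z n ≡ w n) → Null z → Null w
  null-cong eq hz ε 0<ε = mapE (λ n → subst (λ q → ℚ.∣ q ∣ ℚ.< ε) (eq n)) (hz ε 0<ε)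

  null-0 : Null (λ _ → 0ℚ)
  null-0 ε 0<ε = 0 , λ _ _ → 0<ε

  null-neg : ∀ {z : ℕ → ℚ} → Null z → Null (λ n → ℚ.- z n)
  null-neg {z} hz ε 0<ε = mapE (λ n → subst (ℚ._< ε) (sym (ℚP.∣-p∣≡∣p∣ (z n)))) (hz ε 0<ε)

  null-+ : ∀ {z w : ℕ → ℚ} → Null z → Null w → Null (λ n → z n ℚ.+ w n)
  null-+ {z} {w} hz hw ε 0<ε = zipWith
    (λ n a b → ℚP.≤-<-trans (ℚP.∣p+q∣≤∣p∣+∣q∣ (z n) (w n)) (subst (ℚ.∣ z n ∣ ℚ.+ ℚ.∣ w n ∣ ℚ.<_) (½*+½* ε) (ℚP.+-mono-< a b)))
    (hz (½ ℚ.* ε) (0<½* 0<ε)) (hw (½ ℚ.* ε) (0<½* 0<ε))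

  null-* : ∀ {z w : ℕ → ℚ} B → 0ℚ ℚ.< B → Eventually (λ n → ℚ.∣ w n ∣ ℚ.≤ B) → Null z → Null (λ n → z n ℚ.* w n)
  null-* {z} {w} B 0<B hw hz ε 0<ε = zipWith
      (λ n a b → ℚP.≤-<-trans
        (Rationals.∣*∣≤ {z n} {w n} (ℚP.≤-refl) b)
        (subst (ℚ.∣ z n ∣ ℚ.* B ℚ.<_) eq (ℚP.*-monoˡ-<-pos B a)))
      (hz (ε ℚ.* r) 0<δ) hw
    where
    instance
      posB : ℚ.Positive B
      posB = ℚ.positive 0<B
      nzB : ℚ.NonZero B
      nzB = ℚP.pos⇒nonZero B
    r : ℚ
    r = ℚ.1/ B
    instance
      posr : ℚ.Positive r
      posr = ℚP.1/pos⇒pos B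
    0<δ : 0ℚ ℚ.< ε ℚ.* r
    0<δ = subst (ℚ._< ε ℚ.* r) (ℚP.*-zeroˡ r) (ℚP.*-monoˡ-<-pos r 0<ε)
    eq : ε ℚ.* r ℚ.* B ≡ ε
    eq = trans (ℚP.*-assoc ε r B) (trans (cong (ε ℚ.*_) (ℚP.*-inverseˡ B)) (ℚP.*-identityʳ ε))

  ∣-∣<⇒< : ∀ p q {ε} → ℚ.∣ p ℚ.- q ∣ ℚ.< ε → p ℚ.< q ℚ.+ ε
  ∣-∣<⇒< p q {ε} h = subst (ℚ._< q ℚ.+ ε) (solve 2 (λ p q → q :+ (p :- q) := p) refl p q)
    (ℚP.+-monoʳ-< q (ℚP.≤-<-trans (Rationals.p≤∣p∣ (p ℚ.- q)) h))

  ∣-∣-sym : ∀ p q → ℚ.∣ p ℚ.- q ∣ ≡ ℚ.∣ q ℚ.- p ∣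
  ∣-∣-sym p q = trans (sym (ℚP.∣-p∣≡∣p∣ (p ℚ.- q))) (cong ℚ.∣_∣ (solve 2 (λ p q → :- (p :- q) := q :- p) refl p q))

  ∣∣<-intro : ∀ {p ε} → p ℚ.< ε → ℚ.- p ℚ.< ε → ℚ.∣ p ∣ ℚ.< ε
  ∣∣<-intro {p} h k with ℚP.∣p∣≡p∨∣p∣≡-p p
  ... | inj₁ e = subst (ℚ._< _) (sym e) h
  ... | inj₂ e = subst (ℚ._< _) (sym e) k

  <⇒∣-∣< : ∀ p q {ε} → p ℚ.< q ℚ.+ ε → q ℚ.< p ℚ.+ ε → ℚ.∣ p ℚ.- q ∣ ℚ.< ε
  <⇒∣-∣< p q {ε} h k = ∣∣<-intro
    (subst (p ℚ.- q ℚ.<_) (solve 2 (λ q ε → q :+ ε :- q := ε) refl q ε) (ℚP.+-monoˡ-< (ℚ.- q) h))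
    (subst₂ ℚ._<_ (solve 2 (λ p q → q :- p := :- (p :- q)) refl p q) (solve 2 (λ p ε → p :+ ε :- p := ε) refl p ε) (ℚP.+-monoˡ-< (ℚ.- p) k))

  ∣-∣<-trans : ∀ p q r {δ ε} → ℚ.∣ p ℚ.- q ∣ ℚ.< δ → ℚ.∣ q ℚ.- r ∣ ℚ.< ε → ℚ.∣ p ℚ.- r ∣ ℚ.< δ ℚ.+ ε
  ∣-∣<-trans p q r {δ} {ε} h k = subst (λ z → ℚ.∣ z ∣ ℚ.< δ ℚ.+ ε) (solve 3 (λ p q r → (p :- q) :+ (q :- r) := p :- r) refl p q r)
    (ℚP.≤-<-trans (ℚP.∣p+q∣≤∣p∣+∣q∣ (p ℚ.- q) (q ℚ.- r)) (ℚP.+-mono-< h k))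

  p<p+ε : ∀ p {ε} → 0ℚ ℚ.< ε → p ℚ.< p ℚ.+ ε
  p<p+ε p {ε} 0<ε = subst (ℚ._< p ℚ.+ ε) (ℚP.+-identityʳ p) (ℚP.+-monoʳ-< p 0<ε)

  bounded : ∀ x → ∃[ B ] (0ℚ ℚ.< B × Eventually (λ n → ℚ.∣ seq x n ∣ ℚ.≤ B))
  bounded x = let N , h = cauchy x 1ℚ (ℚP.positive⁻¹ 1ℚ) in
    1ℚ ℚ.+ ℚ.∣ seq x N ∣ , ℚP.+-mono-<-≤ (ℚP.positive⁻¹ 1ℚ) (ℚP.0≤∣p∣ (seq x N)) , N , λ n N≤n →
      subst (λ z → ℚ.∣ z ∣ ℚ.≤ 1ℚ ℚ.+ ℚ.∣ seq x N ∣) (solve 2 (λ p q → (p :- q) :+ q := p) refl (seq x n) (seq x N))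
        (Rationals.∣+∣≤ {seq x n ℚ.- seq x N} {seq x N} (ℚP.<⇒≤ (h n N N≤n ℕP.≤-refl)) ℚP.≤-refl)

  ≈-pointwise : ∀ x y → (∀ n → seq x n ≡ seq y n) → x ≈ y
  ≈-pointwise x y eq = null-cong (λ n → trans (sym (ℚP.+-inverseʳ (seq y n))) (cong (ℚ._- seq y n) (sym (eq n)))) null-0

  *-cong : ∀ x y v w → x ≈ y → v ≈ w → x * v ≈ y * w
  *-cong x y v w x≈y v≈w = let A , 0<A , hA = bounded v ; B , 0<B , hB = bounded y in
    null-cong (λ n → solve 4 (λ x y v w → (x :- y) :* v :+ (v :- w) :* y := x :* v :- y :* w) refl (seq x n) (seq y n) (seq v n) (seq w n))
      (null-+ {λ n → (seq x n ℚ.- seq y n) ℚ.* seq v n} {λ n → (seq v n ℚ.- seq w n) ℚ.* seq y n}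
        (null-* {λ n → seq x n ℚ.- seq y n} {seq v} A 0<A hA x≈y)
        (null-* {λ n → seq v n ℚ.- seq w n} {seq y} B 0<B hB v≈w))

  ℝ-commutativeRing : CommutativeRing 0ℓ 0ℓ
  ℝ-commutativeRing = record
    { Carrier = ℝ ; _≈_ = _≈_ ; _+_ = _+_ ; _*_ = _*_ ; -_ = -_ ; 0# = 0ℝ ; 1# = 1ℝ
    ; isCommutativeRing = record
      { isRing = record
        { +-isAbelianGroup = record
          { isGroup = record
            { isMonoid = record
              { isSemigroup = record
                { isMagma = record
                  { isEquivalence = record
                    { refl  = λ {x} → ≈-pointwise x x (λ _ → refl)
                    ; sym   = λ {x} {y} h → null-cong (λ n → solve 2 (λ x y → :- (x :- y) := y :- x) refl (seq x n) (seq y n)) (null-neg {λ n → seq x n ℚ.- seq y n} h)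
                    ; trans = λ {x} {y} {z} h k → null-cong (λ n → solve 3 (λ x y z → (x :- y) :+ (y :- z) := x :- z) refl (seq x n) (seq y n) (seq z n))
                                (null-+ {λ n → seq x n ℚ.- seq y n} {λ n → seq y n ℚ.- seq z n} h k) }
                  ; ∙-cong = λ {x} {y} {v} {w} h k → null-cong (λ n → solve 4 (λ x y v w → (x :- y) :+ (v :- w) := (x :+ v) :- (y :+ w)) refl (seq x n) (seq y n) (seq v n) (seq w n))
                                (null-+ {λ n → seq x n ℚ.- seq y n} {λ n → seq v n ℚ.- seq w n} h k) }
                ; assoc = λ x y z → ≈-pointwise (x + y + z) (x + (y + z)) (λ n → ℚP.+-assoc (seq x n) (seq y n) (seq z n)) }
              ; identity = (λ x → ≈-pointwise (0ℝ + x) x (λ n → ℚP.+-identityˡ (seq x n)))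
                         , (λ x → ≈-pointwise (x + 0ℝ) x (λ n → ℚP.+-identityʳ (seq x n))) }
            ; inverse = (λ x → ≈-pointwise (- x + x) 0ℝ (λ n → ℚP.+-inverseˡ (seq x n)))
                      , (λ x → ≈-pointwise (x + - x) 0ℝ (λ n → ℚP.+-inverseʳ (seq x n)))
            ; ⁻¹-cong = λ {x} {y} h → null-cong (λ n → solve 2 (λ x y → :- (x :- y) := (:- x) :- (:- y)) refl (seq x n) (seq y n)) (null-neg {λ n → seq x n ℚ.- seq y n} h) }
          ; comm = λ x y → ≈-pointwise (x + y) (y + x) (λ n → ℚP.+-comm (seq x n) (seq y n)) }
        ; *-cong = λ {x} {y} {v} {w} → *-cong x y v w
        ; *-assoc = λ x y z → ≈-pointwise (x * y * z) (x * (y * z)) (λ n → ℚP.*-assoc (seq x n) (seq y n) (seq z n))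
        ; *-identity = (λ x → ≈-pointwise (1ℝ * x) x (λ n → ℚP.*-identityˡ (seq x n)))
                     , (λ x → ≈-pointwise (x * 1ℝ) x (λ n → ℚP.*-identityʳ (seq x n)))
        ; distrib = (λ x y z → ≈-pointwise (x * (y + z)) (x * y + x * z) (λ n → ℚP.*-distribˡ-+ (seq x n) (seq y n) (seq z n)))
                  , (λ x y z → ≈-pointwise ((y + z) * x) (y * x + z * x) (λ n → ℚP.*-distribʳ-+ (seq x n) (seq y n) (seq z n))) }
      ; *-comm = λ x y → ≈-pointwise (x * y) (y * x) (λ n → ℚP.*-comm (seq x n) (seq y n)) } }

  -- Order

  ≤-reflexive : ∀ x y → x ≈ y → x ≤ y
  ≤-reflexive x y h ε 0<ε = mapE (λ n → ∣-∣<⇒< (seq x n) (seq y n)) (h ε 0<ε)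

  ≤-trans : ∀ x y z → x ≤ y → y ≤ z → x ≤ z
  ≤-trans x y z h k ε 0<ε = zipWith (λ n a b → ℚP.<-trans a (subst (seq y n ℚ.+ ½ ℚ.* ε ℚ.<_)
      (trans (ℚP.+-assoc (seq z n) (½ ℚ.* ε) (½ ℚ.* ε)) (cong (λ e → seq z n ℚ.+ e) (½*+½* ε))) (ℚP.+-monoˡ-< (½ ℚ.* ε) b)))
    (h (½ ℚ.* ε) (0<½* 0<ε)) (k (½ ℚ.* ε) (0<½* 0<ε))

  ≤-antisym : ∀ x y → x ≤ y → y ≤ x → x ≈ y
  ≤-antisym x y h k ε 0<ε = zipWith (λ n → <⇒∣-∣< (seq x n) (seq y n)) (h ε 0<ε) (k ε 0<ε)

  +-mono-≤ : ∀ x y v w → x ≤ y → v ≤ w → x + v ≤ y + w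
  +-mono-≤ x y v w h k ε 0<ε = zipWith (λ n a b → subst (seq x n ℚ.+ seq v n ℚ.<_)
      (trans (solve 3 (λ y w e → (y :+ e) :+ (w :+ e) := (y :+ w) :+ (e :+ e)) refl (seq y n) (seq w n) (½ ℚ.* ε)) (cong (λ e → seq y n ℚ.+ seq w n ℚ.+ e) (½*+½* ε)))
      (ℚP.+-mono-< a b))
    (h (½ ℚ.* ε) (0<½* 0<ε)) (k (½ ℚ.* ε) (0<½* 0<ε))

  ≤-pointwise : ∀ x y → (∀ n → seq x n ℚ.≤ seq y n) → x ≤ y
  ≤-pointwise x y h ε 0<ε = 0 , λ n _ → ℚP.≤-<-trans (h n) (p<p+ε (seq y n) 0<ε)

  -- Overlapping alternatives can be decided. From index L on both sequences move by less than η, so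
  -- testing the rationals at L against the threshold 4η leaves room for the drift on either side.
  compare : ∀ x y η → 0ℚ ℚ.< η →
    Eventually (λ n → seq x n ℚ.< seq y n ℚ.+ nat 6 ℚ.* η) ⊎ Eventually (λ n → seq y n ℚ.+ η ℚ.< seq x n)
  compare x y η 0<η with cauchy x η 0<η | cauchy y η 0<η
  ... | M , hM | N , hN with seq x L ℚP.<? seq y L ℚ.+ nat 4 ℚ.* η
    where L = M ℕ.⊔ N
  ... | yes lt = inj₁ (L , λ n L≤n → begin-strict
        seq x n                                  <⟨ ∣-∣<⇒< (seq x n) (seq x L) (hM n L (ℕP.m⊔n≤o⇒m≤o M N L≤n) (ℕP.m≤m⊔n M N)) ⟩
        seq x L ℚ.+ η                            <⟨ ℚP.+-monoˡ-< η lt ⟩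
        seq y L ℚ.+ nat 4 ℚ.* η ℚ.+ η            <⟨ ℚP.+-monoˡ-< η (ℚP.+-monoˡ-< (nat 4 ℚ.* η) (∣-∣<⇒< (seq y L) (seq y n) (hN L n (ℕP.m≤n⊔m M N) (ℕP.m⊔n≤o⇒n≤o M N L≤n)))) ⟩
        seq y n ℚ.+ η ℚ.+ nat 4 ℚ.* η ℚ.+ η      ≡⟨ solve 2 (λ y e → y :+ e :+ con (nat 4) :* e :+ e := y :+ con (nat 6) :* e) refl (seq y n) η ⟩
        seq y n ℚ.+ nat 6 ℚ.* η                  ∎)
    where
    L = M ℕ.⊔ N
    open ℚP.≤-Reasoning
  ... | no ¬lt = inj₂ (L , λ n L≤n → ℚP.≤-<-trans (Rationals.0≤⇒≤ (η ℚ.+ 0ℚ) (solve 2 (λ y e → y :+ con (nat 4) :* e :+ :- (con 2ℚ :* e) := y :+ e :+ (e :+ con 0ℚ)) refl (seq y n) η) (Rationals.0≤+ (ℚP.<⇒≤ 0<η) ℚP.≤-refl))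
        (begin-strict
        seq y n ℚ.+ nat 4 ℚ.* η ℚ.- 2ℚ ℚ.* η             <⟨ ℚP.+-monoˡ-< (ℚ.- (2ℚ ℚ.* η)) (ℚP.+-monoˡ-< (nat 4 ℚ.* η) (∣-∣<⇒< (seq y n) (seq y L) (hN n L (ℕP.m⊔n≤o⇒n≤o M N L≤n) (ℕP.m≤n⊔m M N)))) ⟩
        seq y L ℚ.+ η ℚ.+ nat 4 ℚ.* η ℚ.- 2ℚ ℚ.* η       ≡⟨ solve 2 (λ y e → y :+ e :+ con (nat 4) :* e :- con 2ℚ :* e := (y :+ con (nat 4) :* e) :- e) refl (seq y L) η ⟩
        seq y L ℚ.+ nat 4 ℚ.* η ℚ.- η                    ≤⟨ ℚP.+-monoˡ-≤ (ℚ.- η) (ℚP.≮⇒≥ ¬lt) ⟩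
        seq x L ℚ.- η                                    <⟨ ℚP.+-monoˡ-< (ℚ.- η) (∣-∣<⇒< (seq x L) (seq x n) (hM L n (ℕP.m≤m⊔n M N) (ℕP.m⊔n≤o⇒m≤o M N L≤n))) ⟩
        seq x n ℚ.+ η ℚ.- η                              ≡⟨ solve 2 (λ x e → x :+ e :- e := x) refl (seq x n) η ⟩
        seq x n                                          ∎))
    where
    L = M ℕ.⊔ N
    open ℚP.≤-Reasoning

  sixth : ∀ {ε} → 0ℚ ℚ.< ε → 0ℚ ℚ.< inv 5 ℚ.* ε
  sixth {ε} 0<ε = ℚP.*-monoʳ-<-pos (inv 5) 0<ε

  sixths : ∀ ε → nat 6 ℚ.* (inv 5 ℚ.* ε) ≡ ε
  sixths ε = trans (sym (ℚP.*-assoc (nat 6) (inv 5) ε)) (ℚP.*-identityˡ ε)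

  ≤-not-gap : ∀ x y η → 0ℚ ℚ.< η → x ≤ y → ¬ Eventually (λ n → seq y n ℚ.+ η ℚ.< seq x n)
  ≤-not-gap x y η 0<η h k with zipWith (λ n a b → ℚP.<-asym a b) (h η 0<η) k
  ... | N , absurd = absurd N ℕP.≤-refl

  -- The only obstruction `compare` can report is a positive gap, and a gap refutes x ≤ y.
  ≤-stable : ∀ x y → ¬ ¬ (x ≤ y) → x ≤ y
  ≤-stable x y ¬¬h ε 0<ε with compare x y (inv 5 ℚ.* ε) (sixth 0<ε)
  ... | inj₁ (N , hN) = N , λ n N≤n → subst (λ e → seq x n ℚ.< seq y n ℚ.+ e) (sixths ε) (hN n N≤n)
  ... | inj₂ gap      = ⊥-elim (¬¬h (λ h → ≤-not-gap x y (inv 5 ℚ.* ε) (sixth 0<ε) h gap))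

  ≰⇒≥ : ∀ x y → ¬ (x ≤ y) → y ≤ x
  ≰⇒≥ x y ¬h ε 0<ε with compare y x (inv 5 ℚ.* ε) (sixth 0<ε)
  ... | inj₁ (N , hN) = N , λ n N≤n → subst (λ e → seq y n ℚ.< seq x n ℚ.+ e) (sixths ε) (hN n N≤n)
  ... | inj₂ gap      = ⊥-elim (¬h (λ ε′ 0<ε′ → mapE (λ n lt → ℚP.<-trans (p<p+ε (seq x n) (sixth 0<ε)) (ℚP.<-trans lt (p<p+ε (seq y n) 0<ε′))) gap))

  -- If v ≤ w failed, so would x ≤ y, hence y ≤ x and v ≤ w after all; stability removes the double
  -- negation.
  ≤-cases : ∀ x y v w → (x ≤ y → v ≤ w) → (y ≤ x → v ≤ w) → v ≤ w
  ≤-cases x y v w f g = ≤-stable v w (λ ¬h → ¬h (g (≰⇒≥ x y (λ h → ¬h (f h)))))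

  -- The approximations of a nonnegative real may be negative. Replacing it by its absolute value
  -- makes them nonnegative termwise, which is what products need.
  0≤⇒≈∣∣ : ∀ x → 0ℝ ≤ x → x ≈ ∣ x ∣
  0≤⇒≈∣∣ x h ε 0<ε = mapE close (h (½ ℚ.* ε) (0<½* 0<ε))
    where
    close : ∀ n → 0ℚ ℚ.< seq x n ℚ.+ ½ ℚ.* ε → ℚ.∣ seq x n ℚ.- ℚ.∣ seq x n ∣ ∣ ℚ.< ε
    close n lt with ℚP.∣p∣≡p∨∣p∣≡-p (seq x n)
    ... | inj₁ e rewrite e = subst (λ z → ℚ.∣ z ∣ ℚ.< ε) (sym (ℚP.+-inverseʳ (seq x n))) 0<ε
    ... | inj₂ e rewrite e = ∣∣<-intro
        (ℚP.≤-<-trans (ℚP.+-mono-≤ x≤0 (subst (ℚ._≤ 0ℚ) (solve 1 (λ x → x := :- (:- x)) refl (seq x n)) x≤0)) 0<ε)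
        (subst₂ ℚ._<_ (solve 1 (λ x → con 0ℚ :+ :- x :+ :- x := :- (x :- (:- x))) refl (seq x n))
          (trans (solve 2 (λ x e → (x :+ e) :+ :- x :+ e := e :+ e) refl (seq x n) (½ ℚ.* ε)) (½*+½* ε))
          (ℚP.<-trans (ℚP.+-monoˡ-< (ℚ.- seq x n) (ℚP.+-monoˡ-< (ℚ.- seq x n) lt))
            (ℚP.+-monoʳ-< (seq x n ℚ.+ ½ ℚ.* ε ℚ.+ ℚ.- seq x n)
                (subst₂ ℚ._<_ (ℚP.+-identityˡ (ℚ.- seq x n)) (solve 2 (λ x e → x :+ e :+ :- x := e) refl (seq x n) (½ ℚ.* ε)) (ℚP.+-monoˡ-< (ℚ.- seq x n) lt)))))
      where
      x≤0 : seq x n ℚ.≤ 0ℚ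
      x≤0 = subst₂ ℚ._≤_ (trans (cong ℚ.-_ e) (solve 1 (λ x → :- (:- x) := x) refl (seq x n))) refl (ℚP.neg-antimono-≤ (ℚP.0≤∣p∣ (seq x n)))

  0≤* : ∀ x y → 0ℝ ≤ x → 0ℝ ≤ y → 0ℝ ≤ x * y
  0≤* x y h k = ≤-trans 0ℝ (∣ x ∣ * ∣ y ∣) (x * y)
    (≤-pointwise 0ℝ (∣ x ∣ * ∣ y ∣) (λ n → Rationals.0≤* (ℚP.0≤∣p∣ (seq x n)) (ℚP.0≤∣p∣ (seq y n))))
    (≤-reflexive (∣ x ∣ * ∣ y ∣) (x * y) (R.sym {x * y} {∣ x ∣ * ∣ y ∣} (*-cong x (∣ x ∣) y (∣ y ∣) (0≤⇒≈∣∣ x h) (0≤⇒≈∣∣ y k))))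
    where module R = CommutativeRing ℝ-commutativeRing

  archimedean : ∀ x y → (∀ ε → 0ℚ ℚ.< ε → x ≤ y + fromℚ ε) → x ≤ y
  archimedean x y h ε 0<ε = mapE (λ n → subst (seq x n ℚ.<_) (trans (ℚP.+-assoc (seq y n) (½ ℚ.* ε) (½ ℚ.* ε)) (cong (λ e → seq y n ℚ.+ e) (½*+½* ε))))
    (h (½ ℚ.* ε) (0<½* 0<ε) (½ ℚ.* ε) (0<½* 0<ε))

  -- Completeness

  Bounded : ℝ → ℝ → Set
  Bounded x c = (x ≤ c) × (- x ≤ c)

  bounded⇒ : ∀ x y q ε → 0ℚ ℚ.< ε → Bounded (x - y) (fromℚ q) → Eventually (λ n → ℚ.∣ seq x n ℚ.- seq y n ∣ ℚ.< q ℚ.+ ε)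
  bounded⇒ x y q ε 0<ε (h , k) = zipWith (λ n a b → ∣∣<-intro a b) (h ε 0<ε) (k ε 0<ε)

  ⇒bounded : ∀ x y q → Eventually (λ n → ℚ.∣ seq x n ℚ.- seq y n ∣ ℚ.≤ q) → Bounded (x - y) (fromℚ q)
  ⇒bounded x y q h =
    (λ ε 0<ε → mapE (λ n a → ℚP.≤-<-trans (ℚP.≤-trans (Rationals.p≤∣p∣ (seq x n ℚ.- seq y n)) a) (p<p+ε q 0<ε)) h) ,
    (λ ε 0<ε → mapE (λ n a → ℚP.≤-<-trans (ℚP.≤-trans (Rationals.-p≤∣p∣ (seq x n ℚ.- seq y n)) a) (p<p+ε q 0<ε)) h)

  module Complete (y : ℕ → ℝ)
    (hy : ∀ ε → 0ℚ ℚ.< ε → ∃[ N ] (∀ m n → N ℕ.≤ m → N ℕ.≤ n → Bounded (y m - y n) (fromℚ ε))) where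

    -- Diagonal construction: `stage j` selects a member within 1/(j+1) of all later ones, and
    -- `index j` an approximation of it equally close to its own later ones.
    stage : ℕ → ℕ
    stage j = proj₁ (hy (inv j) (Rationals.0<inv j))

    index : ℕ → ℕ
    index j = proj₁ (cauchy (y (stage j)) (inv j) (Rationals.0<inv j))

    diagonal : ℕ → ℚ
    diagonal j = seq (y (stage j)) (index j)

    near-diagonal : ∀ j → Eventually (λ n → ℚ.∣ seq (y (stage j)) n ℚ.- diagonal j ∣ ℚ.< inv j)
    near-diagonal j = index j , λ n ≤n → proj₂ (cauchy (y (stage j)) (inv j) (Rationals.0<inv j)) n (index j) ≤n ℕP.≤-refl

    near-stage : ∀ j m n → stage j ℕ.≤ m → stage j ℕ.≤ n → Eventually (λ i → ℚ.∣ seq (y m) i ℚ.- seq (y n) i ∣ ℚ.< inv j ℚ.+ inv j)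
    near-stage j m n ≤m ≤n = bounded⇒ (y m) (y n) (inv j) (inv j) (Rationals.0<inv j) (proj₂ (hy (inv j) (Rationals.0<inv j)) m n ≤m ≤n)

    -- The path runs through the member s = max(m, `stage k`), which is late enough for both j and
    -- k: two reciprocals at level j lead to s, three at level k lead on to the diagonal.
    late-diagonal : ∀ j k m → stage j ℕ.≤ m →
      Eventually (λ i → ℚ.∣ seq (y m) i ℚ.- diagonal k ∣ ℚ.< (inv j ℚ.+ inv j) ℚ.+ ((inv k ℚ.+ inv k) ℚ.+ inv k))
    late-diagonal j k m ≤m = zipWith
        (λ i a b → ∣-∣<-trans (seq (y m) i) (seq (y s) i) (diagonal k) a b)
        (near-stage j m s ≤m (ℕP.≤-trans ≤m (ℕP.m≤m⊔n m (stage k))))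
        (zipWith (λ i a b → ∣-∣<-trans (seq (y s) i) (seq (y (stage k)) i) (diagonal k) a b)
          (near-stage k s (stage k) (ℕP.m≤n⊔m m (stage k)) ℕP.≤-refl) (near-diagonal k))
      where s = m ℕ.⊔ stage k

    private
      small : ∀ {ε} J j k → inv J ℚ.≤ inv 5 ℚ.* ε → J ℕ.≤ j → J ℕ.≤ k → inv J ℚ.+ ((inv j ℚ.+ inv j) ℚ.+ ((inv k ℚ.+ inv k) ℚ.+ inv k)) ℚ.≤ ε
      small {ε} J j k hJ J≤j J≤k = ℚP.≤-trans (ℚP.+-mono-≤ hJ (ℚP.+-mono-≤ (ℚP.+-mono-≤ j≤ j≤) (ℚP.+-mono-≤ (ℚP.+-mono-≤ k≤ k≤) k≤)))
          (ℚP.≤-reflexive (trans (solve 1 (λ e → e :+ ((e :+ e) :+ ((e :+ e) :+ e)) := con (nat 6) :* e) refl (inv 5 ℚ.* ε)) (sixths ε)))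
        where
        j≤ : inv j ℚ.≤ inv 5 ℚ.* ε
        j≤ = ℚP.≤-trans (Rationals.inv-antimono J≤j) hJ
        k≤ : inv k ℚ.≤ inv 5 ℚ.* ε
        k≤ = ℚP.≤-trans (Rationals.inv-antimono J≤k) hJ

    limit : ℝ
    limit = mkℝ diagonal λ ε 0<ε → let J , hJ = Rationals.archimedean (inv 5 ℚ.* ε) (sixth 0<ε) in
      J , λ j k J≤j J≤k →
        let N , hN = zipWith (λ i a b → ∣-∣<-trans (diagonal j) (seq (y (stage j)) i) (diagonal k)
                          (subst (ℚ._< inv j) (∣-∣-sym (seq (y (stage j)) i) (diagonal j)) a) b)
                        (near-diagonal j) (late-diagonal j k (stage j) ℕP.≤-refl)
        in ℚP.<-≤-trans (hN N ℕP.≤-refl) (ℚP.≤-trans (ℚP.+-monoˡ-≤ ((inv j ℚ.+ inv j) ℚ.+ ((inv k ℚ.+ inv k) ℚ.+ inv k)) (Rationals.inv-antimono J≤j)) (small J j k hJ J≤j J≤k))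

    converges : ∀ ε → 0ℚ ℚ.< ε → ∃[ N ] (∀ n → N ℕ.≤ n → Bounded (y n - limit) (fromℚ ε))
    converges ε 0<ε = let J , hJ = Rationals.archimedean (inv 5 ℚ.* ε) (sixth 0<ε) in
      stage J , λ n ≤n →
        let K , hK = cauchy (y n) (inv J) (Rationals.0<inv J) in
        ⇒bounded (y n) limit ε (J ℕ.⊔ K , λ k ≤k →
          let N , hN = late-diagonal J k n ≤n
              i = N ℕ.⊔ K
          in ℚP.<⇒≤ (ℚP.<-≤-trans
               (∣-∣<-trans (seq (y n) k) (seq (y n) i) (diagonal k) (hK k i (ℕP.m⊔n≤o⇒n≤o J K ≤k) (ℕP.m≤n⊔m N K)) (hN i (ℕP.m≤m⊔n N K)))
               (small J J k hJ ℕP.≤-refl (ℕP.m⊔n≤o⇒m≤o J K ≤k))))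

  -- Square roots

  √approx≡ : ∀ n k → √approx n k ≡ nat ⌊√ n ℕ.* (suc k ℕ.* suc k) ⌋ ℚ.* inv k
  √approx≡ n k = /-unique (ℤ.+ r) (suc k) (trans (ℚP.*-assoc (nat r) (inv k) (nat (suc k)))
      (trans (cong (nat r ℚ.*_) (Rationals.inv-nat k)) (trans (ℚP.*-identityʳ (nat r)) (Rationals.nat≡/1 r))))
    where r = ⌊√ n ℕ.* (suc k ℕ.* suc k) ⌋

  0≤√ : ∀ n → 0ℝ ≤ √ n
  0≤√ n = ≤-pointwise 0ℝ (√ n) (λ k → subst (0ℚ ℚ.≤_) (sym (√approx≡ n k))
    (Rationals.0≤* (Rationals.0≤nat ⌊√ n ℕ.* (suc k ℕ.* suc k) ⌋) (Rationals.0≤inv k)))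

  √approx² : ∀ n k → ℚ.∣ √approx n k ℚ.* √approx n k ℚ.- nat n ∣ ℚ.≤ inv k ℚ.* nat (suc (suc (suc (n ℕ.+ n))))
  √approx² n k = subst (λ q → ℚ.∣ q ℚ.* q ℚ.- nat n ∣ ℚ.≤ inv k ℚ.* nat (suc (suc (suc (n ℕ.+ n))))) (sym (√approx≡ n k))
      (Rationals.∣p∣≤ upper lower)
    where
    open ℚP.≤-Reasoning
    K = nat (suc k)
    N = nat n
    i = inv k
    r = ⌊√ n ℕ.* (suc k ℕ.* suc k) ⌋
    q = nat r ℚ.* i
    nat-nKK : nat (n ℕ.* (suc k ℕ.* suc k)) ≡ N ℚ.* (K ℚ.* K)
    nat-nKK = trans (Rationals.nat-* n (suc k ℕ.* suc k)) (cong (N ℚ.*_) (Rationals.nat-* (suc k) (suc k)))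
    0≤ii : 0ℚ ℚ.≤ i ℚ.* i
    0≤ii = Rationals.0≤* (Rationals.0≤inv k) (Rationals.0≤inv k)
    cancel : N ℚ.* (K ℚ.* K) ℚ.* (i ℚ.* i) ≡ N
    cancel = trans (solve 3 (λ n k i → n :* (k :* k) :* (i :* i) := n :* ((k :* i) :* (k :* i))) refl N K i)
      (trans (cong (λ z → N ℚ.* (z ℚ.* z)) (Rationals.nat-inv k)) (ℚP.*-identityʳ N))
    q²≤n : q ℚ.* q ℚ.≤ N
    q²≤n = begin
      q ℚ.* q                                ≡⟨ solve 2 (λ r i → r :* i :* (r :* i) := r :* r :* (i :* i)) refl (nat r) i ⟩
      nat r ℚ.* nat r ℚ.* (i ℚ.* i)          ≤⟨ ℚP.*-monoʳ-≤-nonNeg (i ℚ.* i) {{ℚ.nonNegative 0≤ii}}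
          (subst₂ ℚ._≤_ (Rationals.nat-* r r) nat-nKK (Rationals.nat-mono (⌊√⌋-lower (n ℕ.* (suc k ℕ.* suc k))))) ⟩
      N ℚ.* (K ℚ.* K) ℚ.* (i ℚ.* i)          ≡⟨ cancel ⟩
      N                                      ∎
    n≤[q+i]² : N ℚ.≤ (q ℚ.+ i) ℚ.* (q ℚ.+ i)
    n≤[q+i]² = begin
      N                                      ≡⟨ cancel ⟨
      N ℚ.* (K ℚ.* K) ℚ.* (i ℚ.* i)          ≤⟨ ℚP.*-monoʳ-≤-nonNeg (i ℚ.* i) {{ℚ.nonNegative 0≤ii}}
          (subst₂ ℚ._≤_ nat-nKK (Rationals.nat-* (suc r) (suc r)) (Rationals.nat-mono (ℕP.<⇒≤ (⌊√⌋-upper (n ℕ.* (suc k ℕ.* suc k)))))) ⟩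
      nat (suc r) ℚ.* nat (suc r) ℚ.* (i ℚ.* i)   ≡⟨ solve 2 (λ r i → (con 1ℚ :+ r) :* (con 1ℚ :+ r) :* (i :* i) := (r :* i :+ i) :* (r :* i :+ i)) refl (nat r) i ⟩
      (q ℚ.+ i) ℚ.* (q ℚ.+ i)                ∎
    0≤q : 0ℚ ℚ.≤ q
    0≤q = Rationals.0≤* (Rationals.0≤nat r) (Rationals.0≤inv k)
    q≤1+n : q ℚ.≤ 1ℚ ℚ.+ N
    q≤1+n with ℚP.≤-total q 1ℚ
    ... | inj₁ q≤1 = ℚP.≤-trans q≤1 (Rationals.1≤nat n)
    ... | inj₂ 1≤q = begin
      q              ≡⟨ ℚP.*-identityʳ q ⟨
      q ℚ.* 1ℚ       ≤⟨ ℚP.*-monoˡ-≤-nonNeg q {{ℚ.nonNegative 0≤q}} 1≤q ⟩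
      q ℚ.* q        ≤⟨ q²≤n ⟩
      N              ≤⟨ Rationals.nat-mono (ℕP.n≤1+n n) ⟩
      1ℚ ℚ.+ N       ∎
    c≡ : nat (suc (suc (suc (n ℕ.+ n)))) ≡ 1ℚ ℚ.+ (1ℚ ℚ.+ (1ℚ ℚ.+ (N ℚ.+ N)))
    c≡ = cong (λ z → 1ℚ ℚ.+ (1ℚ ℚ.+ (1ℚ ℚ.+ z))) (Rationals.nat-+ n n)
    upper : q ℚ.* q ℚ.- N ℚ.≤ i ℚ.* nat (suc (suc (suc (n ℕ.+ n))))
    upper = ℚP.≤-trans (subst (q ℚ.* q ℚ.- N ℚ.≤_) (ℚP.+-inverseʳ N) (ℚP.+-monoˡ-≤ (ℚ.- N) q²≤n)) (Rationals.0≤* (Rationals.0≤inv k) (Rationals.0≤nat (suc (suc (suc (n ℕ.+ n))))))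
    lower : ℚ.- (q ℚ.* q ℚ.- N) ℚ.≤ i ℚ.* nat (suc (suc (suc (n ℕ.+ n))))
    lower = begin
      ℚ.- (q ℚ.* q ℚ.- N)                          ≡⟨ solve 2 (λ q n → :- (q :* q :- n) := n :- q :* q) refl q N ⟩
      N ℚ.- q ℚ.* q                                ≤⟨ ℚP.+-monoˡ-≤ (ℚ.- (q ℚ.* q)) n≤[q+i]² ⟩
      (q ℚ.+ i) ℚ.* (q ℚ.+ i) ℚ.- q ℚ.* q          ≡⟨ solve 2 (λ q i → (q :+ i) :* (q :+ i) :- q :* q := i :* (q :+ q :+ i)) refl q i ⟩
      i ℚ.* (q ℚ.+ q ℚ.+ i)                        ≤⟨ ℚP.*-monoˡ-≤-nonNeg i {{ℚ.nonNegative (Rationals.0≤inv k)}} (ℚP.+-mono-≤ (ℚP.+-mono-≤ q≤1+n q≤1+n) (Rationals.inv≤1 k)) ⟩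
      i ℚ.* (1ℚ ℚ.+ N ℚ.+ (1ℚ ℚ.+ N) ℚ.+ 1ℚ)       ≡⟨ solve 2 (λ i n → i :* (con 1ℚ :+ n :+ (con 1ℚ :+ n) :+ con 1ℚ) := i :* (con 1ℚ :+ (con 1ℚ :+ (con 1ℚ :+ (n :+ n))))) refl i N ⟩
      i ℚ.* (1ℚ ℚ.+ (1ℚ ℚ.+ (1ℚ ℚ.+ (N ℚ.+ N))))   ≡⟨ cong (i ℚ.*_) c≡ ⟨
      i ℚ.* nat (suc (suc (suc (n ℕ.+ n))))        ∎

  null-inv : Null inv
  null-inv ε 0<ε = let k , k≤ = Rationals.archimedean (½ ℚ.* ε) (0<½* 0<ε) in k , λ n k≤n →
    subst (ℚ._< ε) (sym (ℚP.0≤p⇒∣p∣≡p (Rationals.0≤inv n))) (ℚP.≤-<-trans (ℚP.≤-trans (Rationals.inv-antimono k≤n) k≤)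
      (subst (½ ℚ.* ε ℚ.<_) (½*+½* ε) (p<p+ε (½ ℚ.* ε) (0<½* 0<ε))))

  √² : ∀ n → √ n * √ n ≈ fromℚ (nat n)
  √² n ε 0<ε = mapE (λ k h → ℚP.≤-<-trans (ℚP.≤-trans (√approx² n k) (Rationals.p≤∣p∣ (inv k ℚ.* c))) h)
      (null-* {inv} {λ _ → c} c (ℚP.positive⁻¹ c {{Rationals.nat-pos (suc (suc (n ℕ.+ n)))}}) (0 , λ _ _ → ℚP.≤-reflexive (ℚP.0≤p⇒∣p∣≡p (Rationals.0≤nat (suc (suc (suc (n ℕ.+ n))))))) null-inv ε 0<ε)
    where c = nat (suc (suc (suc (n ℕ.+ n))))

  ℝ-sqrtField : SqrtField
  ℝ-sqrtField = record
    { commutativeRing = ℝ-commutativeRing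
    ; _≤_          = _≤_
    ; ≤-reflexive  = λ {x} {y} → ≤-reflexive x y
    ; ≤-trans      = λ {x} {y} {z} → ≤-trans x y z
    ; ≤-antisym    = λ {x} {y} → ≤-antisym x y
    ; ≤-cases      = λ {x} {y} {v} {w} → ≤-cases x y v w
    ; +-mono-≤     = λ {x} {y} {v} {w} → +-mono-≤ x y v w
    ; ι            = fromℚ
    ; ι-0          = ≈-pointwise 0ℝ 0ℝ (λ _ → refl)
    ; ι-1          = ≈-pointwise 1ℝ 1ℝ (λ _ → refl)
    ; ι-+          = λ p q → ≈-pointwise (fromℚ (p ℚ.+ q)) (fromℚ p + fromℚ q) (λ _ → refl)
    ; ι-*          = λ p q → ≈-pointwise (fromℚ (p ℚ.* q)) (fromℚ p * fromℚ q) (λ _ → refl)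
    ; ι-neg        = λ p → ≈-pointwise (fromℚ (ℚ.- p)) (- fromℚ p) (λ _ → refl)
    ; ι-mono       = λ {p} {q} h → ≤-pointwise (fromℚ p) (fromℚ q) (λ _ → h)
    ; 0≤*          = λ {x} {y} → 0≤* x y
    ; archimedean  = λ {x} {y} → archimedean x y
    ; complete     = λ y hy → Complete.limit y hy , Complete.converges y hy
    ; √            = √
    ; 0≤√          = 0≤√
    ; √²           = √²
    }

-- Transfer of the abstract results to the stated theorem.

module Comparison where
  open import Data.Nat as ℕ using (ℕ; zero; suc; NonZero)
  import Data.Nat.Properties as ℕP
  open import Data.Nat.DivMod using (_%_; m≡m%n+[m/n]*n) renaming (_/_ to _/ₙ_)
  open import Data.Integer using (+_)
  open import Data.Rational as ℚ using (ℚ; 0ℚ; 1ℚ; ½; _/_)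
  import Data.Rational.Properties as ℚP
  open import Data.Rational.Solver using (module +-*-Solver)
  open import Data.Product using (_×_; _,_; Σ-syntax; ∃-syntax; proj₁; proj₂)
  open import Relation.Nullary.Decidable using (from-yes)
  open import Relation.Binary.PropositionalEquality hiding (J)
  open Rationals using (nat; inv)
  open Coefficients
  open OrderedFields using (SqrtField)
  open RealField using (ℝ-sqrtField; zipWith; mapE; ∣∣<-intro; ≤-antisym)
  open import Defs
  open +-*-Solver

  signℚ≡sgn : ∀ j → signℚ (suc j) ≡ Rationals.sgn j
  signℚ≡sgn zero    = refl
  signℚ≡sgn (suc j) = trans (signℚ-suc (suc j)) (cong ℚ.-_ (signℚ≡sgn j))

  1/^≡inv^ : ∀ j k → (+ 1 / (suc j ℕ.^ k)) {{ℕP.m^n≢0 (suc j) k}} ≡ inv j Rationals.^ k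
  1/^≡inv^ j k = /-unique (+ 1) (suc j ℕ.^ k) {{ℕP.m^n≢0 (suc j) k}}
    (trans (cong (inv j Rationals.^ k ℚ.*_) (nat-^ (suc j) k)) (trans (sym (Rationals.^-distrib-* (inv j) (nat (suc j)) k))
      (trans (cong (Rationals._^ k) (Rationals.inv-nat j)) (1^ k))))
    where
    1^ : ∀ k → 1ℚ Rationals.^ k ≡ 1ℚ
    1^ zero    = refl
    1^ (suc k) = trans (ℚP.*-identityˡ (1ℚ Rationals.^ k)) (1^ k)

  ^-½≡ : ∀ m k .{{_ : NonZero m}} {q} → (+ 1 / (m ℕ.^ k)) {{ℕP.m^n≢0 m k}} ≡ q → (m ^-[ k -½]) ≡ fromℚ q * √ m
  ^-½≡ m k refl = refl

  /2≡½* : ∀ n → + n / 2 ≡ ½ ℚ.* nat n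
  /2≡½* n = /-unique (+ n) 2 (trans (solve 1 (λ n → con ½ :* n :* con (nat 2) := n) refl (nat n)) (Rationals.nat≡/1 n))

  -- One η is the bound, one is the tolerance built into `_≤_`, and one is the gap demanded by
  -- `_<_`.
  ∣∣≤⇒< : ∀ x η → 0ℚ ℚ.< η → ∣ x ∣ ≤ fromℚ η → ∣ x ∣ < fromℚ (η ℚ.+ η ℚ.+ η)
  ∣∣≤⇒< x η 0<η h = η , 0<η , mapE (λ i lt → ℚP.+-monoˡ-< η lt) (h η 0<η)

  -- ℝ is reached only through the approximating sequences: equations between its elements as such would
  -- have to be checked by comparing the proofs that sums and products are Cauchy.
  record Realisation (F : SqrtField) : Set where
    open SqrtField F using (Carrier; ι) renaming (_+_ to _⊕_; _*_ to _⊗_; -_ to ⊖_; _≤_ to _≲_; √ to sqrt)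
    field
      real   : Carrier → ℝ
      real-+ : ∀ x y i → seq (real (x ⊕ y)) i ≡ seq (real x) i ℚ.+ seq (real y) i
      real-* : ∀ x y i → seq (real (x ⊗ y)) i ≡ seq (real x) i ℚ.* seq (real y) i
      real-neg : ∀ x i → seq (real (⊖ x)) i ≡ ℚ.- seq (real x) i
      real-ι : ∀ q i → seq (real (ι q)) i ≡ q
      real-√ : ∀ n i → seq (real (sqrt n)) i ≡ √approx n i
      real-≤ : ∀ x y → x ≲ y → real x ≤ real y

  module Realised (F : SqrtField) (𝓡 : Realisation F) where
    open Realisation 𝓡
    private module R = Constant.Constant F
    open R using (Carrier; ι) renaming (_+_ to _⊕_; _*_ to _⊗_; -_ to ⊖_; _-_ to _⊝_; √ to sqrt)

    infix 4 _≐_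
    -- Termwise equality of approximations, so that Cauchy proofs never enter. Being a record, it
    -- lets both sides be recovered by unification.
    record _≐_ (x : Carrier) (r : ℝ) : Set where
      constructor pointwise
      field at : ∀ i → seq (real x) i ≡ seq r i
    open _≐_

    ≐-real : ∀ x → x ≐ real x
    ≐-real x = pointwise (λ _ → refl)

    ≐-ι : ∀ {q} p → p ≡ q → ι q ≐ fromℚ p
    ≐-ι p refl = pointwise (real-ι p)

    ≐-1 : ι 1ℚ ≐ 1ℝ
    ≐-1 = pointwise (real-ι 1ℚ)

    ≐-√ : ∀ n → sqrt n ≐ √ n
    ≐-√ n = pointwise (real-√ n)

    ≐-+ : ∀ {x y r s} → x ≐ r → y ≐ s → (x ⊕ y) ≐ (r + s)
    ≐-+ {x} {y} h k = pointwise (λ i → trans (real-+ x y i) (cong₂ ℚ._+_ (at h i) (at k i)))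

    ≐-neg : ∀ {x r} → x ≐ r → (⊖ x) ≐ (- r)
    ≐-neg {x} h = pointwise (λ i → trans (real-neg x i) (cong ℚ.-_ (at h i)))

    ≐-- : ∀ {x y r s} → x ≐ r → y ≐ s → (x ⊝ y) ≐ (r - s)
    ≐-- {x} {y} h k = pointwise (λ i → trans (real-+ x (⊖ y) i) (cong₂ ℚ._+_ (at h i) (trans (real-neg y i) (cong ℚ.-_ (at k i)))))

    ≐-* : ∀ {x y r s} → x ≐ r → y ≐ s → (x ⊗ y) ≐ (r * s)
    ≐-* {x} {y} h k = pointwise (λ i → trans (real-* x y i) (cong₂ ℚ._*_ (at h i) (at k i)))

    ≐-sum : ∀ g (f : (j : ℕ) → .{{NonZero j}} → ℝ) → (∀ j → g j ≐ f (suc j)) → ∀ n → R.sum g n ≐ sum₁ n f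
    ≐-sum g f h zero    = pointwise (real-ι 0ℚ)
    ≐-sum g f h (suc n) = pointwise (λ i → trans (real-+ (R.sum g n) (g n) i) (cong₂ ℚ._+_ (at (≐-sum g f h n) i) (at (h n) i)))

    ≤-≐ : ∀ x y r s → x ≐ r → y ≐ s → x R.≤ y → r ≤ s
    ≤-≐ x y r s h k x≤y ε 0<ε = mapE (λ i → subst₂ (λ p q → p ℚ.< q ℚ.+ ε) (at h i) (at k i)) (real-≤ x y x≤y ε 0<ε)

    ∣∣≤-≐ : ∀ x c r d → x ≐ r → c ≐ d → R.∣ x ∣≤ c → ∣ r ∣ ≤ d
    ∣∣≤-≐ x c r d h k (x≤c , -x≤c) ε 0<ε =
      zipWith (λ i → ∣∣<-intro) (≤-≐ x c r d h k x≤c ε 0<ε) (≤-≐ (⊖ x) c (- r) d (≐-neg h) k -x≤c ε 0<ε)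

    ⟶⇒HasSum : ∀ g (f : (j : ℕ) → .{{NonZero j}} → ℝ) x l → (∀ j → g j ≐ f (suc j)) → x ≐ l → R.sum g R.⟶ x → HasSum f l
    -- A third of ε, because `∣∣≤⇒<` triples the bound.
    ⟶⇒HasSum g f x l h k y⟶x ε 0<ε = third-< (inv 2 ℚ.* ε) (ℚP.*-monoʳ-<-pos (inv 2) 0<ε)
        (solve 1 (λ e → con (inv 2) :* e :+ con (inv 2) :* e :+ con (inv 2) :* e := e) refl ε)
      where
      third-< : ∀ η → 0ℚ ℚ.< η → η ℚ.+ η ℚ.+ η ≡ ε → ∃[ N ] (∀ n → N ℕ.≤ n → ∣ sum₁ n f - l ∣ < fromℚ ε)
      third-< η 0<η refl = proj₁ (y⟶x η 0<η) , λ n N≤n →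
        let difference = ≐-- (≐-sum g f h n) k in
        ∣∣≤⇒< (sum₁ n f - l) η 0<η
          (∣∣≤-≐ (R.sum g n ⊝ x) (ι η) (sum₁ n f - l) (fromℚ η) difference (≐-ι η refl) (proj₂ (y⟶x η 0<η) n N≤n))

    ζ : (k : ℕ) → .{{NonZero k}} → ℝ
    ζ k = real (R.ζ (ℕ.pred k))

    ζ≐ : ∀ k → R.ζ k ≐ ζ (suc k)
    ζ≐ k = pointwise (λ _ → refl)

    ζ-term : ∀ k j → R.s k j ≐ suc j ^-[ k -½]
    ζ-term k j = let term = ≐-* (≐-ι (inv j Rationals.^ k) refl) (≐-√ (suc j)) in
      subst (λ r → R.s k j ≐ r) (sym (^-½≡ (suc j) k (1/^≡inv^ j k))) term

    η-summand : (m : ℕ) → .{{NonZero m}} → ℝ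
    η-summand m = fromℚ (sign m / 1) * m ^-[ 1 -½]

    η-sum : ℝ → ℝ
    η-sum z = (1ℝ - √ 2) * z

    η-term : ∀ j → (ι (Rationals.sgn j) ⊗ R.s 1 j) ≐ η-summand (suc j)
    η-term j = let term = ≐-* (≐-ι (sign (suc j) / 1) (signℚ≡sgn j)) (ζ-term 1 j) in term

    η-value : ∀ z → R.ζ 0 ≐ z → ((ι 1ℚ ⊝ sqrt 2) ⊗ R.ζ 0) ≐ η-sum z
    η-value z h = let value = ≐-* (≐-- ≐-1 (≐-√ 2)) h in value

    η-hasSum : ∀ z → R.ζ 0 ≐ z → HasSum η-summand (η-sum z)
    η-hasSum z h = ⟶⇒HasSum (λ j → ι (Rationals.sgn j) ⊗ R.s 1 j) η-summand
      ((ι 1ℚ ⊝ sqrt 2) ⊗ R.ζ 0) (η-sum z) η-term (η-value z h) R.eta⟶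

    ζ[½]-isZeta : ∀ z → R.ζ 0 ≐ z → IsZeta[ 1 -½] z
    ζ[½]-isZeta z h = η-hasSum z h

    ζ-summand : ℕ → (m : ℕ) → .{{NonZero m}} → ℝ
    ζ-summand k m = m ^-[ k -½]

    ζ-hasSum : ∀ k z → R.ζ (suc k) ≐ z → HasSum (ζ-summand (suc (suc k))) z
    ζ-hasSum k z h = ⟶⇒HasSum (R.s (suc (suc k))) (ζ-summand (suc (suc k))) (R.ζ (suc k)) z
      (ζ-term (suc (suc k))) h (R.Y⟶ζ (suc k))

    ζ[k-½]-isZeta : ∀ k z → R.ζ (suc k) ≐ z → IsZeta[ suc (suc k) -½] z
    ζ[k-½]-isZeta k z h = ζ-hasSum k z h

    ζ-isZeta : ∀ k → .{{_ : NonZero k}} → IsZeta[ k -½] (ζ k)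
    ζ-isZeta 1             = ζ[½]-isZeta (ζ 1) (ζ≐ 0)
    ζ-isZeta (suc (suc k)) = ζ[k-½]-isZeta k (ζ (suc (suc k))) (ζ≐ (suc k))

    C : ℝ
    C = real R.C

    C≐ : R.C ≐ C
    C≐ = pointwise (λ _ → refl)

    1+√2S : ℝ
    1+√2S = 1ℝ + √ 2 * real R.S

    1+√2S≐ : (ι 1ℚ ⊕ (sqrt 2 ⊗ R.S)) ≐ 1+√2S
    1+√2S≐ = let sum = ≐-+ ≐-1 (≐-* (≐-√ 2) (≐-real R.S)) in sum

    C≈1+√2S : C ≈ 1+√2S
    C≈1+√2S = ≤-antisym C 1+√2S
      (≤-≐ R.C (ι 1ℚ ⊕ (sqrt 2 ⊗ R.S)) C 1+√2S C≐ 1+√2S≐ (R.≤-reflexive R.C≈))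
      (≤-≐ (ι 1ℚ ⊕ (sqrt 2 ⊗ R.S)) R.C 1+√2S C 1+√2S≐ C≐ (R.≤-reflexive (R.sym R.C≈)))

    C-summand : (k : ℕ) → .{{NonZero k}} → ℝ
    C-summand k = fromℚ (coeff k) * ζ k

    C-term : ∀ k → (ι (Rationals.coef k) ⊗ R.ζ k) ≐ C-summand (suc k)
    C-term k = let term = ≐-* (≐-ι (coeff (suc k)) (coeff≡ k)) (ζ≐ k) in term

    C-hasSum : HasSum C-summand (real R.S)
    C-hasSum = ⟶⇒HasSum (λ k → ι (Rationals.coef k) ⊗ R.ζ k) C-summand R.S (real R.S) C-term (≐-real R.S) R.partial⟶S

    C-isConstant : IsConstantC C
    C-isConstant = ζ , ζ-isZeta , real R.S , C-hasSum , C≈1+√2S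

    A-summand : ℕ → (j : ℕ) → .{{NonZero j}} → ℝ
    A-summand n j = fromℚ (sign j / 1) * √ (j ℕ.* n)

    A-term : ∀ n j → (ι (Rationals.sgn j) ⊗ sqrt (suc j ℕ.* n)) ≐ A-summand n (suc j)
    A-term n j = let term = ≐-* (≐-ι (sign (suc j) / 1) (signℚ≡sgn j)) (≐-√ (suc j ℕ.* n)) in term

    -- The summand, the constant and the rationals are variables tied down by equations, so the
    -- bound is transferred before their concrete forms have to be compared.
    residue-bound : ∀ m (f : (j : ℕ) → .{{NonZero j}} → ℝ) c q₁ q₂ q₃ → let n = suc (m ℕ.* 2) in
      (∀ j → (ι (Rationals.sgn j) ⊗ sqrt (suc j ℕ.* n)) ≐ f (suc j)) → R.C ≐ c → q₁ ≡ ½ ℚ.* nat n → q₂ ≡ Rationals.⅛ → q₃ ≡ inv (m ℕ.* 2) →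
      ∣ sum₁ n f - fromℚ q₁ - c * √ n - fromℚ q₂ ∣ ≤ fromℚ (nat 3) * fromℚ q₃
    residue-bound m f c q₁ q₂ q₃ h C≐c refl refl refl =
      let n     = suc (m ℕ.* 2)
          S     = R.sum (λ j → ι (Rationals.sgn j) ⊗ sqrt (suc j ℕ.* n)) n
          main  = ≐-sum (λ j → ι (Rationals.sgn j) ⊗ sqrt (suc j ℕ.* n)) f h n
          total = ≐-- (≐-- (≐-- main (≐-ι q₁ refl)) (≐-* C≐c (≐-√ n))) (≐-ι q₂ refl)
          error = ≐-* (≐-ι (nat 3) refl) (≐-ι q₃ refl)
      in ∣∣≤-≐ (S ⊝ ι q₁ ⊝ (R.C ⊗ sqrt n) ⊝ ι q₂) (ι (nat 3) ⊗ ι q₃) (sum₁ n f - fromℚ q₁ - c * √ n - fromℚ q₂) (fromℚ (nat 3) * fromℚ q₃)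
           total error (R.asymptotics m)

    residue-bound-odd : ∀ m (n : ℕ) → .{{_ : NonZero n}} → n ≡ suc (m ℕ.* 2) →
      ∣ sum₁ n (λ j → fromℚ (sign j / 1) * √ (j ℕ.* n)) - fromℚ (+ n / 2) - C * √ n - fromℚ (+ 1 / 8) ∣ ≤ fromℚ (nat 3) * fromℚ (+ 1 / n)
    residue-bound-odd m n refl = residue-bound m (λ j → fromℚ (sign j / 1) * √ (j ℕ.* n)) C (+ n / 2) (+ 1 / 8) (+ 1 / n)
      (A-term n) C≐ (/2≡½* n) refl refl

    result : Σ[ C ∈ ℝ ] (IsConstantC C ×
      Σ[ K ∈ ℝ ] (0ℝ < K ×
      (∀ (n : ℕ) → .{{_ : NonZero n}} → n % 2 ≡ 1 →
      ∣ sum₁ n (λ j → fromℚ (sign j / 1) * √ (j ℕ.* n))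
      - fromℚ (+ n / 2) - C * √ n - fromℚ (+ 1 / 8) ∣
      ≤ K * fromℚ (+ 1 / n))))
    result = C , C-isConstant , fromℚ (nat 3)
      -- The constant is K = 3, inherited from the bound 3/n² on B - C; the gap 1 witnesses its
      -- positivity.
      , (1ℚ , ℚP.positive⁻¹ 1ℚ , 0 , λ _ _ → from-yes ((0ℚ ℚ.+ 1ℚ) ℚP.<? nat 3))
      , λ n odd → residue-bound-odd (n /ₙ 2) n (trans (m≡m%n+[m/n]*n n 2) (cong (ℕ._+ n /ₙ 2 ℕ.* 2) odd))

open import Data.Nat as ℕ using (ℕ; NonZero)
open import Data.Nat.DivMod using (_%_)
open import Data.Integer using (+_)
open import Data.Rational using (½; _/_)
open import Data.Product using (_×_; Σ-syntax)
open import Relation.Binary.PropositionalEquality using (_≡_; refl)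
open import Defs

mainTheorem2 : Σ[ C ∈ ℝ ] (IsConstantC C ×
    Σ[ K ∈ ℝ ] (0ℝ < K ×
    (∀ (n : ℕ) → .{{_ : NonZero n}} → n % 2 ≡ 1 →
    ∣ sum₁ n (λ j → fromℚ (sign j / 1) * √ (j ℕ.* n))
    - fromℚ (+ n / 2) - C * √ n - fromℚ (+ 1 / 8) ∣
    ≤ K * fromℚ (+ 1 / n))))
-- The abstract ring is now ℝ itself, so the realisation is the identity and its laws hold by
-- computation.
mainTheorem2 = Comparison.Realised.result RealField.ℝ-sqrtField (record
  { real = λ x → x
  ; real-+ = λ _ _ _ → refl
  ; real-* = λ _ _ _ → refl
  ; real-neg = λ _ _ → refl
  ; real-ι = λ _ _ → refl
  ; real-√ = λ _ _ → refl
  ; real-≤ = λ _ _ x≤y → x≤y })
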